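{- Let $P,Q$ be Dyck paths of semilength $n$. There exists a permutation $\alpha\in S_n$ with $\lambda(\alpha)=P$ and $\mu(\alpha)=Q$ if and only if $L'(Q)\le P$ and $L'(P)\le Q$.
   Context: Dyck path of semilength $n$: lattice path from $(0,0)$ to $(2n,0)$ with steps $U=(1,1)$, $D=(1,-1)$, never below the $x$-axis. A return is a down step ending on the $x$-axis; a Dyck path is irreducible if it has exactly one return; every Dyck path factors uniquely as $P=P_1\cdots P_r$ with each $P_i$ irreducible (its irreducible components). If $P$ has ascents (maximal runs of $U$) of lengths $a_1,\dots,a_k$ and descents of lengths $d_1,\dots,d_k$ (left to right), with $A_i=a_1+\dots+a_i$, $D_i=d_1+\dots+d_i$, its ascent-descent code is $(A,D)$, $A=A_1,\dots,A_{k-1}$, $D=D_1,\dots,D_{k-1}$; this determines $P$. $P$ is irreducible iff $A_i>D_i$ for all $i$. Order $\le$: for irreducible $P,Q$ of the same semilength with $P$ having code $A=A_1,\dots,A_k$, $D=D_1,\dots,D_k$, $Q$ covers $P$ if the ascent code of $Q$ is obtained from $A$ by deleting some $A_i$ and the descent code of $Q$ is obtained from $D$ by deleting some $D_j$ with $j\ge i$. On irreducible paths, $\le$ is the reflexive-transitive closure of this covering relation. For arbitrary Dyck paths with irreducible decompositions $P=P_1\cdots P_r$, $Q=Q_1\cdots Q_s$, $P\le Q$ iff $r=s$ and $P_i\le Q_i$ for all $i$. The map $L'$: for an irreducible path $P$ of semilength $n$ with code $A=A_1,\dots,A_h$, $D=D_1,\dots,D_h$, let $\{\hat A_1>\dots>\hat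 A_{n-2-h}\}=\{1,\dots,n-2\}\setminus\{A_1-1,\dots,A_h-1\}$ and $\{\hat D_1>\dots>\hat D_{n-2-h}\}=\{1,\dots,n-2\}\setminus\{D_1,\dots,D_h\}$; $L'(P)$ is the irreducible Dyck path of semilength $n$ with code $A'_i=n-\hat A_i$, $D'_i=n-1-\hat D_i$. For a general path, $L'(P_1\cdots P_r)=L'(P_r)\cdots L'(P_1)$. For $\sigma=x_1\cdots x_n$: $x_i$ is a left-to-right (LTR) minimum if $x_i<x_j$ for all $j<i$; $x_i$ is a right-to-left (RTL) maximum if $x_i>x_j$ for all $j>i$. $\lambda(\sigma)$: write $\sigma=m_1w_1\cdots m_kw_k$ with $m_1>\dots>m_k$ the LTR minima and $w_i$ possibly empty words, $m_0=n+1$; $\lambda(\sigma)=U^{m_0-m_1}D^{|w_1|+1}\cdots U^{m_{k-1}-m_k}D^{|w_k|+1}$. $\mu(\sigma)$: write $\sigma=u_hM_h\cdots u_1M_1$ with $M_1<\dots<M_h$ the RTL maxima and $u_i$ possibly empty words, $M_0=0$; $\mu(\sigma)=U^{M_1-M_0}D^{|u_1|+1}U^{M_2-M_1}D^{|u_2|+1}\cdots U^{M_h-M_{h-1}}D^{|u_h|+1}$. -}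

module Defs where

open import Data.Bool using (if_then_else_)
open import Data.Nat using (ℕ; zero; suc; pred; _+_; _∸_; _*_; ⌊_/2⌋)
import Data.Nat as ℕ
import Data.Nat.Properties as ℕ
open import Data.Fin using (Fin; toℕ; _<_)
open import Data.Fin.Properties using (all?; _<?_)
open import Data.Fin.Permutation using (Permutation′; _⟨$⟩ʳ_)
open import Data.List using (List; []; _∷_; _++_; _∷ʳ_; map; foldr; foldl; concat; concatMap; reverse; length; replicate; filter; zip; downFrom; allFin; removeAt)
open import Data.List.Membership.DecPropositional ℕ._≟_ using (_∈?_)
open import Data.List.Relation.Binary.Pointwise using (Pointwise)
open import Data.Product using (_×_; _,_; proj₁; proj₂)
open import Relation.Binary.Construct.Closure.ReflexiveTransitive using (Star)
open import Relation.Binary.PropositionalEquality using (_≡_)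
open import Relation.Nullary using (Dec; does; ¬?)
open import Relation.Nullary.Decidable using (_→-dec_)

data Step : Set where
  U D : Step

Path : Set
Path = List Step

-- `DyckFrom h P`: starting at height h, the path P never goes below the
-- x-axis and ends on it.
data DyckFrom : ℕ → Path → Set where
  end  : DyckFrom 0 []
  up   : ∀ {h P} → DyckFrom (suc h) P → DyckFrom h (U ∷ P)
  down : ∀ {h P} → DyckFrom h P → DyckFrom (suc h) (D ∷ P)

record IsDyck (n : ℕ) (P : Path) : Set where
  field
    dyck       : DyckFrom 0 P
    endsAt[2n] : length P ≡ 2 * n

semilength : Path → ℕ
semilength P = ⌊ length P /2⌋

-- The number of down steps ending on the x-axis, for a path started at
-- height h.  A down step from height 0 never occurs in a Dyck path; the
-- value there is irrelevant.
returns : ℕ → Path → ℕ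
returns h             []      = 0
returns h             (U ∷ P) = returns (suc h) P
returns zero          (D ∷ P) = returns zero P
returns (suc zero)    (D ∷ P) = suc (returns zero P)
returns (suc (suc h)) (D ∷ P) = returns (suc h) P

record Irreducible (P : Path) : Set where
  field
    dyck      : IsDyck (semilength P) P
    oneReturn : returns 0 P ≡ 1

-- The irreducible components are obtained by cutting P after each return.
-- `cut h P`, for P started at height h, is the part of P up to and
-- including its first return, together with the components of the rest.
mutual
  components : Path → List Path
  components []          = []
  components P@(_ ∷ _) = let (C , Cs) = cut 0 P in C ∷ Cs

  cut : ℕ → Path → Path × List Path
  cut h             []      = [] , []
  cut h             (U ∷ P) = let (C , Cs) = cut (suc h) P in U ∷ C , Cs
  cut zero          (D ∷ P) = let (C , Cs) = cut zero P in D ∷ C , Cs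
  cut (suc zero)    (D ∷ P) = D ∷ [] , components P
  cut (suc (suc h)) (D ∷ P) = let (C , Cs) = cut (suc h) P in D ∷ C , Cs

-- The pair (ascent lengths, descent lengths); the first argument of
-- `extendRuns` is a step put in front of the path given by the second.
extendRuns : Step → Path → List ℕ × List ℕ → List ℕ × List ℕ
extendRuns U (U ∷ _) (a ∷ as , ds) = suc a ∷ as , ds
extendRuns U _       (as , ds)     = 1 ∷ as , ds
extendRuns D (D ∷ _) (as , d ∷ ds) = as , suc d ∷ ds
extendRuns D _       (as , ds)     = as , 1 ∷ ds

runs : Path → List ℕ × List ℕ
runs []      = [] , []
runs (s ∷ P) = extendRuns s P (runs P)

ascents descents : Path → List ℕ
ascents  P = proj₁ (runs P)
descents P = proj₂ (runs P)

-- c + a₁ , c + a₁ + a₂ , … , c + a₁ + ⋯ + aₖ₋₁  (the full sum is left out).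
properPartialSums : ℕ → List ℕ → List ℕ
properPartialSums c []           = []
properPartialSums c (a ∷ [])     = []
properPartialSums c (a ∷ b ∷ as) = c + a ∷ properPartialSums (c + a) (b ∷ as)

ascentCode descentCode : Path → List ℕ
ascentCode  P = properPartialSums 0 (ascents P)
descentCode P = properPartialSums 0 (descents P)

-- U^a₁ D^d₁ U^a₂ D^d₂ ⋯
zigzag : List (ℕ × ℕ) → Path
zigzag = concatMap λ (a , d) → replicate a U ++ replicate d D

-- The path of semilength n with the code (As , Ds); the code must consist of
-- two strictly increasing lists of equal length.
pathWithCode : ℕ → List ℕ → List ℕ → Path
pathWithCode n As Ds = zigzag (differences 0 0 (zip As Ds))
  where
  differences : ℕ → ℕ → List (ℕ × ℕ) → List (ℕ × ℕ)
  differences a d []               = (n ∸ a , n ∸ d) ∷ []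
  differences a d ((a′ , d′) ∷ ps) = (a′ ∸ a , d′ ∸ d) ∷ differences a′ d′ ps

-- Q covers P.
record _⋖_ (P Q : Path) : Set where
  field
    irreducibleˡ   : Irreducible P
    irreducibleʳ   : Irreducible Q
    sameSemilength : semilength P ≡ semilength Q
    i              : Fin (length (ascentCode P))
    j              : Fin (length (descentCode P))
    i≤j            : toℕ i ℕ.≤ toℕ j
    ascents-del    : ascentCode Q ≡ removeAt (ascentCode P) i
    descents-del   : descentCode Q ≡ removeAt (descentCode P) j

-- For irreducible paths.  If one side is irreducible then so is the other,
-- because every covering step relates irreducible paths.
_≼ᵢ_ : Path → Path → Set
_≼ᵢ_ = Star _⋖_

infix 4 _⋖_ _≼ᵢ_ _≼_

_≼_ : Path → Path → Set
P ≼ Q = Pointwise _≼ᵢ_ (components P) (components Q)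

-- {1, …, n − 2} ∖ X, in decreasing order.
complement : ℕ → List ℕ → List ℕ
complement n X = filter (λ x → ¬? (x ∈? X)) (map suc (downFrom (n ∸ 2)))

-- L′ on irreducible paths.
L′ᵢ : Path → Path
L′ᵢ P = pathWithCode n (map (n ∸_) Â) (map (n ∸ 1 ∸_) D̂)
  where
  n = semilength P
  Â = complement n (map pred (ascentCode P))
  D̂ = complement n (descentCode P)

L′ : Path → Path
L′ P = concat (reverse (map L′ᵢ (components P)))

module _ {n : ℕ} (σ : Permutation′ n) where

  -- The i-th letter of σ as a word in 1, …, n.
  letter : Fin n → ℕ
  letter i = suc (toℕ (σ ⟨$⟩ʳ i))

  IsLTRMin IsRTLMax : Fin n → Set
  IsLTRMin i = ∀ j → j < i → σ ⟨$⟩ʳ i < σ ⟨$⟩ʳ j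
  IsRTLMax i = ∀ j → i < j → σ ⟨$⟩ʳ j < σ ⟨$⟩ʳ i

  isLTRMin? : ∀ i → Dec (IsLTRMin i)
  isLTRMin? i = all? λ j → (j <? i) →-dec (σ ⟨$⟩ʳ i <? σ ⟨$⟩ʳ j)

  isRTLMax? : ∀ i → Dec (IsRTLMax i)
  isRTLMax? i = all? λ j → (i <? j) →-dec (σ ⟨$⟩ʳ j <? σ ⟨$⟩ʳ i)

  -- (m₁ , w₁) , … , (mₖ , wₖ) with σ = m₁ w₁ ⋯ mₖ wₖ.  The fold also returns
  -- the letters before the first LTR minimum, of which there are none.
  ltrFactors : List (ℕ × List ℕ)
  ltrFactors = proj₂ (foldr add ([] , []) (allFin n))
    where
    add : Fin n → List ℕ × List (ℕ × List ℕ) → List ℕ × List (ℕ × List ℕ)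
    add i (w , fs) = if does (isLTRMin? i)
                     then ([] , (letter i , w) ∷ fs)
                     else (letter i ∷ w , fs)

  -- (M₁ , u₁) , … , (Mₕ , uₕ) with σ = uₕ Mₕ ⋯ u₁ M₁.  The fold also returns
  -- the letters after the last RTL maximum, of which there are none.
  rtlFactors : List (ℕ × List ℕ)
  rtlFactors = proj₂ (foldl add ([] , []) (allFin n))
    where
    add : List ℕ × List (ℕ × List ℕ) → Fin n → List ℕ × List (ℕ × List ℕ)
    add (u , fs) i = if does (isRTLMax? i)
                     then ([] , (letter i , u) ∷ fs)
                     else (u ∷ʳ letter i , fs)

  λ-path : Path
  λ-path = zigzag (exponents (suc n) ltrFactors)
    where
    exponents : ℕ → List (ℕ × List ℕ) → List (ℕ × ℕ)
    exponents m₀ []             = []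
    exponents m₀ ((m , w) ∷ fs) = (m₀ ∸ m , length w + 1) ∷ exponents m fs

  μ-path : Path
  μ-path = zigzag (exponents 0 rtlFactors)
    where
    exponents : ℕ → List (ℕ × List ℕ) → List (ℕ × ℕ)
    exponents M₀ []             = []
    exponents M₀ ((M , u) ∷ fs) = (M ∸ M₀ , length u + 1) ∷ exponents M fs

module Submission where

-- For a permutation σ of 1, …, n let f i be the number of letters larger than the
-- letter at position i (positions counted from 0), and let f′ be the same
-- function for the reverse complement of σ.  Then λ(σ) and μ(σ) are the staircases
-- of the running maxima of f and f′: λ(σ) = P says that f stays below P and
-- attains it exactly at the peaks.
--
-- Let P and Q be irreducible.  The code of L′ Q lists the values and positions
-- that are not right-to-left maxima if μ(σ) = Q, hence are available for
-- left-to-right minima.  L′ Q ≤ P says that the code of P arises from it by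
-- dropping entries in such a way that, for each valley of P, at least as many
-- available values lie above the valley as available positions lie to its left.
-- This is necessary because σ maps the latter positions injectively to the former
-- values.  Conversely P and Q prescribe σ at the minima and maxima; pair the
-- remaining positions and values monotonically.  The inequalities at the valleys
-- of P and of Q say precisely that this pairing respects both paths.
--
-- In general the irreducible components of P, and those of Q in reverse order,
-- have to cut σ into the same blocks.

open import Data.Bool using (true; false; if_then_else_)
open import Data.Empty using (⊥; ⊥-elim)
open import Data.Fin as Fin using (Fin; toℕ; fromℕ<; opposite)
import Data.Fin.Properties as Fin
open import Data.Fin.Permutation using (Permutation′; _⟨$⟩ʳ_; _⟨$⟩ˡ_; inverseˡ; permutation)
open import Data.List using (List; []; _∷_; _++_; map; foldr; foldl; concat; reverse; length; replicate; filter; zip; drop; downFrom; upTo; tabulate; removeAt)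
import Data.List.Properties as List
open import Data.List.Membership.Propositional using (_∈_; _∉_)
open import Data.List.Membership.Propositional.Properties using (∈-∃++; ∈-++⁺ˡ; ∈-++⁺ʳ; ∈-++⁻; ∈-map⁺; ∈-map⁻; ∈-filter⁺; ∈-filter⁻; ∈-upTo⁺; ∈-upTo⁻; ∈-downFrom⁺; ∈-downFrom⁻)
open import Data.List.Relation.Binary.Pointwise as Pointwise using (Pointwise; []; _∷_)
open import Data.List.Relation.Binary.Sublist.Propositional using ([]; _∷_; _∷ʳ_) renaming (_⊆_ to _⊑_)
open import Data.List.Relation.Unary.All as All using (All; []; _∷_)
open import Data.List.Relation.Unary.AllPairs as AllPairs using (AllPairs; []; _∷_)
import Data.List.Relation.Unary.AllPairs.Properties as AllPairs
open import Data.List.Relation.Unary.Any using (here; there)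
import Data.List.Relation.Unary.Any.Properties as Any
open import Data.List.Relation.Unary.Unique.Propositional using (Unique)
import Data.List.Relation.Unary.Unique.Propositional.Properties as Unique
open import Data.Nat using (ℕ; zero; suc; pred; _+_; _∸_; _⊔_; _≤_; _<_; z≤n; s≤s; s≤s⁻¹; ⌊_/2⌋; _≟_; _<?_; _≤?_)
open import Data.Nat.Properties
open import Data.Nat.Tactic.RingSolver using (solve-∀)
open import Data.Product using (_×_; _,_; proj₁; proj₂; Σ-syntax; ∃-syntax; ∃₂)
open import Data.Sum using (_⊎_; inj₁; inj₂; [_,_]′)
open import Data.Unit using (⊤)
open import Function using (_∘_; id)
open import Function.Bundles using (_⇔_; mk⇔; Equivalence)
open import Relation.Binary.Construct.Closure.ReflexiveTransitive using (ε; _◅_)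
open import Relation.Binary.PropositionalEquality using (_≡_; _≢_; refl; sym; trans; cong; cong₂; subst; subst₂)
open import Relation.Nullary using (Dec; yes; no; does; ¬_; ¬?; contradiction)
open import Data.List.Membership.DecPropositional _≟_ using (_∈?_)
open import Defs

-- A chain of coverings is replaced by one static condition: the code of the upper path consists of
-- entries of the lower code, and at each valley of the upper path the index of its ascent in the
-- lower code is at least the index of its descent. Deleting the descent no earlier than the ascent
-- preserves this. Conversely, such a thinning can be split into single deletions whose intermediate
-- codes still belong to irreducible paths. In sorted lists indices are counts, so the condition can
-- be compared with sets of positions and values. Each argument is given for one of the two
-- inequalities; reversing and complementing the word exchanges λ and μ and gives the other.
-- Semilength 1 is treated apart, because its only letter is both a minimum and a maximum. In larger
-- irreducible blocks `f` exceeds the position at every minimum and falls short of it at every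
-- maximum. Blocks agree because an irreducible path lies above the diagonal at every inner point:
-- some position before that point has its value beyond it, so no shorter initial segment is
-- preserved.

infixl 5 _⊕_

_⊕_ : ∀ {a b c d} → a ≤ b → c ≤ d → a + c ≤ b + d
_⊕_ = +-mono-≤

≤-of : ∀ {a b} → a ≡ b → a ≤ b
≤-of = ≤-reflexive

≥-of : ∀ {a b} → a ≡ b → b ≤ a
≥-of e = ≤-reflexive (sym e)

-- Linear arithmetic by certificate: the hypotheses are added up with _⊕_, and
-- the remaining identity is left to the ring solver.
linear-⊥ : ∀ {A B} k → A ≤ B → suc B + k ≡ A → ⊥
linear-⊥ k p refl = 1+n≰n (≤-trans (s≤s (m≤m+n _ k)) p)

-- Finite sets of numbers as lists: cardinality, counting and pairing

Sorted : List ℕ → Set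
Sorted = AllPairs _<_

sorted⇒unique : ∀ {xs} → Sorted xs → Unique xs
sorted⇒unique = AllPairs.map <⇒≢

module _ {a} {A : Set a} where

  ∉-head : ∀ {x : A} {xs} → Unique (x ∷ xs) → x ∉ xs
  ∉-head (x∉ ∷ _) x∈ = All.lookup x∉ x∈ refl

  unique-∷ : ∀ {x : A} {xs} → x ∉ xs → Unique xs → Unique (x ∷ xs)
  unique-∷ {x} {xs} x∉ u = All.tabulate (λ y∈ x≡y → x∉ (subst (_∈ xs) (sym x≡y) y∈)) ∷ u

  -- The counting tool behind every pigeonhole argument below: injectivity enters as uniqueness of
  -- an image list, and cardinalities are lengths.
  card : ∀ {xs ys : List A} → Unique xs → (∀ {z} → z ∈ xs → z ∈ ys) → length xs ≤ length ys
  card {[]} _ _ = z≤n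
  card {x ∷ xs} u@(_ ∷ u′) sub with ∈-∃++ (sub (here refl))
  ... | ys₁ , ys₂ , refl =
    ≤-trans (s≤s (card u′ sub′))
      (≥-of (trans (List.length-++ ys₁) (trans (+-suc _ _) (cong suc (sym (List.length-++ ys₁))))))
    where
    sub′ : ∀ {z} → z ∈ xs → z ∈ ys₁ ++ ys₂
    sub′ z∈ with ∈-++⁻ ys₁ (sub (there z∈))
    ... | inj₁ p         = ∈-++⁺ˡ p
    ... | inj₂ (there p) = ∈-++⁺ʳ ys₁ p
    ... | inj₂ (here refl) = contradiction z∈ (∉-head u)

  -- Membership together with the index, because the deletion order compares indices in two
  -- different lists.
  data At : List A → ℕ → A → Set a where
    here  : ∀ {x xs} → At (x ∷ xs) 0 x
    there : ∀ {x y xs k} → At xs k x → At (y ∷ xs) (suc k) x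

  At⇒∈ : ∀ {xs k x} → At xs k x → x ∈ xs
  At⇒∈ here      = here refl
  At⇒∈ (there p) = there (At⇒∈ p)

unique-map : ∀ {a b} {A : Set a} {B : Set b} (f : A → B) {xs} → Unique xs →
  (∀ {x y} → x ∈ xs → y ∈ xs → f x ≡ f y → x ≡ y) → Unique (map f xs)
unique-map f {[]} _ _ = []
unique-map f {x ∷ xs} u@(_ ∷ u′) inj = unique-∷
  (λ fx∈ → let (y , y∈ , e) = ∈-map⁻ f fx∈ in
     ∉-head u (subst (_∈ xs) (sym (inj (here refl) (there y∈) e)) y∈))
  (unique-map f u′ λ p q → inj (there p) (there q))

sorted-map : ∀ (f : ℕ → ℕ) {_~_ : ℕ → ℕ → Set} {xs} → AllPairs _~_ xs →
  (∀ {x y} → x ∈ xs → y ∈ xs → x ~ y → f x < f y) → Sorted (map f xs)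
sorted-map f [] _ = []
sorted-map f {xs = x ∷ xs} (x~ ∷ s) h =
  All.tabulate (λ fy∈ → let (y , y∈ , e) = ∈-map⁻ f fy∈ in
    subst (f x <_) (sym e) (h (here refl) (there y∈) (All.lookup x~ y∈)))
  ∷ sorted-map f s (λ p q → h (there p) (there q))

cnt : ℕ → List ℕ → ℕ
cnt z xs = length (filter (_<? z) xs)

cnt-∷-< : ∀ {z x} xs → x < z → cnt z (x ∷ xs) ≡ suc (cnt z xs)
cnt-∷-< {z} xs x<z = cong length (List.filter-accept (_<? z) x<z)

cnt-map : ∀ {a} {A : Set a} (f : A → ℕ) z xs → cnt z (map f xs) ≡ length (filter (λ x → f x <? z) xs)
cnt-map f z [] = refl
cnt-map f z (x ∷ xs) with does (f x <? z)
... | true  = cong suc (cnt-map f z xs)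
... | false = cnt-map f z xs

filter-<-none : ∀ {z xs} → All (z ≤_) xs → filter (_<? z) xs ≡ []
filter-<-none [] = refl
filter-<-none {z} {x ∷ xs} (p ∷ ps) = trans (List.filter-reject (_<? z) (≤⇒≯ p)) (filter-<-none ps)

-- The entries before `x` are exactly the smaller ones. This translates the index conditions of the
-- order into counts.
At⇒cnt : ∀ {xs k x} → Sorted xs → At xs k x → cnt x xs ≡ k
At⇒cnt {x ∷ xs} (x< ∷ s) here =
  trans (cong length (List.filter-reject (_<? x) (<-irrefl refl)))
        (cong length (filter-<-none (All.map <⇒≤ x<)))
At⇒cnt {y ∷ xs} (y< ∷ s) (there p) = trans (cnt-∷-< xs (All.lookup y< (At⇒∈ p))) (cong suc (At⇒cnt s p))

module _ {a b} {A : Set a} {B : Set b} where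

  zip-∈ˡ : ∀ {x : A} {y : B} xs ys → (x , y) ∈ zip xs ys → x ∈ xs
  zip-∈ˡ (x ∷ xs) (y ∷ ys) (here refl) = here refl
  zip-∈ˡ (x ∷ xs) (y ∷ ys) (there p)   = there (zip-∈ˡ xs ys p)

  zip-∈ʳ : ∀ {x : A} {y : B} xs ys → (x , y) ∈ zip xs ys → y ∈ ys
  zip-∈ʳ (x ∷ xs) (y ∷ ys) (here refl) = here refl
  zip-∈ʳ (x ∷ xs) (y ∷ ys) (there p)   = there (zip-∈ʳ xs ys p)

  ∈⇒zipˡ : ∀ {x : A} {xs} {ys : List B} → length xs ≡ length ys → x ∈ xs → ∃[ y ] (x , y) ∈ zip xs ys
  ∈⇒zipˡ {ys = y ∷ ys} e (here refl) = y , here refl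
  ∈⇒zipˡ {ys = y ∷ ys} e (there p) = let (y′ , q) = ∈⇒zipˡ (suc-injective e) p in y′ , there q

  ∈⇒zipʳ : ∀ {y : B} {xs : List A} {ys} → length xs ≡ length ys → y ∈ ys → ∃[ x ] (x , y) ∈ zip xs ys
  ∈⇒zipʳ {xs = x ∷ xs} e (here refl) = x , here refl
  ∈⇒zipʳ {xs = x ∷ xs} e (there p) = let (x′ , q) = ∈⇒zipʳ (suc-injective e) p in x′ , there q

  zip-at : ∀ {x : A} {y : B} xs ys → (x , y) ∈ zip xs ys → ∃[ t ] At xs t x × At ys t y
  zip-at (x ∷ xs) (y ∷ ys) (here refl) = 0 , here , here
  zip-at (x ∷ xs) (y ∷ ys) (there p) = let (t , q , r) = zip-at xs ys p in suc t , there q , there r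

  zip-map : ∀ {c d} {C : Set c} {E : Set d} (f : A → C) (g : B → E) xs ys →
    zip (map f xs) (map g ys) ≡ map (λ (x , y) → f x , g y) (zip xs ys)
  zip-map f g [] ys = refl
  zip-map f g (x ∷ xs) [] = refl
  zip-map f g (x ∷ xs) (y ∷ ys) = cong (_ ∷_) (zip-map f g xs ys)

  zip-∈-mapʳ : ∀ {c} {C : Set c} (g : B → C) {x : A} {y : B} xs ys → (x , y) ∈ zip xs ys → (x , g y) ∈ zip xs (map g ys)
  zip-∈-mapʳ g (x ∷ xs) (y ∷ ys) (here refl) = here refl
  zip-∈-mapʳ g (x ∷ xs) (y ∷ ys) (there p)   = there (zip-∈-mapʳ g xs ys p)

  zip-++ : ∀ (xs : List A) {xs′} {ys : List B} {ys′} → length xs ≡ length ys →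
    zip (xs ++ xs′) (ys ++ ys′) ≡ zip xs ys ++ zip xs′ ys′
  zip-++ [] {ys = []} e = refl
  zip-++ (x ∷ xs) {ys = y ∷ ys} e = cong (_ ∷_) (zip-++ xs (suc-injective e))

  map-proj₁-zip : ∀ (xs : List A) (ys : List B) → length xs ≡ length ys → map proj₁ (zip xs ys) ≡ xs
  map-proj₁-zip [] [] e = refl
  map-proj₁-zip (x ∷ xs) (y ∷ ys) e = cong (x ∷_) (map-proj₁-zip xs ys (suc-injective e))

  map-proj₂-zip : ∀ (xs : List A) (ys : List B) → length xs ≡ length ys → map proj₂ (zip xs ys) ≡ ys
  map-proj₂-zip [] [] e = refl
  map-proj₂-zip (x ∷ xs) (y ∷ ys) e = cong (y ∷_) (map-proj₂-zip xs ys (suc-injective e))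

zip-swap : ∀ {a b} {A : Set a} {B : Set b} {x : A} {y : B} xs ys → (x , y) ∈ zip xs ys → (y , x) ∈ zip ys xs
zip-swap (x ∷ xs) (y ∷ ys) (here refl) = here refl
zip-swap (x ∷ xs) (y ∷ ys) (there p)   = there (zip-swap xs ys p)

Comonotone : List (ℕ × ℕ) → Set
Comonotone Z = ∀ {i v i′ v′} → (i , v) ∈ Z → (i′ , v′) ∈ Z → v′ < v → i′ < i

zip-comonotone : ∀ {xs ys} → Sorted xs → Sorted ys → Comonotone (zip xs ys)
zip-comonotone (x< ∷ sx) (y< ∷ sy) (here refl) (here refl) v< = contradiction v< (<-irrefl refl)
zip-comonotone {_ ∷ xs} {_ ∷ ys} (x< ∷ sx) (y< ∷ sy) (here refl) (there q) v< =
  contradiction v< (<⇒≯ (All.lookup y< (zip-∈ʳ xs ys q)))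
zip-comonotone {_ ∷ xs} {_ ∷ ys} (x< ∷ sx) (y< ∷ sy) (there p) (here refl) v< = All.lookup x< (zip-∈ˡ xs ys p)
zip-comonotone (x< ∷ sx) (y< ∷ sy) (there p) (there q) v< = zip-comonotone sx sy p q v<

-- If `v` were at least `a`, every pair with value below `a` would have its position below `i`,
-- hence below `d`. Together with `(i , v)` itself this gives more positions below `d` than values
-- below `a`.
comonotone-< : ∀ {Z i v} d a → Unique (map proj₁ Z) → Comonotone Z →
  cnt d (map proj₁ Z) ≤ cnt a (map proj₂ Z) → (i , v) ∈ Z → i < d → v < a
comonotone-< {Z} {i} {v} d a u mono le p i<d with v <? a
... | yes v<a = v<a
... | no  v≮a = ⊥-elim (1+n≰n (≤-trans (card uniq sub)
        (subst₂ _≤_ (cnt-map proj₁ d Z) (cnt-map proj₂ a Z) le)))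
  where
  low  = filter (λ z → proj₁ z <? d) Z
  high = filter (λ z → proj₂ z <? a) Z
  uniq : Unique ((i , v) ∷ high)
  uniq = unique-∷ (λ q → v≮a (proj₂ (∈-filter⁻ (λ z → proj₂ z <? a) {xs = Z} q)))
    (Unique.filter⁺ (λ z → proj₂ z <? a) {Z} (Unique.map⁻ u))
  sub : ∀ {z} → z ∈ (i , v) ∷ high → z ∈ low
  sub (here refl) = ∈-filter⁺ (λ z → proj₁ z <? d) p i<d
  sub (there q) = let (z∈ , v′<a) = ∈-filter⁻ (λ z → proj₂ z <? a) {xs = Z} q in
    ∈-filter⁺ (λ z → proj₁ z <? d) z∈ (<-trans (mono p z∈ (<-≤-trans v′<a (≮⇒≥ v≮a))) i<d)

-- Dyck paths: step counts and irreducible components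

ups downs : Path → ℕ
ups []      = 0
ups (U ∷ P) = suc (ups P)
ups (D ∷ P) = ups P
downs []      = 0
downs (U ∷ P) = downs P
downs (D ∷ P) = suc (downs P)

downs-++ : ∀ P R → downs (P ++ R) ≡ downs P + downs R
downs-++ []      R = refl
downs-++ (U ∷ P) R = downs-++ P R
downs-++ (D ∷ P) R = cong suc (downs-++ P R)

length-path : ∀ P → length P ≡ ups P + downs P
length-path []      = refl
length-path (U ∷ P) = cong suc (length-path P)
length-path (D ∷ P) = trans (cong suc (length-path P)) (sym (+-suc _ _))

dyck-balance : ∀ {h P} → DyckFrom h P → ups P + h ≡ downs P
dyck-balance end = refl
dyck-balance (up p)   = trans (sym (+-suc _ _)) (dyck-balance p)
dyck-balance (down p) = trans (+-suc _ _) (cong suc (dyck-balance p))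

dyck-ups≡downs : ∀ {P} → DyckFrom 0 P → ups P ≡ downs P
dyck-ups≡downs p = trans (sym (+-identityʳ _)) (dyck-balance p)

dyck-length : ∀ {P} → DyckFrom 0 P → length P ≡ downs P + downs P
dyck-length {P} p = trans (length-path P) (cong (_+ downs P) (dyck-ups≡downs p))

dyck-semilength : ∀ {P} → DyckFrom 0 P → semilength P ≡ downs P
dyck-semilength p = trans (cong ⌊_/2⌋ (dyck-length p)) (sym (n≡⌊n+n/2⌋ _))

isDyck-downs : ∀ {n P} → IsDyck n P → downs P ≡ n
isDyck-downs {n} {P} d = trans (trans (n≡⌊n+n/2⌋ (downs P)) (cong ⌊_/2⌋ e)) (sym (n≡⌊n+n/2⌋ n))
  where
  open IsDyck d
  e : downs P + downs P ≡ n + n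
  e = trans (sym (dyck-length dyck)) (trans endsAt[2n] (cong (n +_) (+-identityʳ n)))

-- Nonempty paths from height h to 0 that touch the x-axis only at their end
-- (and, if h = 0, at their start).
data Irr : ℕ → Path → Set where
  last : Irr 1 (D ∷ [])
  up   : ∀ {h P} → Irr (suc h) P → Irr h (U ∷ P)
  down : ∀ {h P} → Irr (suc h) P → Irr (suc (suc h)) (D ∷ P)

irr⇒dyck : ∀ {h P} → Irr h P → DyckFrom h P
irr⇒dyck last     = down end
irr⇒dyck (up p)   = up (irr⇒dyck p)
irr⇒dyck (down p) = down (irr⇒dyck p)

irr-semilength : ∀ {P} → Irr 0 P → semilength P ≡ downs P
irr-semilength = dyck-semilength ∘ irr⇒dyck

irr⇒Irreducible : ∀ {P} → Irr 0 P → Irreducible P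
irr⇒Irreducible {P} p = record
  { dyck = record
    { dyck = irr⇒dyck p
    ; endsAt[2n] = trans (dyck-length (irr⇒dyck p))
        (trans (cong (λ k → k + k) (sym (irr-semilength p))) (cong (semilength P +_) (sym (+-identityʳ _)))) }
  ; oneReturn = one p }
  where
  one : ∀ {h P} → Irr h P → returns h P ≡ 1
  one last     = refl
  one (up p)   = one p
  one (down p) = one p

cut-irr : ∀ {h C} → Irr h C → ∀ P → cut h (C ++ P) ≡ (C , components P)
cut-irr last     P = refl
cut-irr (up p)   P = cong (λ r → U ∷ proj₁ r , proj₂ r) (cut-irr p P)
cut-irr (down p) P = cong (λ r → D ∷ proj₁ r , proj₂ r) (cut-irr p P)

components-concat : ∀ {Cs} → All (Irr 0) Cs → components (concat Cs) ≡ Cs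
components-concat [] = refl
components-concat {_ ∷ Cs} (p@(up _) ∷ ps) =
  trans (cong (λ r → proj₁ r ∷ proj₂ r) (cut-irr p (concat Cs))) (cong (_ ∷_) (components-concat ps))

decompose : ∀ {P} → DyckFrom 0 P → ∃[ Cs ] All (Irr 0) Cs × P ≡ concat Cs
decompose₊ : ∀ {h P} → DyckFrom (suc h) P → ∃₂ λ C Cs → Irr (suc h) C × All (Irr 0) Cs × P ≡ C ++ concat Cs
decompose end    = [] , [] , refl
decompose (up p) = let (C , Cs , c , cs , e) = decompose₊ p in
  (U ∷ C) ∷ Cs , up c ∷ cs , cong (U ∷_) e
decompose₊ (up p) = let (C , Cs , c , cs , e) = decompose₊ p in
  U ∷ C , Cs , up c , cs , cong (U ∷_) e
decompose₊ (down {zero} p) = let (Cs , cs , e) = decompose p in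
  D ∷ [] , Cs , last , cs , cong (D ∷_) e
decompose₊ (down {suc h} p) = let (C , Cs , c , cs , e) = decompose₊ p in
  D ∷ C , Cs , down c , cs , cong (D ∷_) e

-- Paths as staircases of functions

-- Path reconstruction from f, where f i is the height index (0 for the largest
-- letter) of the letter at position i: before the i-th down step come as many
-- up steps as are needed to make their number exceed f i.
staircase : (ℕ → ℕ) → ℕ → ℕ → ℕ → Path
staircase f c i zero    = []
staircase f c i (suc k) = replicate (suc (f i) ∸ c) U ++ D ∷ staircase f (c ⊔ suc (f i)) (suc i) k

-- `Fit P c i s f`: the path P, continuing a path with c up and i down steps
-- whose last step is s, is the staircase of f.
Fit : Path → ℕ → ℕ → Step → (ℕ → ℕ) → Set
Fit []      c i s f = ⊤
Fit (U ∷ P) c i s f = Fit P (suc c) i U f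
Fit (D ∷ P) c i U f = suc (f i) ≡ c × Fit P c (suc i) D f
Fit (D ∷ P) c i D f = f i < c × Fit P c (suc i) D f

lastStep : Step → Path → Step
lastStep s []      = s
lastStep s (t ∷ P) = lastStep t P

dyck-lastStep : ∀ {h s P} → DyckFrom h P → h ≢ 0 ⊎ s ≡ D → lastStep s P ≡ D
dyck-lastStep end      (inj₁ p) = contradiction refl p
dyck-lastStep end      (inj₂ e) = e
dyck-lastStep (up p)   _        = dyck-lastStep p (inj₁ λ ())
dyck-lastStep (down p) _        = dyck-lastStep p (inj₂ refl)

-- Whether a down step demands an equation or an inequality depends on the step before it, so the
-- last step of `P` has to be passed on to `R`.
Fit-++⁻ : ∀ P {R c i s f} → Fit (P ++ R) c i s f →
  Fit P c i s f × Fit R (c + ups P) (i + downs P) (lastStep s P) f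
Fit-++⁻ [] {c = c} {i} p rewrite +-identityʳ c | +-identityʳ i = _ , p
Fit-++⁻ (U ∷ P) {c = c} p rewrite +-suc c (ups P) = Fit-++⁻ P p
Fit-++⁻ (D ∷ P) {i = i} {s = U} (e , p) rewrite +-suc i (downs P) =
  let (q , r) = Fit-++⁻ P p in (e , q) , r
Fit-++⁻ (D ∷ P) {i = i} {s = D} (e , p) rewrite +-suc i (downs P) =
  let (q , r) = Fit-++⁻ P p in (e , q) , r

Fit-++⁺ : ∀ P {R c i s f} → Fit P c i s f → Fit R (c + ups P) (i + downs P) (lastStep s P) f →
  Fit (P ++ R) c i s f
Fit-++⁺ [] {c = c} {i} _ p rewrite +-identityʳ c | +-identityʳ i = p
Fit-++⁺ (U ∷ P) {c = c} p q rewrite +-suc c (ups P) = Fit-++⁺ P p q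
Fit-++⁺ (D ∷ P) {i = i} {s = U} (e , p) q rewrite +-suc i (downs P) = e , Fit-++⁺ P p q
Fit-++⁺ (D ∷ P) {i = i} {s = D} (e , p) q rewrite +-suc i (downs P) = e , Fit-++⁺ P p q

Fit-bound : ∀ P {c i s f} → Fit P c i s f → ∀ j → i ≤ j → j < i + downs P → f j < c + ups P
Fit-bound [] {i = i} _ j i≤j j< = contradiction (≤-trans j< (≤-of (+-identityʳ i))) (≤⇒≯ i≤j)
Fit-bound (U ∷ P) {c} {f = f} p j i≤j j< = subst (f j <_) (sym (+-suc c (ups P))) (Fit-bound P p j i≤j j<)
Fit-bound (D ∷ P) {c} {i} {s} p j i≤j j< with m≤n⇒m<n∨m≡n i≤j
Fit-bound (D ∷ P) {c} {i} {U} (_ , p) j _ j< | inj₁ i<j = Fit-bound P p j i<j (≤-trans j< (≤-of (+-suc i _)))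
Fit-bound (D ∷ P) {c} {i} {D} (_ , p) j _ j< | inj₁ i<j = Fit-bound P p j i<j (≤-trans j< (≤-of (+-suc i _)))
Fit-bound (D ∷ P) {c} {i} {U} (e , p) j _ j< | inj₂ refl = ≤-trans (≤-of e) (m≤m+n c _)
Fit-bound (D ∷ P) {c} {i} {D} (l , p) j _ j< | inj₂ refl = ≤-trans l (m≤m+n c _)

-- A component that starts on the axis is preceded by equally many up and down steps, so positions
-- and heights are translated by the same `m`.
Fit-shift⁻ : ∀ m P {c i s f f₂} → (∀ j → i ≤ j → j < i + downs P → f (m + j) ≡ m + f₂ j) →
  Fit P (m + c) (m + i) s f → Fit P c i s f₂
Fit-shift⁻ m [] h p = _
Fit-shift⁻ m (U ∷ P) {c} {i} {_} {f} h p = Fit-shift⁻ m P h (subst (λ k → Fit P k (m + i) U f) (sym (+-suc m c)) p)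
Fit-shift⁻ m (D ∷ P) {c} {i} {U} {f} h (e , p) =
  +-cancelˡ-≡ m _ _ (trans (trans (+-suc m _) (cong suc (sym (h i ≤-refl (m<m+n i (s≤s z≤n)))))) e) ,
  Fit-shift⁻ m P (λ j i<j j< → h j (<⇒≤ i<j) (≤-trans j< (≥-of (+-suc i _))))
    (subst (λ k → Fit P (m + c) k D f) (sym (+-suc m i)) p)
Fit-shift⁻ m (D ∷ P) {c} {i} {D} {f} h (e , p) =
  +-cancelˡ-< m _ _ (≤-trans (s≤s (≥-of (h i ≤-refl (m<m+n i (s≤s z≤n))))) e) ,
  Fit-shift⁻ m P (λ j i<j j< → h j (<⇒≤ i<j) (≤-trans j< (≥-of (+-suc i _))))
    (subst (λ k → Fit P (m + c) k D f) (sym (+-suc m i)) p)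

Fit-shift⁺ : ∀ m P {c i s f f₂} → (∀ j → i ≤ j → j < i + downs P → f (m + j) ≡ m + f₂ j) →
  Fit P c i s f₂ → Fit P (m + c) (m + i) s f
Fit-shift⁺ m [] h p = _
Fit-shift⁺ m (U ∷ P) {c} {i} {_} {f} h p = subst (λ k → Fit P k (m + i) U f) (+-suc m c) (Fit-shift⁺ m P h p)
Fit-shift⁺ m (D ∷ P) {c} {i} {U} {f} h (e , p) =
  trans (cong suc (h i ≤-refl (m<m+n i (s≤s z≤n)))) (trans (sym (+-suc m _)) (cong (m +_) e)) ,
  subst (λ k → Fit P (m + c) k D f) (+-suc m i)
    (Fit-shift⁺ m P (λ j i<j j< → h j (<⇒≤ i<j) (≤-trans j< (≥-of (+-suc i _)))) p)
Fit-shift⁺ m (D ∷ P) {c} {i} {D} {f} h (e , p) =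
  ≤-trans (s≤s (≤-of (h i ≤-refl (m<m+n i (s≤s z≤n))))) (+-monoʳ-< m e) ,
  subst (λ k → Fit P (m + c) k D f) (+-suc m i)
    (Fit-shift⁺ m P (λ j i<j j< → h j (<⇒≤ i<j) (≤-trans j< (≥-of (+-suc i _)))) p)

replicate-snoc : ∀ {a} {A : Set a} k (x : A) xs → replicate k x ++ x ∷ xs ≡ x ∷ replicate k x ++ xs
replicate-snoc zero    x xs = refl
replicate-snoc (suc k) x xs = cong (x ∷_) (replicate-snoc k x xs)

-- The staircase emits a whole ascent at once, when the next down step determines its length;
-- `suc u` up steps are pending here. A positive height guarantees that this down step comes.
Fit⇒staircaseᵁ : ∀ {h} u P {c i f} → DyckFrom h P → h ≢ 0 → Fit P (suc (u + c)) i U f →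
  replicate (suc u) U ++ P ≡ staircase f c i (downs P)
Fit⇒staircase : ∀ {h} P {c i f} → DyckFrom h P → Fit P c i D f → P ≡ staircase f c i (downs P)
Fit⇒staircaseᵁ u [] end h≢0 _ = contradiction refl h≢0
Fit⇒staircaseᵁ u (U ∷ P) (up p) _ fit =
  trans (cong (U ∷_) (replicate-snoc u U P)) (Fit⇒staircaseᵁ (suc u) P p (λ ()) fit)
Fit⇒staircaseᵁ u (D ∷ P) {c} {i} {f} (down p) _ (e , fit) = cong₂ (λ k R → replicate k U ++ D ∷ R)
  (sym (trans (cong (_∸ c) e) (m+n∸n≡m (suc u) c)))
  (trans (Fit⇒staircase P p fit)
    (cong (λ k → staircase f k (suc i) (downs P))
      (sym (trans (cong (c ⊔_) e) (m≤n⇒m⊔n≡n (m≤n+m c (suc u)))))))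
Fit⇒staircase [] end _ = refl
Fit⇒staircase (U ∷ P) (up p) fit = Fit⇒staircaseᵁ 0 P p (λ ()) fit
Fit⇒staircase (D ∷ P) {c} {i} {f} (down p) (l , fit) = cong₂ (λ k R → replicate k U ++ D ∷ R)
  (sym (m≤n⇒m∸n≡0 l))
  (trans (Fit⇒staircase P p fit)
    (cong (λ k → staircase f k (suc i) (downs P)) (sym (m≥n⇒m⊔n≡m l))))

staircase-Fit : ∀ f c i k → Fit (staircase f c i k) c i D f
staircase-Fit f c i zero = _
staircase-Fit f c i (suc k) with suc (f i) ≤? c
... | yes l rewrite m≤n⇒m∸n≡0 l | m≥n⇒m⊔n≡m l = l , staircase-Fit f c (suc i) k
... | no ¬l = go (suc (f i) ∸ c) c (m≢0 , m∸n+n≡m (<⇒≤ (≰⇒> ¬l)))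
  where
  m≢0 : suc (f i) ∸ c ≢ 0
  m≢0 e = ¬l (m∸n≡0⇒m≤n e)
  R = staircase f (c ⊔ suc (f i)) (suc i) k
  rest : Fit R (suc (f i)) (suc i) D f
  rest = subst (λ z → Fit (staircase f z (suc i) k) (suc (f i)) (suc i) D f)
    (sym (m≤n⇒m⊔n≡n (<⇒≤ (≰⇒> ¬l)))) (staircase-Fit f (suc (f i)) (suc i) k)
  go : ∀ u c {s} → u ≢ 0 × u + c ≡ suc (f i) → Fit (replicate u U ++ D ∷ R) c i s f
  go zero c (u≢0 , _) = contradiction refl u≢0
  go (suc zero) c (_ , e) = sym e , subst (λ z → Fit R z (suc i) D f) (sym e) rest
  go (suc (suc u)) c (_ , e) = go (suc u) (suc c) {U} ((λ ()) , trans (+-suc (suc u) c) e)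

-- Codes of irreducible paths

-- `Code n a d As Ds`: As and Ds are the code of an irreducible path of
-- semilength n, without an initial part that consists of a up steps and d down
-- steps.
data Code (n : ℕ) : ℕ → ℕ → List ℕ → List ℕ → Set where
  end  : ∀ {a d} → a < n → d < n → Code n a d [] []
  step : ∀ {a d a′ d′ As Ds} → a < a′ → d < d′ → d′ < a′ → Code n a′ d′ As Ds →
         Code n a d (a′ ∷ As) (d′ ∷ Ds)

-- The path of `pathWithCode` from the valley `(a , d)` onwards; an arbitrary starting valley allows
-- induction along `Code`. Lists of unequal length are truncated as by `zip`.
Z : ℕ → ℕ → ℕ → List ℕ → List ℕ → Path
Z n a d (a′ ∷ As) (d′ ∷ Ds) = replicate (a′ ∸ a) U ++ replicate (d′ ∸ d) D ++ Z n a′ d′ As Ds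
Z n a d []        _         = replicate (n ∸ a) U ++ replicate (n ∸ d) D ++ []
Z n a d (_ ∷ _)   []        = replicate (n ∸ a) U ++ replicate (n ∸ d) D ++ []

zigzag-∷ : ∀ k l ps → zigzag ((k , l) ∷ ps) ≡ replicate k U ++ replicate l D ++ zigzag ps
zigzag-∷ k l ps = List.++-assoc (replicate k U) (replicate l D) (zigzag ps)

codeExponents : ℕ → ℕ → ℕ → List (ℕ × ℕ) → List (ℕ × ℕ)
codeExponents n a d []               = (n ∸ a , n ∸ d) ∷ []
codeExponents n a d ((a′ , d′) ∷ ps) = (a′ ∸ a , d′ ∸ d) ∷ codeExponents n a′ d′ ps

-- The local function of `pathWithCode` cannot be named here; the left-hand side
-- `_` of the second lemma is inferred from the first one.
mutual
  pathWithCode-exponents : ∀ n As Ds → pathWithCode n As Ds ≡ zigzag (codeExponents n 0 0 (zip As Ds))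
  pathWithCode-exponents n As Ds with zip As Ds
  ... | []           = refl
  ... | (a , d) ∷ ps = cong ((replicate a U ++ replicate d D) ++_) (pathWithCode-exponents′ n As Ds a d ps)

  pathWithCode-exponents′ : ∀ n (As Ds : List ℕ) a d ps → _ ≡ zigzag (codeExponents n a d ps)
  pathWithCode-exponents′ n As Ds a d [] = refl
  pathWithCode-exponents′ n As Ds a d ((a′ , d′) ∷ ps) =
    cong ((replicate (a′ ∸ a) U ++ replicate (d′ ∸ d) D) ++_) (pathWithCode-exponents′ n As Ds a′ d′ ps)

zigzag-exponents : ∀ n a d As Ds → zigzag (codeExponents n a d (zip As Ds)) ≡ Z n a d As Ds
zigzag-exponents n a d []        Ds = zigzag-∷ (n ∸ a) (n ∸ d) []
zigzag-exponents n a d (_ ∷ _)   [] = zigzag-∷ (n ∸ a) (n ∸ d) []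
zigzag-exponents n a d (a′ ∷ As) (d′ ∷ Ds) =
  trans (zigzag-∷ (a′ ∸ a) (d′ ∸ d) (codeExponents n a′ d′ (zip As Ds)))
    (cong (λ R → replicate (a′ ∸ a) U ++ replicate (d′ ∸ d) D ++ R) (zigzag-exponents n a′ d′ As Ds))

pathWithCode≡Z : ∀ n As Ds → pathWithCode n As Ds ≡ Z n 0 0 As Ds
pathWithCode≡Z n As Ds = trans (pathWithCode-exponents n As Ds) (zigzag-exponents n 0 0 As Ds)

code-length : ∀ {n a d As Ds} → Code n a d As Ds → length As ≡ length Ds
code-length (end _ _)      = refl
code-length (step _ _ _ c) = cong suc (code-length c)

code-a<n : ∀ {n a d As Ds} → Code n a d As Ds → a < n
code-a<n (end a<n _)         = a<n
code-a<n (step a<a′ _ _ c) = <-trans a<a′ (code-a<n c)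

code-d<n : ∀ {n a d As Ds} → Code n a d As Ds → d < n
code-d<n (end _ d<n)         = d<n
code-d<n (step _ d<d′ _ c) = <-trans d<d′ (code-d<n c)

code-sortedᵃ : ∀ {n a d As Ds} → Code n a d As Ds → Sorted (a ∷ As)
code-sortedᵃ (end _ _) = [] ∷ []
code-sortedᵃ (step a<a′ _ _ c) with code-sortedᵃ c
... | s@(a′< ∷ _) = (a<a′ ∷ All.map (<-trans a<a′) a′<) ∷ s

code-sortedᵈ : ∀ {n a d As Ds} → Code n a d As Ds → Sorted (d ∷ Ds)
code-sortedᵈ (end _ _) = [] ∷ []
code-sortedᵈ (step _ d<d′ _ c) with code-sortedᵈ c
... | s@(d′< ∷ _) = (d<d′ ∷ All.map (<-trans d<d′) d′<) ∷ s

code-As<n : ∀ {n a d As Ds x} → Code n a d As Ds → x ∈ As → x < n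
code-As<n (step _ _ _ c) (here refl) = code-a<n c
code-As<n (step _ _ _ c) (there p)   = code-As<n c p

code-Ds<n : ∀ {n a d As Ds y} → Code n a d As Ds → y ∈ Ds → y < n
code-Ds<n (step _ _ _ c) (here refl) = code-d<n c
code-Ds<n (step _ _ _ c) (there p)   = code-Ds<n c p

code-D⁺<n : ∀ {n a d As Ds i} → Code n a d As Ds → i ∈ d ∷ Ds → i < n
code-D⁺<n c (here refl) = code-d<n c
code-D⁺<n c (there i∈)  = code-Ds<n c i∈

code-peaks : ∀ {n a d As Ds} → Code n a d As Ds → length (d ∷ Ds) ≡ length (As ++ n ∷ [])
code-peaks {As = As} c = trans (cong suc (sym (code-length c))) (sym (trans (List.length-++ As) (+-comm (length As) 1)))

code-zip : ∀ {n a d As Ds x y} → Code n a d As Ds → (x , y) ∈ zip As Ds → y < x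
code-zip (step _ _ l c) (here refl) = l
code-zip (step _ _ l c) (there p)   = code-zip c p

code-sorted-n : ∀ {n a d As Ds} → Code n a d As Ds → Sorted (As ++ n ∷ [])
code-sorted-n c = AllPairs.++⁺ (AllPairs.tail (code-sortedᵃ c)) ([] ∷ [])
  (All.tabulate λ x∈ → code-As<n c x∈ ∷ [])

-- The pairs in `zip (d ∷ Ds) (As ++ n ∷ [])` are the peaks (number of down and
-- of up steps before the peak), those in `zip As Ds` the valleys.
peak-above : ∀ {n a d As Ds i b} → Code n a d As Ds → d < a → (i , b) ∈ zip (d ∷ Ds) (As ++ n ∷ []) → suc i < b
peak-above (end a<n _) d<a (here refl) = <-≤-trans (s≤s d<a) a<n
peak-above (step a<a′ _ _ c) d<a (here refl) = <-≤-trans (s≤s d<a) a<a′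
peak-above (step _ _ l c) d<a (there p) = peak-above c l p

peak-above₀ : ∀ {n As Ds i b} → 2 ≤ n → Code n 0 0 As Ds → (i , b) ∈ zip (0 ∷ Ds) (As ++ n ∷ []) → suc i < b
peak-above₀ 2≤n (end _ _) (here refl) = 2≤n
peak-above₀ 2≤n (step _ d>0 l _) (here refl) = <-≤-trans (s≤s d>0) l
peak-above₀ 2≤n (step _ _ l c) (there p) = peak-above c l p

peak≤valley : ∀ {n a d As Ds i b x y} → Code n a d As Ds → (i , b) ∈ zip (d ∷ Ds) (As ++ n ∷ []) →
  (x , y) ∈ zip As Ds → i < y → b ≤ x
peak≤valley (step _ _ _ c) (here refl) (here refl) i<y = ≤-refl
peak≤valley {As = _ ∷ As} {_ ∷ Ds} (step _ _ _ c) (here refl) (there q) i<y =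
  <⇒≤ (All.lookup (AllPairs.head (code-sortedᵃ c)) (zip-∈ˡ As Ds q))
peak≤valley {n} {As = _ ∷ As} {d′ ∷ Ds} (step _ _ _ c) (there p) (here refl) i<y
  with zip-∈ˡ (d′ ∷ Ds) (As ++ n ∷ []) p
... | here refl = contradiction i<y (<-irrefl refl)
... | there i∈ = contradiction i<y (<⇒≯ (All.lookup (AllPairs.head (code-sortedᵈ c)) i∈))
peak≤valley (step _ _ _ c) (there p) (there q) i<y = peak≤valley c p q i<y

-- The peak is the one at the head of the descent containing the down step number `k`.
-- Irreducibility places the end of that descent below the up count of its peak; on the last
-- descent, `k < n` takes over.
peak-over : ∀ {n a d As Ds} → Code n a d As Ds → ∀ k → d < k → k < n →
  ∃₂ λ i b → (i , b) ∈ zip (d ∷ Ds) (As ++ n ∷ []) × i < k × k < b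
peak-over (end _ _) k d<k k<n = _ , _ , here refl , d<k , k<n
peak-over (step {d′ = d′} _ _ l c) k d<k k<n with d′ <? k
... | yes d′<k = let (i , b , p , q) = peak-over c k d′<k k<n in i , b , there p , q
... | no d′≮k = _ , _ , here refl , d<k , ≤-<-trans (≮⇒≥ d′≮k) l

toCode : ∀ {n a d As Ds} → a < n → d < n → Sorted (a ∷ As) → Sorted (d ∷ Ds) → length As ≡ length Ds →
  (∀ {x y} → (x , y) ∈ zip As Ds → y < x) → (∀ {x} → x ∈ As → x < n) → Code n a d As Ds
toCode {As = []} {[]} a<n d<n _ _ _ _ _ = end a<n d<n
toCode {As = a′ ∷ As} {d′ ∷ Ds} a<n d<n ((a< ∷ _) ∷ sa) ((d< ∷ _) ∷ sd) e above bound =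
  step a< d< (above (here refl))
    (toCode (bound (here refl)) (<-trans (above (here refl)) (bound (here refl))) sa sd
      (suc-injective e) (above ∘ there) (bound ∘ there))

irr-U : ∀ k {h P} → Irr (k + h) P → Irr h (replicate k U ++ P)
irr-U zero    p = p
irr-U (suc k) {h} {P} p = up (irr-U k (subst (λ z → Irr z P) (sym (+-suc k h)) p))

irr-D : ∀ k {h P} → Irr (suc h) P → Irr (k + suc h) (replicate k D ++ P)
irr-D zero    p = p
irr-D (suc k) {h} {P} p = subst (λ z → Irr z (replicate (suc k) D ++ P)) (sym (+-suc (suc k) h))
  (down (subst (λ z → Irr z (replicate k D ++ P)) (+-suc k h) (irr-D k p)))

irr-D-last : ∀ k → Irr (suc k) (replicate (suc k) D ++ [])
irr-D-last zero    = last
irr-D-last (suc k) = down (irr-D-last k)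

Z-irr : ∀ {n a d As Ds} → Code n a d As Ds → ∀ h → h + d ≡ a → Irr h (Z n a d As Ds)
Z-irr {n} {a} {d} (end a<n d<n) h e with n ∸ d in eq
... | zero  = contradiction eq (m>n⇒m∸n≢0 d<n)
... | suc k = irr-U (n ∸ a) (subst (λ z → Irr z (replicate (suc k) D ++ [])) (sym lem) (irr-D-last k))
  where
  k+d : suc k + d ≡ n
  k+d = trans (cong (_+ d) (sym eq)) (m∸n+n≡m (<⇒≤ d<n))
  arith : ∀ u h a d k n → u + a ≡ n → suc k + d ≡ n → h + d ≡ a → u + h ≡ suc k
  arith u h a d k n p q r =
    +-cancelʳ-≡ d _ _ (trans (+-assoc u h d) (trans (cong (u +_) r) (trans p (sym q))))
  lem : n ∸ a + h ≡ suc k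
  lem = arith (n ∸ a) h a d k n (m∸n+n≡m (<⇒≤ a<n)) k+d e
Z-irr {n} {a} {d} (step {a′ = a′} {d′} {As} {Ds} a<a′ d<d′ d′<a′ c) h e with a′ ∸ d′ in eq
... | zero = contradiction eq (m>n⇒m∸n≢0 d′<a′)
... | suc k = irr-U (a′ ∸ a) (subst (λ z → Irr z (replicate (d′ ∸ d) D ++ Z n a′ d′ As Ds)) (sym lem)
                (irr-D (d′ ∸ d) (Z-irr c (suc k) k+d)))
  where
  k+d : suc k + d′ ≡ a′
  k+d = trans (cong (_+ d′) (sym eq)) (m∸n+n≡m (<⇒≤ d′<a′))
  arith : ∀ u v h a d a′ d′ k → u + a ≡ a′ → v + d ≡ d′ → suc k + d′ ≡ a′ → h + d ≡ a → u + h ≡ v + suc k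
  arith u v h a d a′ d′ k p q r s =
    +-cancelʳ-≡ d _ _ (trans (+-assoc u h d) (trans (cong (u +_) s) (trans p (trans (sym r)
      (trans (cong (suc k +_) (sym q)) (trans (sym (+-assoc (suc k) v d)) (cong (_+ d) (+-comm (suc k) v))))))))
  lem : a′ ∸ a + h ≡ d′ ∸ d + suc k
  lem = arith (a′ ∸ a) (d′ ∸ d) h a d a′ d′ k (m∸n+n≡m (<⇒≤ a<a′)) (m∸n+n≡m (<⇒≤ d<d′)) k+d e

downs-U : ∀ k P → downs (replicate k U ++ P) ≡ downs P
downs-U zero    P = refl
downs-U (suc k) P = downs-U k P

downs-D : ∀ k P → downs (replicate k D ++ P) ≡ k + downs P
downs-D zero    P = refl
downs-D (suc k) P = cong suc (downs-D k P)

downs-Z : ∀ {n a d As Ds} → Code n a d As Ds → downs (Z n a d As Ds) + d ≡ n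
downs-Z {n} {a} {d} (end _ d<n) = trans
  (cong (_+ d) (trans (downs-U (n ∸ a) _) (trans (downs-D (n ∸ d) []) (+-identityʳ _))))
  (m∸n+n≡m (<⇒≤ d<n))
downs-Z {n} {a} {d} (step {a′ = a′} {d′} {As} {Ds} _ d<d′ _ c) =
  trans (cong (_+ d) (trans (downs-U (a′ ∸ a) _) (downs-D (d′ ∸ d) _)))
    (arith (d′ ∸ d) (downs (Z n a′ d′ As Ds)) d d′ n (m∸n+n≡m (<⇒≤ d<d′)) (downs-Z c))
  where
  arith : ∀ v s d d′ n → v + d ≡ d′ → s + d′ ≡ n → v + s + d ≡ n
  arith v s d d′ n p q =
    trans (cong (_+ d) (+-comm v s)) (trans (+-assoc s v d) (trans (cong (s +_) p) q))

Z-irr₀ : ∀ {n As Ds} → Code n 0 0 As Ds → Irr 0 (Z n 0 0 As Ds)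
Z-irr₀ c = Z-irr c 0 refl

Z-downs : ∀ {n As Ds} → Code n 0 0 As Ds → downs (Z n 0 0 As Ds) ≡ n
Z-downs c = trans (sym (+-identityʳ _)) (downs-Z c)

Z-semilength : ∀ {n As Ds} → Code n 0 0 As Ds → semilength (Z n 0 0 As Ds) ≡ n
Z-semilength c = trans (irr-semilength (Z-irr₀ c)) (Z-downs c)

-- `extendRuns` merges a down step with a following one, so a descent put in front forms a run of
-- its own only before such paths.
NoLeadingD : Path → Set
NoLeadingD []      = ⊤
NoLeadingD (U ∷ P) = ⊤
NoLeadingD (D ∷ P) = ⊥

runs-D : ∀ k P → NoLeadingD P → runs (replicate (suc k) D ++ P) ≡ (proj₁ (runs P) , suc k ∷ proj₂ (runs P))
runs-D zero [] _ = refl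
runs-D zero (U ∷ P) _ = refl
runs-D (suc k) P nd rewrite runs-D k P nd = refl

runs-U : ∀ k P → runs (replicate (suc k) U ++ D ∷ P) ≡ (suc k ∷ proj₁ (runs (D ∷ P)) , proj₂ (runs (D ∷ P)))
runs-U zero P = refl
runs-U (suc k) P rewrite runs-U k P = refl

runs-UD : ∀ k l P → 0 < k → 0 < l → NoLeadingD P →
  runs (replicate k U ++ replicate l D ++ P) ≡ (k ∷ proj₁ (runs P) , l ∷ proj₂ (runs P))
runs-UD (suc k) (suc l) P _ _ nd rewrite runs-U k (replicate l D ++ P) | runs-D l P nd = refl

differences : ℕ → ℕ → List ℕ → List ℕ
differences n a []        = n ∸ a ∷ []
differences n a (a′ ∷ As) = a′ ∸ a ∷ differences n a′ As

noLeadingD-U : ∀ k P → 0 < k → NoLeadingD (replicate k U ++ P)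
noLeadingD-U (suc k) P _ = _

Z-noLeadingD : ∀ {n a d As Ds} → Code n a d As Ds → NoLeadingD (Z n a d As Ds)
Z-noLeadingD {n} {a} (end a<n _) = noLeadingD-U (n ∸ a) _ (m<n⇒0<n∸m a<n)
Z-noLeadingD {n} {a} (step {a′ = a′} a<a′ _ _ _) = noLeadingD-U (a′ ∸ a) _ (m<n⇒0<n∸m a<a′)

runs-Z : ∀ {n a d As Ds} → Code n a d As Ds → runs (Z n a d As Ds) ≡ (differences n a As , differences n d Ds)
runs-Z {n} {a} {d} (end a<n d<n) = runs-UD (n ∸ a) (n ∸ d) [] (m<n⇒0<n∸m a<n) (m<n⇒0<n∸m d<n) _
runs-Z {n} {a} {d} (step {a′ = a′} {d′} a<a′ d<d′ _ c) = trans
  (runs-UD (a′ ∸ a) (d′ ∸ d) _ (m<n⇒0<n∸m a<a′) (m<n⇒0<n∸m d<d′) (Z-noLeadingD c))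
  (cong (λ r → a′ ∸ a ∷ proj₁ r , d′ ∸ d ∷ proj₂ r) (runs-Z c))

properPartialSums-∷ : ∀ c x n b L →
  properPartialSums c (x ∷ differences n b L) ≡ c + x ∷ properPartialSums (c + x) (differences n b L)
properPartialSums-∷ c x n b []      = refl
properPartialSums-∷ c x n b (_ ∷ _) = refl

properPartialSums-differences : ∀ {n a As} → Sorted (a ∷ As) → properPartialSums a (differences n a As) ≡ As
properPartialSums-differences {As = []} _ = refl
properPartialSums-differences {n} {a} {a′ ∷ As} ((a<a′ ∷ _) ∷ s) =
  trans (properPartialSums-∷ a (a′ ∸ a) n a′ As)
    (trans (cong (λ z → z ∷ properPartialSums z (differences n a′ As)) (m+[n∸m]≡n (<⇒≤ a<a′)))
      (cong (a′ ∷_) (properPartialSums-differences s)))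

Z-ascentCode : ∀ {n As Ds} → Code n 0 0 As Ds → ascentCode (Z n 0 0 As Ds) ≡ As
Z-ascentCode c = trans (cong (properPartialSums 0 ∘ proj₁) (runs-Z c)) (properPartialSums-differences (code-sortedᵃ c))

Z-descentCode : ∀ {n As Ds} → Code n 0 0 As Ds → descentCode (Z n 0 0 As Ds) ≡ Ds
Z-descentCode c = trans (cong (properPartialSums 0 ∘ proj₂) (runs-Z c)) (properPartialSums-differences (code-sortedᵈ c))

-- Reading an irreducible path from left to right; (a₀ , d₀) is the last valley
-- seen, and the path read since then is U^u, respectively U^(a ∸ a₀) D^e.
irr⇒Zᵁ : ∀ {h P n} → Irr h P → ∀ u a₀ d₀ → 0 < u → h + d₀ ≡ u + a₀ → d₀ + downs P ≡ n →
  ∃₂ λ As Ds → Code n a₀ d₀ As Ds × replicate u U ++ P ≡ Z n a₀ d₀ As Ds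
irr⇒Zᴰ : ∀ {h P n} → Irr (suc h) P → ∀ a a₀ d₀ e → a₀ < a → 0 < e → suc h + (d₀ + e) ≡ a → d₀ + e + downs P ≡ n →
  ∃₂ λ As Ds → Code n a₀ d₀ As Ds × replicate (a ∸ a₀) U ++ replicate e D ++ P ≡ Z n a₀ d₀ As Ds
irr⇒Zᵁ {n = n} last u a₀ d₀ 0<u e refl = [] , [] ,
  end (≤-trans (+-monoˡ-≤ a₀ 0<u) (≤-trans (≥-of e) (≤-of (+-comm 1 d₀)))) (m<m+n d₀ (s≤s z≤n)) ,
  cong₂ (λ k l → replicate k U ++ replicate l D ++ [])
    (sym (trans (cong (_∸ a₀) (trans (+-comm d₀ 1) e)) (m+n∸n≡m u a₀)))
    (sym (m+n∸m≡n d₀ 1))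
irr⇒Zᵁ {h} (up {P = P} p) u a₀ d₀ 0<u e e′ = let (As , Ds , c , q) = irr⇒Zᵁ p (suc u) a₀ d₀ (s≤s z≤n) (cong suc e) e′ in
  As , Ds , c , trans (replicate-snoc u U P) q
irr⇒Zᵁ (down {h} {P} p) u a₀ d₀ 0<u e e′ =
  let (As , Ds , c , q) = irr⇒Zᴰ p (u + a₀) a₀ d₀ 1 (+-monoˡ-≤ a₀ 0<u) (s≤s z≤n)
        (trans (trans (cong (suc h +_) (+-comm d₀ 1)) (+-suc (suc h) d₀)) e) (trans (+-assoc d₀ 1 _) e′) in
  As , Ds , c , trans (cong (λ k → replicate k U ++ D ∷ P) (sym (m+n∸n≡m u a₀))) q
irr⇒Zᴰ last a a₀ d₀ e a₀<a 0<e refl refl = [] , [] ,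
  end (≤-trans a₀<a (≤-of (+-comm 1 (d₀ + e)))) (≤-trans (s≤s (m≤m+n d₀ e)) (≤-of (+-comm 1 (d₀ + e)))) ,
  cong₂ (λ k R → replicate k U ++ R) (cong (_∸ a₀) (+-comm 1 (d₀ + e)))
    (trans (replicate-snoc e D []) (cong (λ k → replicate k D ++ [])
      (sym (trans (cong (_∸ d₀) (trans (+-assoc d₀ e 1) (cong (d₀ +_) (+-comm e 1)))) (m+n∸m≡n d₀ (suc e))))))
irr⇒Zᴰ {h} (up {P = P} p) a a₀ d₀ e a₀<a 0<e e₁ e₂ =
  let (As , Ds , c , q) = irr⇒Zᵁ p 1 a (d₀ + e) (s≤s z≤n) (cong suc e₁) e₂ in
  a ∷ As , d₀ + e ∷ Ds , step a₀<a (m<m+n d₀ 0<e) (≤-trans (s≤s (m≤n+m (d₀ + e) h)) (≤-of e₁)) c ,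
  cong₂ (λ k R → replicate (a ∸ a₀) U ++ replicate k D ++ R) (sym (m+n∸m≡n d₀ e)) q
irr⇒Zᴰ (down {h} {P} p) a a₀ d₀ e a₀<a 0<e e₁ e₂ =
  let (As , Ds , c , q) = irr⇒Zᴰ p a a₀ d₀ (suc e) a₀<a (s≤s z≤n)
        (trans (cong (suc h +_) (+-suc d₀ e)) (trans (+-suc (suc h) (d₀ + e)) e₁))
        (trans (cong (_+ downs P) (+-suc d₀ e)) (trans (sym (+-suc (d₀ + e) (downs P))) e₂)) in
  As , Ds , c , trans (cong (replicate (a ∸ a₀) U ++_) (replicate-snoc e D P)) q

irr⇒Z : ∀ {P} → Irr 0 P → ∃₂ λ As Ds → Code (downs P) 0 0 As Ds × P ≡ Z (downs P) 0 0 As Ds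
irr⇒Z (up p) = irr⇒Zᵁ p 1 0 0 (s≤s z≤n) refl refl

-- Fitting a path in terms of its peaks and valleys

fit-U⁻ : ∀ u {R c i s f a} → 0 < u → u + c ≡ a → Fit (replicate u U ++ R) c i s f → Fit R a i U f
fit-U⁻ (suc zero) _ refl p = p
fit-U⁻ (suc (suc u)) {c = c} {i} _ e p = fit-U⁻ (suc u) {c = suc c} {i} {U} (s≤s z≤n) (trans (+-suc (suc u) c) e) p

fit-U⁺ : ∀ u {R c i s f a} → 0 < u → u + c ≡ a → Fit R a i U f → Fit (replicate u U ++ R) c i s f
fit-U⁺ (suc zero) _ refl p = p
fit-U⁺ (suc (suc u)) {c = c} {i} _ e p = fit-U⁺ (suc u) {c = suc c} {i} {U} (s≤s z≤n) (trans (+-suc (suc u) c) e) p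

fit-D⁻ : ∀ e {R c i f d} → e + i ≡ d → Fit (replicate e D ++ R) c i D f →
  (∀ j → i ≤ j → j < d → f j < c) × Fit R c d D f
fit-D⁻ zero refl p = (λ j i≤j j<i → contradiction j<i (≤⇒≯ i≤j)) , p
fit-D⁻ (suc e) {c = c} {i} {f} {d} eq (l , p) = bound , proj₂ ih
  where
  ih = fit-D⁻ e (trans (+-suc e i) eq) p
  bound : ∀ j → i ≤ j → j < d → f j < c
  bound j i≤j j<d with m≤n⇒m<n∨m≡n i≤j
  ... | inj₁ i<j  = proj₁ ih j i<j j<d
  ... | inj₂ refl = l

fit-D⁺ : ∀ e {R c i f d} → e + i ≡ d → (∀ j → i ≤ j → j < d → f j < c) → Fit R c d D f →
  Fit (replicate e D ++ R) c i D f
fit-D⁺ zero refl _ p = p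
fit-D⁺ (suc e) {i = i} eq bound p = bound i ≤-refl (≤-trans (s≤s (m≤n+m i e)) (≤-of eq)) ,
  fit-D⁺ e (trans (+-suc e i) eq) (λ j i<j → bound j (<⇒≤ i<j)) p

fit-UD⁻ : ∀ {a a′ d d′ R f} → a < a′ → d < d′ → Fit (replicate (a′ ∸ a) U ++ replicate (d′ ∸ d) D ++ R) a d D f →
  suc (f d) ≡ a′ × (∀ j → d < j → j < d′ → f j < a′) × Fit R a′ d′ D f
fit-UD⁻ {a} {a′} {d} {d′} {R} {f} a<a′ d<d′ p =
  split (d′ ∸ d) (m<n⇒0<n∸m d<d′) (m∸n+n≡m (<⇒≤ d<d′)) (fit-U⁻ (a′ ∸ a) (m<n⇒0<n∸m a<a′) (m∸n+n≡m (<⇒≤ a<a′)) p)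
  where
  split : ∀ e → 0 < e → e + d ≡ d′ → Fit (replicate e D ++ R) a′ d U f →
    suc (f d) ≡ a′ × (∀ j → d < j → j < d′ → f j < a′) × Fit R a′ d′ D f
  split (suc e) _ eq (q , r) = q , fit-D⁻ e (trans (+-suc e d) eq) r

fit-UD⁺ : ∀ {a a′ d d′ R f} → a < a′ → d < d′ → suc (f d) ≡ a′ → (∀ j → d < j → j < d′ → f j < a′) → Fit R a′ d′ D f →
  Fit (replicate (a′ ∸ a) U ++ replicate (d′ ∸ d) D ++ R) a d D f
fit-UD⁺ {a} {a′} {d} {d′} {R} {f} a<a′ d<d′ e₁ bound p =
  fit-U⁺ (a′ ∸ a) (m<n⇒0<n∸m a<a′) (m∸n+n≡m (<⇒≤ a<a′)) (join (d′ ∸ d) (m<n⇒0<n∸m d<d′) (m∸n+n≡m (<⇒≤ d<d′)))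
  where
  join : ∀ e → 0 < e → e + d ≡ d′ → Fit (replicate e D ++ R) a′ d U f
  join (suc e) _ eq = e₁ , fit-D⁺ e (trans (+-suc e d) eq) bound p

fit-Z-peak : ∀ {n a d As Ds f i b} → Code n a d As Ds → Fit (Z n a d As Ds) a d D f →
  (i , b) ∈ zip (d ∷ Ds) (As ++ n ∷ []) → suc (f i) ≡ b
fit-Z-peak (end a<n d<n) p (here refl) = proj₁ (fit-UD⁻ a<n d<n p)
fit-Z-peak (step a< d< _ c) p (here refl) = proj₁ (fit-UD⁻ a< d< p)
fit-Z-peak (step a< d< _ c) p (there q) = fit-Z-peak c (proj₂ (proj₂ (fit-UD⁻ a< d< p))) q

fit-Z-valley : ∀ {n a d As Ds f x y} → Code n a d As Ds → Fit (Z n a d As Ds) a d D f →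
  (x , y) ∈ zip As Ds → ∀ i → d ≤ i → i < y → f i < x
fit-Z-valley (step {d′ = d′} a< d< _ c) p q i d≤i i<y with fit-UD⁻ a< d< p | m≤n⇒m<n∨m≡n d≤i
fit-Z-valley (step a< d< _ c) p (here refl) i d≤i i<y | e , l , r | inj₁ d<i  = l i d<i i<y
fit-Z-valley (step a< d< _ c) p (here refl) i d≤i i<y | e , l , r | inj₂ refl = ≤-of e
fit-Z-valley {As = _ ∷ As} {_ ∷ Ds} (step {d′ = d′} a< d< _ c) p (there q) i d≤i i<y | e , l , r | d≤i′ with d′ ≤? i
... | yes d′≤i = fit-Z-valley c r q i d′≤i i<y
... | no d′≰i = <-trans (near d≤i′) (All.lookup (AllPairs.head (code-sortedᵃ c)) (zip-∈ˡ As Ds q))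
  where
  near : _ < i ⊎ _ ≡ i → _
  near (inj₁ d<i)  = l i d<i (≰⇒> d′≰i)
  near (inj₂ refl) = ≤-of e

-- A descent that ends in the valley `(x , y)` starts from a peak with `x` up steps, so the valley
-- condition bounds `f` along it. The last descent ends in no valley and needs the bound by `n`.
fit-Z : ∀ {n a d As Ds f} → Code n a d As Ds →
  (∀ {i b} → (i , b) ∈ zip (d ∷ Ds) (As ++ n ∷ []) → suc (f i) ≡ b) →
  (∀ {x y} → (x , y) ∈ zip As Ds → ∀ i → i < y → f i < x) →
  (∀ i → i < n → f i < n) → Fit (Z n a d As Ds) a d D f
fit-Z (end a<n d<n) peak _ bound = fit-UD⁺ a<n d<n (peak (here refl)) (λ j _ → bound j) _
fit-Z (step a< d< _ c) peak valley bound = fit-UD⁺ a< d< (peak (here refl)) (λ j _ → valley (here refl) j)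
  (fit-Z c (peak ∘ there) (valley ∘ there) bound)

-- The order on irreducible paths in terms of codes

-- As and Ds arise from As′ and Ds′ by dropping elements; in every initial part
-- of As′ and Ds′ at most k more elements are dropped from Ds′ than from As′.
data Thin : ℕ → List ℕ → List ℕ → List ℕ → List ℕ → Set where
  []        : Thin 0 [] [] [] []
  keep-keep : ∀ {k a d As′ Ds′ As Ds} → Thin k As′ Ds′ As Ds → Thin k (a ∷ As′) (d ∷ Ds′) (a ∷ As) (d ∷ Ds)
  drop-drop : ∀ {k a d As′ Ds′ As Ds} → Thin k As′ Ds′ As Ds → Thin k (a ∷ As′) (d ∷ Ds′) As Ds
  drop-keep : ∀ {k a d As′ Ds′ As Ds} → Thin (suc k) As′ Ds′ As Ds → Thin k (a ∷ As′) (d ∷ Ds′) As (d ∷ Ds)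
  keep-drop : ∀ {k a d As′ Ds′ As Ds} → Thin k As′ Ds′ As Ds → Thin (suc k) (a ∷ As′) (d ∷ Ds′) (a ∷ As) Ds

-- With a positive surplus some descent must still be dropped. The first such one is deleted; the
-- kept descents before it, starting with `d`, then move one place to the right against the ascents,
-- which uses up one unit of the surplus.
thin-delete-descent : ∀ {k As′ Ds′ As Ds} d → Thin (suc k) As′ Ds′ As Ds →
  Σ[ j ∈ Fin (length Ds′) ] Thin k As′ (d ∷ removeAt Ds′ j) As (d ∷ Ds)
thin-delete-descent d (keep-keep {d = e} t) = let (j , t′) = thin-delete-descent e t in Fin.suc j , keep-keep t′
thin-delete-descent d (drop-drop t) = Fin.zero , drop-keep t
thin-delete-descent d (drop-keep {d = e} t) = let (j , t′) = thin-delete-descent e t in Fin.suc j , drop-keep t′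
thin-delete-descent d (keep-drop t) = Fin.zero , keep-keep t

thin-delete : ∀ {As′ Ds′ As Ds} → Thin 0 As′ Ds′ As Ds → (As′ ≡ As × Ds′ ≡ Ds) ⊎
  (Σ[ i ∈ Fin (length As′) ] Σ[ j ∈ Fin (length Ds′) ] toℕ i ≤ toℕ j × Thin 0 (removeAt As′ i) (removeAt Ds′ j) As Ds)
thin-delete [] = inj₁ (refl , refl)
thin-delete (keep-keep t) with thin-delete t
... | inj₁ (refl , refl) = inj₁ (refl , refl)
... | inj₂ (i , j , i≤j , t′) = inj₂ (Fin.suc i , Fin.suc j , s≤s i≤j , keep-keep t′)
thin-delete (drop-drop t) = inj₂ (Fin.zero , Fin.zero , z≤n , t)
thin-delete (drop-keep {d = d} t) = let (j , t′) = thin-delete-descent d t in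
  inj₂ (Fin.zero , Fin.suc j , z≤n , t′)

code-weaken : ∀ {n a a′ d d′ As Ds} → a < a′ → d < d′ → Code n a′ d′ As Ds → Code n a d As Ds
code-weaken a< d< (end p q)      = end (<-trans a< p) (<-trans d< q)
code-weaken a< d< (step p q r c) = step (<-trans a< p) (<-trans d< q) r c

code-delete₀ : ∀ {n a d x As Ds} → Code n a d (x ∷ As) Ds → ∀ j → Code n x d As (removeAt Ds j)
code-delete₀ (step {a′ = x} {d′} a<x d<d′ d′<x (end p q)) Fin.zero = end p (<-trans d<d′ q)
code-delete₀ (step a<x d<d′ d′<x (step p q r c)) Fin.zero = step p (<-trans d<d′ q) r c
code-delete₀ (step a<x d<d′ d′<x c@(step p _ _ _)) (Fin.suc j) = step p d<d′ (<-trans d′<x p) (code-delete₀ c j)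

-- Between the two deleted indices each descent is now paired with the next ascent, which is larger
-- than its former partner, so the path stays above the axis.
code-delete : ∀ {n a d As Ds} → Code n a d As Ds → ∀ i j → toℕ i ≤ toℕ j → Code n a d (removeAt As i) (removeAt Ds j)
code-delete (step p q _ c) Fin.zero Fin.zero _ = code-weaken p q c
code-delete (step p q r c@(step p′ _ _ _)) Fin.zero (Fin.suc j) _ =
  step (<-trans p p′) q (<-trans r p′) (code-delete₀ c j)
code-delete (step p q r c) (Fin.suc i) (Fin.suc j) (s≤s i≤j) = step p q r (code-delete c i j i≤j)

-- The bound `l` serves as fuel: each covering step shortens the ascent code by one.
thin⇒≼ᵢ : ∀ l {n As′ Ds′ As Ds} → length As′ ≤ l → Code n 0 0 As′ Ds′ → Thin 0 As′ Ds′ As Ds →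
  Z n 0 0 As′ Ds′ ≼ᵢ Z n 0 0 As Ds
thin⇒≼ᵢ l len c t with thin-delete t
... | inj₁ (refl , refl) = ε
thin⇒≼ᵢ zero    {As′ = []} len c t | inj₂ (() , _)
thin⇒≼ᵢ (suc l) {n} {As′} {Ds′} len c t | inj₂ (i , j , i≤j , t′) =
  cover (irr⇒Irreducible (Z-irr₀ c)) (irr⇒Irreducible (Z-irr₀ c′)) (trans (Z-semilength c) (sym (Z-semilength c′)))
    (Z-ascentCode c) (Z-descentCode c) i j i≤j (Z-ascentCode c′) (Z-descentCode c′)
  ◅ thin⇒≼ᵢ l (s≤s⁻¹ (≤-trans (≥-of (List.length-removeAt′ As′ i)) len)) c′ t′
  where
  c′ = code-delete c i j i≤j
  -- Stated for arbitrary lists, so that the code equations can be matched with `refl` and the `Fin`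
  -- indices need no transport.
  cover : ∀ {P Q As Ds} → Irreducible P → Irreducible Q → semilength P ≡ semilength Q →
    ascentCode P ≡ As → descentCode P ≡ Ds → (i : Fin (length As)) (j : Fin (length Ds)) → toℕ i ≤ toℕ j →
    ascentCode Q ≡ removeAt As i → descentCode Q ≡ removeAt Ds j → P ⋖ Q
  cover irrP irrQ e refl refl i j i≤j eA eD = record
    { irreducibleˡ = irrP ; irreducibleʳ = irrQ ; sameSemilength = e ; i = i ; j = j ; i≤j = i≤j
    ; ascents-del = eA ; descents-del = eD }

-- The index that an entry had before the deletion at `i`, given its index `k` afterwards.
skip : ℕ → ℕ → ℕ
skip zero    k       = suc k
skip (suc i) zero    = zero
skip (suc i) (suc k) = suc (skip i k)

-- Here the condition that the deleted descent comes no earlier than the deleted ascent is used: a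
-- later deletion shifts fewer indices.
skip-mono : ∀ {i j k l} → i ≤ j → l ≤ k → skip j l ≤ skip i k
skip-mono {zero} {zero} _ l≤k = s≤s l≤k
skip-mono {zero} {suc j} {l = zero} _ _ = z≤n
skip-mono {zero} {suc j} {suc k} {suc l} _ (s≤s l≤k) = s≤s (skip-mono {zero} {j} z≤n l≤k)
skip-mono {suc i} {suc j} {l = zero} _ _ = z≤n
skip-mono {suc i} {suc j} {suc k} {suc l} (s≤s i≤j) (s≤s l≤k) = s≤s (skip-mono i≤j l≤k)

At-removeAt : ∀ {xs : List ℕ} {k x} i → At (removeAt xs i) k x → At xs (skip (toℕ i) k) x
At-removeAt {_ ∷ _} Fin.zero    p         = there p
At-removeAt {_ ∷ _} (Fin.suc i) here      = here
At-removeAt {_ ∷ _} (Fin.suc i) (there p) = there (At-removeAt i p)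

-- A valley of `Q` is traced back through the deletions. Its two indices agree in `Q`, and each step
-- back preserves `q ≤ p`.
≼ᵢ⇒At : ∀ {P Q} → P ≼ᵢ Q → ∀ {x y} → (x , y) ∈ zip (ascentCode Q) (descentCode Q) →
  ∃₂ λ p q → At (ascentCode P) p x × At (descentCode P) q y × q ≤ p
≼ᵢ⇒At {P} ε p = let (t , r , s) = zip-at (ascentCode P) (descentCode P) p in t , t , r , s , ≤-refl
≼ᵢ⇒At (s ◅ ss) r =
  let (p , q , at-x , at-y , q≤p) = ≼ᵢ⇒At ss r in
  skip (toℕ i) p , skip (toℕ j) q ,
  At-removeAt i (subst (λ L → At L p _) ascents-del at-x) ,
  At-removeAt j (subst (λ L → At L q _) descents-del at-y) ,
  skip-mono i≤j q≤p
  where open _⋖_ s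

≼ᵢ-semilength : ∀ {P Q} → P ≼ᵢ Q → semilength P ≡ semilength Q
≼ᵢ-semilength ε        = refl
≼ᵢ-semilength (s ◅ ss) = trans (_⋖_.sameSemilength s) (≼ᵢ-semilength ss)

≼ᵢ⇒cnt : ∀ {n As′ Ds′ As Ds} → Code n 0 0 As′ Ds′ → Code n 0 0 As Ds → Z n 0 0 As′ Ds′ ≼ᵢ Z n 0 0 As Ds →
  ∀ {x y} → (x , y) ∈ zip As Ds → x ∈ As′ × y ∈ Ds′ × cnt y Ds′ ≤ cnt x As′
≼ᵢ⇒cnt {As′ = As′} {Ds′} c′ c s p
  with ≼ᵢ⇒At s (subst₂ (λ A E → _ ∈ zip A E) (sym (Z-ascentCode c)) (sym (Z-descentCode c)) p)
... | k , l , at-x , at-y , l≤k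
  with subst (λ L → At L k _) (Z-ascentCode c′) at-x | subst (λ L → At L l _) (Z-descentCode c′) at-y
... | at-x′ | at-y′ = At⇒∈ at-x′ , At⇒∈ at-y′ ,
  subst₂ _≤_ (sym (At⇒cnt (AllPairs.tail (code-sortedᵈ c′)) at-y′))
    (sym (At⇒cnt (AllPairs.tail (code-sortedᵃ c′)) at-x′)) l≤k

sorted-⊆⇒⊑ : ∀ {xs ys} → Sorted xs → Sorted ys → (∀ {z} → z ∈ xs → z ∈ ys) → xs ⊑ ys
sorted-⊆⇒⊑ {[]} {[]} _ _ _ = []
sorted-⊆⇒⊑ {x ∷ xs} {[]} _ _ sub with () ← sub (here refl)
sorted-⊆⇒⊑ {[]} {y ∷ ys} s (_ ∷ s′) _ = y ∷ʳ sorted-⊆⇒⊑ s s′ λ ()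
sorted-⊆⇒⊑ {x ∷ xs} {y ∷ ys} (x< ∷ s) (y< ∷ s′) sub with sub (here refl)
... | here refl = refl ∷ sorted-⊆⇒⊑ s s′ λ z∈ → above (sub (there z∈)) (All.lookup x< z∈)
  where
  above : ∀ {z} → z ∈ x ∷ ys → x < z → z ∈ ys
  above (here refl) x<x = contradiction x<x (<-irrefl refl)
  above (there z∈)  _   = z∈
... | there x∈ = y ∷ʳ sorted-⊆⇒⊑ (x< ∷ s) s′ λ z∈ → above (sub z∈) (y<z z∈)
  where
  y<z : ∀ {z} → z ∈ x ∷ xs → y < z
  y<z (here refl) = All.lookup y< x∈
  y<z (there z∈)  = <-trans (All.lookup y< x∈) (All.lookup x< z∈)
  above : ∀ {z} → z ∈ y ∷ ys → y < z → z ∈ ys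
  above (here refl) y<y = contradiction y<y (<-irrefl refl)
  above (there z∈)  _   = z∈

⊑⇒⊆ : ∀ {xs ys : List ℕ} → xs ⊑ ys → ∀ {z} → z ∈ xs → z ∈ ys
⊑⇒⊆ (y ∷ʳ p)   z∈          = there (⊑⇒⊆ p z∈)
⊑⇒⊆ (refl ∷ p) (here refl) = here refl
⊑⇒⊆ (refl ∷ p) (there z∈)  = there (⊑⇒⊆ p z∈)

∈-drop : ∀ k {xs : List ℕ} {z} → z ∈ drop k xs → z ∈ xs
∈-drop zero             z∈ = z∈
∈-drop (suc k) {_ ∷ xs} z∈ = there (∈-drop k z∈)

zip-drop : ∀ k {As Ds : List ℕ} {d x y} → (x , y) ∈ zip (drop (suc k) As) Ds → (x , y) ∈ zip (drop k As) (d ∷ Ds)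
zip-drop zero    {_ ∷ _} p = there p
zip-drop (suc k) {_ ∷ _} p = zip-drop k p

-- At surplus `k`, the partners of `k` kept descents that were already read are still to come among
-- the ascents. Hence the remaining descents are paired with `drop k As`.
thin : ∀ {k As′ Ds′ As Ds} → As ⊑ As′ → Ds ⊑ Ds′ → Sorted As′ → Sorted Ds′ → length As′ ≡ length Ds′ →
  length As ≡ k + length Ds → (∀ {x y} → (x , y) ∈ zip (drop k As) Ds → cnt y Ds′ ≤ cnt x As′) →
  Thin k As′ Ds′ As Ds
thin {zero} [] [] _ _ _ _ _ = []
thin {suc k} [] [] _ _ _ () _
thin {k} {a ∷ As′} {d ∷ Ds′} p q (a< ∷ sa) (d< ∷ sd) e = go p q
  where
  peel : ∀ {x y} → x ∈ As′ → y ∈ Ds′ → cnt y (d ∷ Ds′) ≤ cnt x (a ∷ As′) → cnt y Ds′ ≤ cnt x As′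
  peel x∈ y∈ le = s≤s⁻¹ (subst₂ _≤_ (cnt-∷-< Ds′ (All.lookup d< y∈)) (cnt-∷-< As′ (All.lookup a< x∈)) le)
  e′ = suc-injective e
  peel-zip : ∀ j {As Ds x y} → As ⊑ As′ → Ds ⊑ Ds′ → (x , y) ∈ zip (drop j As) Ds →
    cnt y (d ∷ Ds′) ≤ cnt x (a ∷ As′) → cnt y Ds′ ≤ cnt x As′
  peel-zip j {As} {Ds} p q r = peel (⊑⇒⊆ p (∈-drop j (zip-∈ˡ (drop j As) Ds r))) (⊑⇒⊆ q (zip-∈ʳ (drop j As) Ds r))
  go : ∀ {k As Ds} → As ⊑ a ∷ As′ → Ds ⊑ d ∷ Ds′ → length As ≡ k + length Ds →
    (∀ {x y} → (x , y) ∈ zip (drop k As) Ds → cnt y (d ∷ Ds′) ≤ cnt x (a ∷ As′)) → Thin k (a ∷ As′) (d ∷ Ds′) As Ds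
  go {k} {_ ∷ As} (refl ∷ p) (refl ∷ q) l h =
    keep-keep (thin p q sa sd e′ (suc-injective (trans l (+-suc k _)))
      λ r → peel-zip k p q r (h (zip-drop k {a ∷ As} r)))
  go {k} (.a ∷ʳ p) (refl ∷ q) l h =
    drop-keep (thin p q sa sd e′ (trans l (+-suc k _)) λ r → peel-zip (suc k) p q r (h (zip-drop k r)))
  go {k} (.a ∷ʳ p) (.d ∷ʳ q) l h = drop-drop (thin p q sa sd e′ l λ r → peel-zip k p q r (h r))
  go {suc k} (refl ∷ p) (.d ∷ʳ q) l h =
    keep-drop (thin p q sa sd e′ (suc-injective l) λ r → peel-zip k p q r (h r))
  -- `a` is the partner of `y`; no ascent is smaller than `a`, but the dropped `d` is smaller than
  -- `y`, against the count condition.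
  go {zero} {_ ∷ As} {y ∷ Ds} (refl ∷ p) (.d ∷ʳ q) l h = contradiction
    (subst₂ _≤_ (cnt-∷-< Ds′ (All.lookup d< (⊑⇒⊆ q (here refl)))) (At⇒cnt (a< ∷ sa) here) (h (here refl))) λ ()

-- Complements and the code of `L′`

comp : List ℕ → ℕ → List ℕ
comp X N = filter (λ x → ¬? (x ∈? X)) (map suc (downFrom N))

∈-range⁻ : ∀ {N z} → z ∈ map suc (downFrom N) → 0 < z × z ≤ N
∈-range⁻ z∈ with ∈-map⁻ suc z∈
... | y , y∈ , refl = s≤s z≤n , ∈-downFrom⁻ y∈

∈-range⁺ : ∀ {N z} → 0 < z → z ≤ N → z ∈ map suc (downFrom N)
∈-range⁺ {z = suc z} _ z<N = ∈-map⁺ suc (∈-downFrom⁺ z<N)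

length-range : ∀ N → length (map suc (downFrom N)) ≡ N
length-range N = trans (List.length-map suc (downFrom N)) (List.length-downFrom N)

range-decreasing : ∀ N → AllPairs (λ x y → y < x) (map suc (downFrom N))
range-decreasing N = AllPairs.map⁺ (AllPairs.applyDownFrom⁺₁ id N λ j<i _ → s≤s j<i)

decreasing⇒unique : ∀ {xs} → AllPairs (λ x y → y < x) xs → Unique xs
decreasing⇒unique = AllPairs.map λ y<x → <⇒≢ y<x ∘ sym

module _ {X : List ℕ} {N : ℕ} where

  ∈-comp⁻ : ∀ {z} → z ∈ comp X N → 0 < z × z ≤ N × z ∉ X
  ∈-comp⁻ z∈ = let (r , z∉) = ∈-filter⁻ (λ x → ¬? (x ∈? X)) {xs = map suc (downFrom N)} z∈
                   (p , q) = ∈-range⁻ r in p , q , z∉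

  ∈-comp⁺ : ∀ {z} → 0 < z → z ≤ N → z ∉ X → z ∈ comp X N
  ∈-comp⁺ p q z∉ = ∈-filter⁺ (λ x → ¬? (x ∈? X)) (∈-range⁺ p q) z∉

  comp-decreasing : AllPairs (λ x y → y < x) (comp X N)
  comp-decreasing = AllPairs.filter⁺ (λ x → ¬? (x ∈? X)) (range-decreasing N)

comp-∉ : ∀ X N → suc N ∉ X → comp X (suc N) ≡ suc N ∷ comp X N
comp-∉ X N p = List.filter-accept (λ x → ¬? (x ∈? X)) p

length-comp : ∀ {X} K → Unique X → (∀ {x} → x ∈ X → 0 < x) →
  length (comp X K) + length (filter (_≤? K) X) ≡ K
length-comp {X} K u pos = trans (sym (List.length-++ (comp X K))) (≤-antisym
  (≤-trans (card uniq sub) (≤-of (length-range K)))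
  (≤-trans (≥-of (length-range K)) (card (decreasing⇒unique (range-decreasing K)) sup)))
  where
  L = comp X K ++ filter (_≤? K) X
  uniq : Unique L
  uniq = Unique.++⁺ (decreasing⇒unique (comp-decreasing {X} {K})) (Unique.filter⁺ (_≤? K) u)
    λ (p , q) → proj₂ (proj₂ (∈-comp⁻ {X} {K} p)) (proj₁ (∈-filter⁻ (_≤? K) {xs = X} q))
  sub : ∀ {z} → z ∈ L → z ∈ map suc (downFrom K)
  sub z∈ with ∈-++⁻ (comp X K) z∈
  ... | inj₁ p = let (a , b , _) = ∈-comp⁻ {X} {K} p in ∈-range⁺ a b
  ... | inj₂ q = let (a , b) = ∈-filter⁻ (_≤? K) {xs = X} q in ∈-range⁺ (pos a) b
  sup : ∀ {z} → z ∈ map suc (downFrom K) → z ∈ L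
  sup {z} z∈ with z ∈? X
  ... | yes p = ∈-++⁺ʳ (comp X K) (∈-filter⁺ (_≤? K) p (proj₂ (∈-range⁻ z∈)))
  ... | no p  = ∈-++⁺ˡ (∈-comp⁺ (proj₁ (∈-range⁻ z∈)) (proj₂ (∈-range⁻ z∈)) p)

length-filter-≤-mono : ∀ K Xs Ys → length Xs ≡ length Ys → (∀ {x y} → (x , y) ∈ zip Xs Ys → y ≤ x) →
  length (filter (_≤? K) Xs) ≤ length (filter (_≤? K) Ys)
length-filter-≤-mono K [] Ys e h = z≤n
length-filter-≤-mono K (x ∷ Xs) (y ∷ Ys) e h with x ≤? K | y ≤? K
... | yes x≤K | yes y≤K rewrite List.filter-accept (_≤? K) {xs = Xs} x≤K | List.filter-accept (_≤? K) {xs = Ys} y≤K =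
  s≤s (length-filter-≤-mono K Xs Ys (suc-injective e) (h ∘ there))
... | yes x≤K | no y≰K = contradiction (≤-trans (h (here refl)) x≤K) y≰K
... | no x≰K | yes y≤K rewrite List.filter-reject (_≤? K) {xs = Xs} x≰K | List.filter-accept (_≤? K) {xs = Ys} y≤K =
  m≤n⇒m≤1+n (length-filter-≤-mono K Xs Ys (suc-injective e) (h ∘ there))
... | no x≰K | no y≰K rewrite List.filter-reject (_≤? K) {xs = Xs} x≰K | List.filter-reject (_≤? K) {xs = Ys} y≰K =
  length-filter-≤-mono K Xs Ys (suc-injective e) (h ∘ there)

-- Both decreasing lists are scanned from the top with separate bounds, keeping `N ≤ M` and equal
-- numbers of remaining entries. The order of the bounds could be lost only if they coincide and the
-- top value is missing from the second list alone; then the counting hypothesis fails one step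
-- further down.
comp-zip-≤ : ∀ {X Y} N M → N ≤ M → length (comp X N) ≡ length (comp Y M) →
  (∀ K → length (comp Y K) ≤ length (comp X K)) → ∀ {x y} → (x , y) ∈ zip (comp X N) (comp Y M) → x ≤ y
comp-zip-≤ {X} {Y} (suc N) (suc M) (s≤s N≤M) e le p with suc N ∈? X
... | yes i = comp-zip-≤ N (suc M) (m≤n⇒m≤1+n N≤M) e le p
... | no i with suc M ∈? Y
...   | yes j with m≤n⇒m<n∨m≡n N≤M
...     | inj₁ N<M = comp-zip-≤ (suc N) M N<M (trans (cong length (comp-∉ X N i)) e) le
                       (subst (λ L → _ ∈ zip L (comp Y M)) (sym (comp-∉ X N i)) p)
...     | inj₂ refl = contradiction (≤-trans (≤-of e) (le N)) 1+n≰n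
comp-zip-≤ {X} {Y} (suc N) (suc M) (s≤s N≤M) e le (here refl) | no i | no j = s≤s N≤M
comp-zip-≤ {X} {Y} (suc N) (suc M) (s≤s N≤M) e le (there q) | no i | no j = comp-zip-≤ N M N≤M (suc-injective e) le q

-- The code of L′ of the path with the code (Bs , Es).
A′ D′ : ℕ → List ℕ → List ℕ
A′ m Bs = map (m ∸_) (complement m (map pred Bs))
D′ m Es = map (m ∸ 1 ∸_) (complement m Es)

≤∸2 : ∀ {m z} → 0 < z → z ≤ m ∸ 2 → 2 + z ≤ m
≤∸2 {zero} 0<z z≤ = contradiction 0<z (≤⇒≯ z≤)
≤∸2 {suc zero} 0<z z≤ = contradiction 0<z (≤⇒≯ z≤)
≤∸2 {suc (suc m)} 0<z z≤ = s≤s (s≤s z≤)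

module _ {m Bs Es} (c : Code m 0 0 Bs Es) where

  private
    posE : ∀ {e} → e ∈ Es → 0 < e
    posE = All.lookup (AllPairs.head (code-sortedᵈ c))

    1<B : ∀ {b} → b ∈ Bs → 1 < b
    1<B b∈ = let (e , p) = ∈⇒zipˡ (code-length c) b∈ in ≤-<-trans (posE (zip-∈ʳ Bs Es p)) (code-zip c p)

    E<m : ∀ {e} → e ∈ Es → suc e < m
    E<m e∈ = let (b , p) = ∈⇒zipʳ (code-length c) e∈ in ≤-<-trans (code-zip c p) (code-As<n c (zip-∈ˡ Bs Es p))

    ∈-pred⁻ : ∀ {z} → z ∈ map pred Bs → suc z ∈ Bs
    ∈-pred⁻ z∈ with ∈-map⁻ pred z∈
    ... | zero  , b∈ , refl = contradiction (1<B b∈) λ ()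
    ... | suc b , b∈ , refl = b∈

  -- A letter of rank `x` from the top is the letter `b` exactly if `b + x` is `suc m`, so the last
  -- condition excludes the right-to-left maxima. The bounds exclude the letters `m`, always a
  -- maximum, and 1, always a minimum.
  ∈-A′⁻ : ∀ {x} → x ∈ A′ m Bs → 1 < x × x < m × (∀ {b} → b ∈ Bs → b + x ≢ suc m)
  ∈-A′⁻ x∈ with ∈-map⁻ (m ∸_) x∈
  ... | z , z∈ , refl with ∈-comp⁻ {map pred Bs} {m ∸ 2} z∈
  ... | 0<z , z≤ , z∉ = +-cancelʳ-≤ z 2 _ (≤-trans 2+z≤m (≥-of x+z)) ,
        ≤-trans (m<m+n (m ∸ z) 0<z) (≤-of x+z) ,
        λ {b} b∈ e → z∉ (subst (_∈ map pred Bs) (cong pred (+-cancelʳ-≡ (m ∸ z) b (suc z)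
          (trans e (cong suc (trans (sym x+z) (+-comm (m ∸ z) z)))))) (∈-map⁺ pred b∈))
    where
    2+z≤m = ≤∸2 0<z z≤
    x+z : m ∸ z + z ≡ m
    x+z = m∸n+n≡m (≤-trans (m≤n+m z 2) 2+z≤m)

  ∈-A′⁺ : ∀ {x} → 1 < x → x < m → (∀ {b} → b ∈ Bs → b + x ≢ suc m) → x ∈ A′ m Bs
  ∈-A′⁺ {x} 1<x x<m h = subst (_∈ A′ m Bs) (m∸[m∸n]≡n (<⇒≤ x<m)) (∈-map⁺ (m ∸_)
    (∈-comp⁺ (m<n⇒0<n∸m x<m) (∸-monoʳ-≤ m 1<x) λ z∈ → h (∈-pred⁻ z∈) (cong suc (m∸n+n≡m (<⇒≤ x<m)))))

  -- Position `y` from the left is position `e` from the right exactly if `e + suc y` is `m`. The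
  -- bounds exclude the first position, always a minimum, and the last one, always a maximum.
  ∈-D′⁻ : ∀ {y} → y ∈ D′ m Es → 0 < y × suc y < m × (∀ {e} → e ∈ Es → e + suc y ≢ m)
  ∈-D′⁻ y∈ with ∈-map⁻ (m ∸ 1 ∸_) y∈
  ... | z , z∈ , refl with ∈-comp⁻ {Es} {m ∸ 2} z∈
  ... | 0<z , z≤ , z∉ =
        +-cancelʳ-≤ z 1 _ (≤-trans (m+n≤o⇒m≤o∸n (suc z) (≤-trans (≤-of (+-comm (suc z) 1)) 2+z≤m)) (≥-of y+z)) ,
        ≤-trans (s≤s (m<m+n y 0<z)) (≤-of 1+y+z) ,
        λ {e} e∈ eq → z∉ (subst (_∈ Es) (+-cancelʳ-≡ (suc y) e z
          (trans eq (trans (sym 1+y+z) (trans (cong suc (+-comm y z)) (sym (+-suc z y)))))) e∈)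
    where
    y = m ∸ 1 ∸ z
    2+z≤m = ≤∸2 0<z z≤
    y+z : y + z ≡ m ∸ 1
    y+z = m∸n+n≡m (m+n≤o⇒m≤o∸n z (≤-trans (≤-of (+-comm z 1)) (≤-trans (n≤1+n (suc z)) 2+z≤m)))
    1+y+z : suc (y + z) ≡ m
    1+y+z = trans (cong suc y+z) (m+[n∸m]≡n (≤-trans (s≤s z≤n) 2+z≤m))

  ∈-D′⁺ : ∀ {y} → 0 < y → suc y < m → (∀ {e} → e ∈ Es → e + suc y ≢ m) → y ∈ D′ m Es
  ∈-D′⁺ {y} 0<y 1+y<m h = subst (_∈ D′ m Es) (m∸[m∸n]≡n y≤) (∈-map⁺ (m ∸ 1 ∸_)
    (∈-comp⁺ (m<n⇒0<n∸m (m+n≤o⇒m≤o∸n (suc y) (≤-trans (≤-of (+-comm (suc y) 1)) 1+y<m)))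
      (≤-trans (∸-monoʳ-≤ (m ∸ 1) 0<y) (≤-of (∸-+-assoc m 1 1)))
      λ z∈ → h z∈ (trans (+-suc (m ∸ 1 ∸ y) y) (trans (cong suc (m∸n+n≡m y≤)) (m+[n∸m]≡n (≤-trans (s≤s z≤n) 1+y<m))))))
    where
    y≤ : y ≤ m ∸ 1
    y≤ = m+n≤o⇒m≤o∸n y (≤-trans (≤-of (+-comm y 1)) (<⇒≤ 1+y<m))

  A′-sorted : Sorted (A′ m Bs)
  A′-sorted = sorted-map (m ∸_) (comp-decreasing {map pred Bs} {m ∸ 2}) λ x∈ _ y<x →
    let (0<x , x≤ , _) = ∈-comp⁻ {map pred Bs} {m ∸ 2} x∈ in
    ∸-monoʳ-< y<x (≤-trans x≤ (m∸n≤m m 2))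

  D′-sorted : Sorted (D′ m Es)
  D′-sorted = sorted-map (m ∸ 1 ∸_) (comp-decreasing {Es} {m ∸ 2}) λ x∈ _ y<x →
    let (0<x , x≤ , _) = ∈-comp⁻ {Es} {m ∸ 2} x∈ in
    ∸-monoʳ-< y<x (≤-trans x≤ (∸-monoʳ-≤ m (s≤s z≤n)))

  private
    lengths : length (map pred Bs) ≡ length Es
    lengths = trans (List.length-map pred Bs) (code-length c)

    uniqB : Unique (map pred Bs)
    uniqB = sorted⇒unique (sorted-map pred (AllPairs.tail (code-sortedᵃ c))
      λ x∈ _ x<y → pred-mono-<′ (<-trans (s≤s z≤n) (1<B x∈)) x<y)
      where
      pred-mono-<′ : ∀ {x y} → 0 < x → x < y → pred x < pred y
      pred-mono-<′ {suc x} {suc y} _ (s≤s x<y) = x<y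

    uniqE : Unique Es
    uniqE = sorted⇒unique (AllPairs.tail (code-sortedᵈ c))

    posB : ∀ {x} → x ∈ map pred Bs → 0 < x
    posB x∈ = s≤s⁻¹ (1<B (∈-pred⁻ x∈))

    E≤pred-B : ∀ {x y} → (x , y) ∈ zip (map pred Bs) Es → y ≤ x
    E≤pred-B p with ∈-map⁻ (λ (x , y) → pred x , y)
      (subst (_ ∈_) (trans (cong (zip (map pred Bs)) (sym (List.map-id Es))) (zip-map pred id Bs Es)) p)
    ... | (b , e) , q , refl = <⇒≤pred (code-zip c q)

    length-comp-≤ : ∀ K → length (comp Es K) ≤ length (comp (map pred Bs) K)
    length-comp-≤ K = +-cancelʳ-≤ (length (filter (_≤? K) Es)) _ _
      (≤-trans (≤-of (trans (length-comp K uniqE posE) (sym (length-comp K uniqB posB))))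
        (+-monoʳ-≤ (length (comp (map pred Bs) K)) (length-filter-≤-mono K (map pred Bs) Es lengths E≤pred-B)))

    length-comp-≡ : length (comp (map pred Bs) (m ∸ 2)) ≡ length (comp Es (m ∸ 2))
    length-comp-≡ = +-cancelʳ-≡ (length Es) _ _ (trans
      (cong (length (comp (map pred Bs) (m ∸ 2)) +_)
        (trans (sym lengths) (cong length (sym (List.filter-all (_≤? (m ∸ 2)) B≤)))))
      (trans (length-comp (m ∸ 2) uniqB posB) (trans (sym (length-comp (m ∸ 2) uniqE posE))
        (cong (λ L → length (comp Es (m ∸ 2)) + length L) (List.filter-all (_≤? (m ∸ 2)) E≤)))))
      where
      B≤ : All (_≤ m ∸ 2) (map pred Bs)
      B≤ = All.tabulate λ x∈ → m+n≤o⇒m≤o∸n _ (≤-trans (≤-of (+-comm _ 2)) (code-As<n c (∈-pred⁻ x∈)))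
      E≤ : All (_≤ m ∸ 2) Es
      E≤ = All.tabulate λ e∈ → m+n≤o⇒m≤o∸n _ (≤-trans (≤-of (+-comm _ 2)) (E<m e∈))

    above : ∀ {x y} → (x , y) ∈ zip (A′ m Bs) (D′ m Es) → y < x
    above p with ∈-map⁻ (λ (x , y) → m ∸ x , m ∸ 1 ∸ y)
      (subst (_ ∈_) (zip-map (m ∸_) (m ∸ 1 ∸_) (complement m (map pred Bs)) (complement m Es)) p)
    ... | (x , y) , q , refl = ≤-trans
      (≤-of (trans (cong suc (∸-+-assoc m 1 y)) (sym (+-∸-assoc 1 y<m))))
      (∸-monoʳ-≤ m (comp-zip-≤ (m ∸ 2) (m ∸ 2) ≤-refl length-comp-≡ length-comp-≤ q))
      where
      y<m : suc y ≤ m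
      y<m = let (0<y , y≤ , _) = ∈-comp⁻ {Es} {m ∸ 2} (zip-∈ʳ (complement m (map pred Bs)) (complement m Es) q) in
        ≤-trans (n≤1+n (suc y)) (≤∸2 0<y y≤)

  -- Each descent entry is at most its ascent entry minus one, so complements compare entrywise the
  -- other way round; reflecting them, in `m` and in `m ∸ 1`, makes the inequality strict in the
  -- direction a code requires.
  L′-code : Code m 0 0 (A′ m Bs) (D′ m Es)
  L′-code = toCode (code-a<n c) (code-a<n c)
    (All.tabulate (λ x∈ → <-trans (s≤s z≤n) (proj₁ (∈-A′⁻ x∈))) ∷ A′-sorted)
    (All.tabulate (λ y∈ → proj₁ (∈-D′⁻ y∈)) ∷ D′-sorted)
    (trans (List.length-map (m ∸_) (complement m (map pred Bs)))
      (trans length-comp-≡ (sym (List.length-map (m ∸ 1 ∸_) (complement m Es)))))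
    above (λ x∈ → proj₁ (proj₂ (∈-A′⁻ x∈)))

  L′ᵢ-Z : L′ᵢ (Z m 0 0 Bs Es) ≡ Z m 0 0 (A′ m Bs) (D′ m Es)
  L′ᵢ-Z rewrite Z-semilength c | Z-ascentCode c | Z-descentCode c = pathWithCode≡Z m (A′ m Bs) (D′ m Es)

-- Necessity for irreducible paths

record Injective< (n : ℕ) (f : ℕ → ℕ) : Set where
  field
    bounded   : ∀ {i} → i < n → f i < n
    injective : ∀ {i j} → i < n → j < n → f i ≡ f j → i ≡ j

-- Written with sums instead of truncated differences, which makes the relation visibly symmetric.
ReverseComplement : ℕ → (ℕ → ℕ) → (ℕ → ℕ) → Set
ReverseComplement n f f′ = ∀ {i j} → suc (i + j) ≡ n → suc (f i + f′ j) ≡ n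

reverse-complement-sym : ∀ {n f f′} → ReverseComplement n f f′ → ReverseComplement n f′ f
reverse-complement-sym {f = f} {f′} rc {i} {j} e =
  trans (cong suc (+-comm (f′ i) (f j))) (rc (trans (cong suc (+-comm j i)) e))

mirror : ∀ {n i} → i < n → suc (i + (n ∸ suc i)) ≡ n
mirror i<n = m+[n∸m]≡n i<n

module _ {m As Ds Bs Es f f′} (c : Code m 0 0 As Ds) (c′ : Code m 0 0 Bs Es)
  (inj : Injective< m f) (inj′ : Injective< m f′) (rc : ReverseComplement m f f′)
  (fit : Fit (Z m 0 0 As Ds) 0 0 D f) (fit′ : Fit (Z m 0 0 Bs Es) 0 0 D f′) (2≤m : 2 ≤ m) where

  private
    D⁺ A⁺ E⁺ B⁺ : List ℕ
    D⁺ = 0 ∷ Ds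
    A⁺ = As ++ m ∷ []
    E⁺ = 0 ∷ Es
    B⁺ = Bs ++ m ∷ []

    -- At a minimum `f` exceeds the position, at a maximum `f′` exceeds the mirrored position. Both
    -- cannot happen at one place, because mirrored positions and their values have the same sum.
    peaks-disjoint : ∀ {i b e b′} → (i , b) ∈ zip D⁺ A⁺ → (e , b′) ∈ zip E⁺ B⁺ → suc (i + e) ≢ m
    peaks-disjoint {i} {b} {e} {b′} p q eq = <-irrefl (suc-injective (trans eq (sym (rc eq))))
      (+-mono-< (s≤s⁻¹ (≤-trans (peak-above₀ 2≤m c p) (≥-of (fit-Z-peak c fit p))))
                (s≤s⁻¹ (≤-trans (peak-above₀ 2≤m c′ q) (≥-of (fit-Z-peak c′ fit′ q)))))

    -- Coincidence of letters becomes coincidence of positions by injectivity of `f′`.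
    value-position : ∀ {i e b} → i < m → (e , b) ∈ zip E⁺ B⁺ → b + suc (f i) ≡ suc m → suc (i + e) ≡ m
    value-position {i} {e} {b} i<m q eq = trans (cong (λ z → suc (i + z)) e≡j) (mirror i<m)
      where
      j = m ∸ suc i
      f′e+fi : suc (f′ e + f i) ≡ m
      f′e+fi = suc-injective (trans (sym (+-suc (suc (f′ e)) (f i)))
        (trans (cong (_+ suc (f i)) (fit-Z-peak c′ fit′ q)) eq))
      e≡j : e ≡ j
      e≡j = Injective<.injective inj′ (code-D⁺<n c′ (zip-∈ˡ E⁺ B⁺ q)) (≤-trans (s≤s (m≤n+m j i)) (≤-of (mirror i<m)))
        (+-cancelʳ-≡ (f i) _ _ (trans (suc-injective (trans f′e+fi (sym (rc (mirror i<m))))) (+-comm (f i) (f′ j))))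

    peak-of-A : ∀ {x} → x ∈ As → ∃[ i ] (i , x) ∈ zip D⁺ A⁺
    peak-of-A x∈ = ∈⇒zipʳ (code-peaks c) (∈-++⁺ˡ x∈)

    peak-of-D : ∀ {y} → y ∈ Ds → ∃[ b ] (y , b) ∈ zip D⁺ A⁺
    peak-of-D y∈ = ∈⇒zipˡ (code-peaks c) (there y∈)

    peak-of-B⁺ : ∀ {b} → b ∈ B⁺ → ∃[ e ] (e , b) ∈ zip E⁺ B⁺
    peak-of-B⁺ b∈ = ∈⇒zipʳ (code-peaks c′) b∈

    peak-of-E⁺ : ∀ {e} → e ∈ E⁺ → ∃[ b ] (e , b) ∈ zip E⁺ B⁺
    peak-of-E⁺ e∈ = ∈⇒zipˡ (code-peaks c′) e∈

    A⊆A′ : ∀ {x} → x ∈ As → x ∈ A′ m Bs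
    A⊆A′ {x} x∈ with peak-of-A x∈
    ... | i , p = ∈-A′⁺ c′ (≤-<-trans (s≤s z≤n) (peak-above₀ 2≤m c p)) (code-As<n c x∈) λ {b} b∈ eq →
      let (e , q) = peak-of-B⁺ (∈-++⁺ˡ b∈) in
      peaks-disjoint p q (value-position (code-D⁺<n c (zip-∈ˡ D⁺ A⁺ p)) q (trans (cong (b +_) (fit-Z-peak c fit p)) eq))

    D⊆D′ : ∀ {y} → y ∈ Ds → y ∈ D′ m Es
    D⊆D′ {y} y∈ with ∈⇒zipʳ (code-length c) y∈
    ... | x , p = ∈-D′⁺ c′ (All.lookup (AllPairs.head (code-sortedᵈ c)) y∈)
      (≤-<-trans (code-zip c p) (code-As<n c (zip-∈ˡ As Ds p))) λ {e} e∈ eq →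
      peaks-disjoint (proj₂ (peak-of-D y∈)) (proj₂ (peak-of-E⁺ (there e∈)))
        (trans (cong suc (+-comm y e)) (trans (sym (+-suc e y)) eq))

    -- The positions to the left of the valley that are not right-to-left maxima
    -- are mapped to values of the same kind that lie above it.
    valley-cnt : ∀ {x y} → (x , y) ∈ zip As Ds → cnt y (D′ m Es) ≤ cnt x (A′ m Bs)
    valley-cnt {x} {y} p = s≤s⁻¹ (≤-trans (≥-of (List.length-map (suc ∘ f) (0 ∷ low))) (card uniq sub))
      where
      low = filter (_<? y) (D′ m Es)
      y∈Ds = zip-∈ʳ As Ds p

      low⁻ : ∀ {i} → i ∈ low → (0 < i × suc i < m × (∀ {e} → e ∈ Es → e + suc i ≢ m)) × i < y
      low⁻ i∈ = let (a , b) = ∈-filter⁻ (_<? y) {xs = D′ m Es} i∈ in ∈-D′⁻ c′ a , b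

      i<y : ∀ {i} → i ∈ 0 ∷ low → i < y
      i<y (here refl) = All.lookup (AllPairs.head (code-sortedᵈ c)) y∈Ds
      i<y (there i∈)  = proj₂ (low⁻ i∈)

      i<m : ∀ {i} → i ∈ 0 ∷ low → i < m
      i<m i∈ = <-trans (i<y i∈) (code-Ds<n c y∈Ds)

      no-peak : ∀ {i e b} → i ∈ 0 ∷ low → (e , b) ∈ zip E⁺ B⁺ → suc (i + e) ≢ m
      no-peak (here refl) q eq = 1+n≰n (≤-trans (peak-above₀ 2≤m c′ q) (≤-trans (B⁺≤m (zip-∈ʳ E⁺ B⁺ q)) (≥-of eq)))
        where
        B⁺≤m : ∀ {b} → b ∈ B⁺ → b ≤ m
        B⁺≤m b∈ with ∈-++⁻ Bs b∈
        ... | inj₁ b∈ = <⇒≤ (code-As<n c′ b∈)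
        ... | inj₂ (here refl) = ≤-refl
      no-peak {i} {e} (there i∈) q eq with low⁻ i∈ | zip-∈ˡ E⁺ B⁺ q
      ... | (_ , si<m , h) , _ | here refl = <-irrefl (trans (cong suc (sym (+-identityʳ i))) eq) si<m
      ... | (_ , si<m , h) , _ | there e∈ = h e∈ (trans (+-suc e i) (trans (cong suc (+-comm e i)) eq))

      no-value : ∀ {i b} → i ∈ 0 ∷ low → b ∈ B⁺ → b + suc (f i) ≢ suc m
      no-value i∈ b∈ eq = let (e , q) = peak-of-B⁺ b∈ in no-peak i∈ q (value-position (i<m i∈) q eq)

      -- Position 0, which `D′` never contains, is added on the left to pay for the value `x` on the
      -- right: the valley allows `suc (f i)` to equal `x`, which `cnt x` does not count.
      uniq : Unique (map (suc ∘ f) (0 ∷ low))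
      uniq = unique-map (suc ∘ f)
        (unique-∷ (λ 0∈ → <-irrefl refl (proj₁ (proj₁ (low⁻ 0∈))))
          (Unique.filter⁺ (_<? y) (sorted⇒unique (D′-sorted c′))))
        λ i∈ j∈ eq → Injective<.injective inj (i<m i∈) (i<m j∈) (suc-injective eq)

      sub : ∀ {z} → z ∈ map (suc ∘ f) (0 ∷ low) → z ∈ x ∷ filter (_<? x) (A′ m Bs)
      sub z∈ with ∈-map⁻ (suc ∘ f) z∈
      ... | i , i∈ , refl with m≤n⇒m<n∨m≡n (fit-Z-valley c fit p i z≤n (i<y i∈))
      ... | inj₂ refl = here refl
      ... | inj₁ sfi<x = there (∈-filter⁺ (_<? x) (∈-A′⁺ c′ 1<sfi (<-trans sfi<x (code-As<n c (zip-∈ˡ As Ds p)))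
              λ b∈ → no-value i∈ (∈-++⁺ˡ b∈)) sfi<x)
        where
        1<sfi : 1 < suc (f i)
        1<sfi with f i in eq
        ... | zero = contradiction (trans (cong (λ k → m + suc k) eq) (+-comm m 1)) (no-value i∈ (∈-++⁺ʳ Bs (here refl)))
        ... | suc _ = s≤s (s≤s z≤n)

  L′≼ᵢ₂ : Z m 0 0 (A′ m Bs) (D′ m Es) ≼ᵢ Z m 0 0 As Ds
  L′≼ᵢ₂ = thin⇒≼ᵢ _ ≤-refl (L′-code c′)
    (thin (sorted-⊆⇒⊑ (AllPairs.tail (code-sortedᵃ c)) (A′-sorted c′) A⊆A′)
          (sorted-⊆⇒⊑ (AllPairs.tail (code-sortedᵈ c)) (D′-sorted c′) D⊆D′)
          (A′-sorted c′) (D′-sorted c′) (code-length (L′-code c′)) (code-length c) valley-cnt)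

code-1 : ∀ {m As Ds} → m < 2 → Code m 0 0 As Ds → As ≡ [] × Ds ≡ [] × m ≡ 1
code-1 (s≤s m≤1) (end 0<m _) = refl , refl , ≤-antisym m≤1 0<m
code-1 (s≤s m≤1) (step _ 0<d d<a c) =
  contradiction (≤-trans (s≤s 0<d) (≤-trans d<a (≤-trans (<⇒≤ (code-a<n c)) m≤1))) 1+n≰n

-- For `m` equal to 1 minima and maxima are not disjoint; there both codes are empty and the empty
-- chain suffices.
L′≼ᵢ : ∀ {m As Ds Bs Es f f′} → Code m 0 0 As Ds → Code m 0 0 Bs Es → Injective< m f → Injective< m f′ →
  ReverseComplement m f f′ → Fit (Z m 0 0 As Ds) 0 0 D f → Fit (Z m 0 0 Bs Es) 0 0 D f′ →
  L′ᵢ (Z m 0 0 Bs Es) ≼ᵢ Z m 0 0 As Ds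
L′≼ᵢ {m} {As} {Ds} c c′ inj inj′ rc fit fit′ = subst (_≼ᵢ Z m 0 0 As Ds) (sym (L′ᵢ-Z c′)) go
  where
  go : Z m 0 0 (A′ m _) (D′ m _) ≼ᵢ Z m 0 0 As Ds
  go with m <? 2
  ... | no m≮2 = L′≼ᵢ₂ c c′ inj inj′ rc fit fit′ (≮⇒≥ m≮2)
  ... | yes m<2 with code-1 m<2 c | code-1 m<2 c′
  ... | refl , refl , refl | refl , refl , _ = ε

-- Sufficiency for irreducible paths

mirror-unique : ∀ {m i j} → suc (i + j) ≡ m → m ∸ suc i ≡ j
mirror-unique {i = i} {j} refl = m+n∸m≡n i j

mirror-map-∈⁻ : ∀ {m xs j} → (∀ {i} → i ∈ xs → i < m) → j ∈ map (λ i → m ∸ suc i) xs →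
  ∃[ i ] i ∈ xs × suc (i + j) ≡ m
mirror-map-∈⁻ {m} bound j∈ with ∈-map⁻ (λ i → m ∸ suc i) j∈
... | i , i∈ , refl = i , i∈ , mirror (bound i∈)

mirror-map-∈⁺ : ∀ {m xs i j} → i ∈ xs → suc (i + j) ≡ m → j ∈ map (λ i → m ∸ suc i) xs
mirror-map-∈⁺ {m} {xs} i∈ e = subst (_∈ map (λ i → m ∸ suc i) xs) (mirror-unique e) (∈-map⁺ (λ i → m ∸ suc i) i∈)

mirror-comm : ∀ {m} i j → suc (i + j) ≡ m → suc (j + i) ≡ m
mirror-comm i j e = trans (cong suc (+-comm j i)) e

mirror-cancel : ∀ {m} i {j k} → suc (i + j) ≡ m → suc (i + k) ≡ m → j ≡ k
mirror-cancel i e e′ = +-cancelˡ-≡ (suc i) _ _ (trans e (sym e′))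

mirror-injective : ∀ {m i j} → i < m → j < m → m ∸ suc i ≡ m ∸ suc j → i ≡ j
mirror-injective i<m j<m e = suc-injective (∸-cancelˡ-≡ i<m j<m e)

mirror-< : ∀ {m i} → i < m → m ∸ suc i < m
mirror-< {m} {i} i<m = ≤-trans (s≤s (m≤n+m (m ∸ suc i) i)) (≤-of (mirror i<m))

module _ (m : ℕ) (As Ds Bs Es : List ℕ) where

  -- A bijection that maps the peaks as prescribed by both codes; M lists the
  -- remaining positions with their values.
  record Configuration (f : ℕ → ℕ) (M : List (ℕ × ℕ)) : Set where
    field
      low-peak   : ∀ {i b} → (i , b) ∈ zip (0 ∷ Ds) (As ++ m ∷ []) → suc (f i) ≡ b
      high-peak  : ∀ {e b} → (e , b) ∈ zip (0 ∷ Es) (Bs ++ m ∷ []) → ∀ i → suc (i + e) ≡ m → f i + b ≡ m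
      classify   : ∀ {i} → i < m → i ∈ 0 ∷ Ds ⊎ (∃[ e ] e ∈ 0 ∷ Es × suc (i + e) ≡ m) ⊎ (i , f i) ∈ M
      mid-pos    : ∀ {i} → i ∈ map proj₁ M → i < m × i ∉ 0 ∷ Ds × (∀ {e} → e ∈ 0 ∷ Es → suc (i + e) ≢ m)
      mid-val    : ∀ {v} → v < m → v ∉ map pred (As ++ m ∷ []) →
                   (∀ {w} → w ∈ map pred (Bs ++ m ∷ []) → suc (v + w) ≢ m) → v ∈ map proj₂ M
      mid-unique : Unique (map proj₁ M)
      mid-mono   : Comonotone M

mirrorᴹ : ℕ → List (ℕ × ℕ) → List (ℕ × ℕ)
mirrorᴹ m = map (λ (i , v) → m ∸ suc i , m ∸ suc v)

-- Reverse complement swaps minima and maxima. It reverses both coordinates of the middle pairs, so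
-- these stay comonotone, and the argument for the first path applies to the second.
configuration-mirror : ∀ {m As Ds Bs Es f f′ M} → Code m 0 0 Bs Es → ReverseComplement m f f′ →
  Configuration m As Ds Bs Es f M → Configuration m Bs Es As Ds f′ (mirrorᴹ m M)
configuration-mirror {m} {As} {Ds} {Bs} {Es} {f} {f′} {M} c rc C = record
  { low-peak = λ {e} {b} p → let i = m ∸ suc e
                                 e′ = mirror-comm e i (mirror (E⁺<m p)) in
      +-cancelˡ-≡ (f i) _ _ (trans (trans (+-suc (f i) (f′ e)) (rc e′)) (sym (high-peak p i e′)))
  ; high-peak = λ {i} {b} p e eq → trans (cong (f′ e +_) (sym (low-peak p)))
      (trans (+-suc (f′ e) (f i)) (mirror-comm (f i) (f′ e) (rc (mirror-comm e i eq))))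
  ; classify = cls
  ; mid-pos = λ j∈ → pos (subst (_ ∈_) proj₁-mirror j∈)
  ; mid-val = λ {v} v<m v∉ h → subst (v ∈_) (sym proj₂-mirror)
      (mirror-map-∈⁺ (mid-val (mirror-< v<m) (λ w∈ → h w∈ (mirror v<m))
        λ {w} w∈ eq → v∉ (subst (_∈ map pred (Bs ++ m ∷ []))
          (mirror-cancel (m ∸ suc v) eq (mirror-comm v _ (mirror v<m))) w∈))
        (mirror-comm v _ (mirror v<m)))
  ; mid-unique = subst Unique (sym proj₁-mirror)
      (unique-map _ mid-unique λ i∈ j∈ → mirror-injective (proj₁ (mid-pos i∈)) (proj₁ (mid-pos j∈)))
  ; mid-mono = mono }
  where
  open Configuration C
  E⁺<m : ∀ {e b} → (e , b) ∈ zip (0 ∷ Es) (Bs ++ m ∷ []) → e < m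
  E⁺<m p = code-D⁺<n c (zip-∈ˡ (0 ∷ Es) (Bs ++ m ∷ []) p)
  proj₁-mirror : map proj₁ (mirrorᴹ m M) ≡ map (λ i → m ∸ suc i) (map proj₁ M)
  proj₁-mirror = trans (sym (List.map-∘ M)) (List.map-∘ M)
  proj₂-mirror : map proj₂ (mirrorᴹ m M) ≡ map (λ i → m ∸ suc i) (map proj₂ M)
  proj₂-mirror = trans (sym (List.map-∘ M)) (List.map-∘ M)
  cls : ∀ {e} → e < m → e ∈ 0 ∷ Es ⊎ (∃[ i ] i ∈ 0 ∷ Ds × suc (e + i) ≡ m) ⊎ (e , f′ e) ∈ mirrorᴹ m M
  cls {e} e<m with classify (mirror-< e<m)
  ... | inj₁ i∈ = inj₂ (inj₁ (_ , i∈ , mirror e<m))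
  ... | inj₂ (inj₁ (e₀ , e₀∈ , eq)) =
    inj₁ (subst (_∈ 0 ∷ Es) (mirror-cancel (m ∸ suc e) eq (mirror-comm e _ (mirror e<m))) e₀∈)
  ... | inj₂ (inj₂ p) = inj₂ (inj₂ (subst (_∈ mirrorᴹ m M)
          (cong₂ _,_ (mirror-unique (mirror-comm e _ (mirror e<m))) (mirror-unique (rc (mirror-comm e _ (mirror e<m)))))
          (∈-map⁺ _ p)))
  pos : ∀ {j} → j ∈ map (λ i → m ∸ suc i) (map proj₁ M) →
    j < m × j ∉ 0 ∷ Es × (∀ {i} → i ∈ 0 ∷ Ds → suc (j + i) ≢ m)
  pos {j} j∈ with mirror-map-∈⁻ (λ i∈ → proj₁ (mid-pos i∈)) j∈
  ... | i , i∈ , eq = let (i<m , i∉ , h) = mid-pos i∈ in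
    ≤-trans (s≤s (m≤n+m j i)) (≤-of eq) , (λ j∈ → h j∈ eq) ,
    λ {k} k∈ eq′ → i∉ (subst (_∈ 0 ∷ Ds) (mirror-cancel j eq′ (mirror-comm i j eq)) k∈)
  mono : Comonotone (mirrorᴹ m M)
  mono p q v′<v with ∈-map⁻ _ p | ∈-map⁻ _ q
  ... | (i , v) , p′ , refl | (i′ , v′) , q′ , refl =
    ∸-monoʳ-< (s≤s (mid-mono q′ p′ (s≤s⁻¹ (∸-cancelʳ-< {o = m} v′<v)))) (proj₁ (mid-pos (∈-map⁺ proj₁ q′)))

-- L′ of the path with the code (Bs , Es) lies below the path with the code
-- (As , Ds).
Below : ℕ → List ℕ → List ℕ → List ℕ → List ℕ → Set
Below m Bs Es As Ds = ∀ {x y} → (x , y) ∈ zip As Ds →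
  x ∈ A′ m Bs × y ∈ D′ m Es × cnt y (D′ m Es) ≤ cnt x (A′ m Bs)

module _ {m As Ds Bs Es f M} (2≤m : 2 ≤ m) (c : Code m 0 0 As Ds) (c′ : Code m 0 0 Bs Es)
  (below : Below m Bs Es As Ds) (C : Configuration m As Ds Bs Es f M) where

  open Configuration C

  private
    cnt-positions : ∀ y → cnt y Ds + cnt y (map proj₁ M) ≤ cnt y (D′ m Es)
    cnt-positions y = ≤-trans (≥-of (List.length-++ (filter (_<? y) Ds)))
      (card (Unique.++⁺ (Unique.filter⁺ (_<? y) (sorted⇒unique (AllPairs.tail (code-sortedᵈ c))))
                        (Unique.filter⁺ (_<? y) mid-unique) disjoint) sub)
      where
      disjoint : ∀ {i} → ¬ (i ∈ filter (_<? y) Ds × i ∈ filter (_<? y) (map proj₁ M))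
      disjoint (p , q) = proj₁ (proj₂ (mid-pos (proj₁ (∈-filter⁻ (_<? y) {xs = map proj₁ M} q))))
        (there (proj₁ (∈-filter⁻ (_<? y) {xs = Ds} p)))
      sub : ∀ {i} → i ∈ filter (_<? y) Ds ++ filter (_<? y) (map proj₁ M) → i ∈ filter (_<? y) (D′ m Es)
      sub {i} i∈ with ∈-++⁻ (filter (_<? y) Ds) i∈
      ... | inj₁ p = let (i∈D , i<y) = ∈-filter⁻ (_<? y) {xs = Ds} p
                         (x , r) = ∈⇒zipʳ (code-length c) i∈D in
        ∈-filter⁺ (_<? y) (proj₁ (proj₂ (below r))) i<y
      ... | inj₂ q = let (i∈M , i<y) = ∈-filter⁻ (_<? y) {xs = map proj₁ M} q
                         (i<m , i∉ , h) = mid-pos i∈M in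
        ∈-filter⁺ (_<? y) (∈-D′⁺ c′ (n≢0⇒n>0 λ { refl → i∉ (here refl) })
          (≤∧≢⇒< i<m λ e → h (here refl) (trans (cong suc (+-identityʳ i)) e))
          λ {e} e∈ eq → h (there e∈) (trans (cong suc (+-comm i e)) (trans (sym (+-suc e i)) eq))) i<y

    cnt-values : ∀ x → cnt x (A′ m Bs) ≤ cnt x As + cnt x (map proj₂ M)
    cnt-values x = ≤-trans (card (Unique.filter⁺ (_<? x) (sorted⇒unique (A′-sorted c′))) sub)
      (≤-of (trans (List.length-++ (filter (_<? x) As))
        (cong (cnt x As +_) (List.length-map suc (filter (_<? x) (map proj₂ M))))))
      where
      mid : ∀ {z} → z ∈ A′ m Bs → z ∉ As → ∃[ v ] z ≡ suc v × v ∈ map proj₂ M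
      mid {zero} z∈ _ = contradiction (proj₁ (∈-A′⁻ c′ z∈)) λ ()
      mid {suc v} z∈ z∉ = let (1<z , z<m , h) = ∈-A′⁻ c′ z∈ in v , refl ,
        mid-val (<-trans (n<1+n v) z<m)
          (λ v∈ → let (a , a∈ , e) = ∈-map⁻ pred v∈ in not-A a a∈ e)
          λ w∈ eq → let (b , b∈ , e) = ∈-map⁻ pred w∈ in not-B b b∈ (trans (cong (λ k → suc (v + k)) (sym e)) eq)
        where
        not-A : ∀ a → a ∈ As ++ m ∷ [] → v ≢ pred a
        not-A zero a∈ refl = contradiction (proj₁ (∈-A′⁻ c′ z∈)) (<-irrefl refl)
        not-A (suc a) a∈ refl with ∈-++⁻ As a∈
        ... | inj₁ a∈As = z∉ a∈As
        ... | inj₂ (here refl) = <-irrefl refl (proj₁ (proj₂ (∈-A′⁻ c′ z∈)))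
        not-B : ∀ b → b ∈ Bs ++ m ∷ [] → suc (v + pred b) ≢ m
        not-B zero b∈ eq with ∈-++⁻ Bs b∈
        ... | inj₁ b∈Bs = contradiction (All.lookup (AllPairs.head (code-sortedᵃ c′)) b∈Bs) λ ()
        ... | inj₂ (here refl) = contradiction 2≤m λ ()
        not-B (suc b) b∈ eq with ∈-++⁻ Bs b∈
        ... | inj₁ b∈Bs = proj₂ (proj₂ (∈-A′⁻ c′ z∈)) b∈Bs
                (cong suc (trans (+-suc b v) (trans (cong suc (+-comm b v)) eq)))
        ... | inj₂ (here refl) = contradiction
                (≤-trans (proj₁ (∈-A′⁻ c′ z∈)) (s≤s (≤-of (+-cancelʳ-≡ b v 0 (suc-injective eq))))) 1+n≰n
      sub : ∀ {z} → z ∈ filter (_<? x) (A′ m Bs) → z ∈ filter (_<? x) As ++ map suc (filter (_<? x) (map proj₂ M))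
      sub {z} z∈ with ∈-filter⁻ (_<? x) {xs = A′ m Bs} z∈ | z ∈? As
      ... | z∈A′ , z<x | yes p = ∈-++⁺ˡ (∈-filter⁺ (_<? x) p z<x)
      ... | z∈A′ , z<x | no z∉ with mid z∈A′ z∉
      ... | v , refl , v∈ = ∈-++⁺ʳ (filter (_<? x) As) (∈-map⁺ suc (∈-filter⁺ (_<? x) v∈ (<-trans (n<1+n v) z<x)))

    -- `below` compares all available positions and values. The minima among them contribute the
    -- index of the valley to each side and cancel, leaving the middle entries.
    cnt-mid : ∀ {x y} → (x , y) ∈ zip As Ds → cnt y (map proj₁ M) ≤ cnt x (map proj₂ M)
    cnt-mid {x} {y} p = +-cancelˡ-≤ (cnt y Ds) _ _
      (≤-trans (cnt-positions y) (≤-trans (proj₂ (proj₂ (below p)))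
        (≤-trans (cnt-values x) (≤-of (cong (_+ cnt x (map proj₂ M)) same)))))
      where
      same : cnt x As ≡ cnt y Ds
      same = let (t , at-x , at-y) = zip-at As Ds p in
        trans (At⇒cnt (AllPairs.tail (code-sortedᵃ c)) at-x) (sym (At⇒cnt (AllPairs.tail (code-sortedᵈ c)) at-y))

  -- A minimum left of the valley belongs to an earlier, hence no higher, peak. A maximum has
  -- `f i ≤ i`, while the valley has `y < x`. A middle position is handled by the monotone pairing
  -- and the count at this valley.
  configuration-valley : ∀ {x y} → (x , y) ∈ zip As Ds → ∀ i → i < y → f i < x
  configuration-valley {x} {y} p i i<y with classify (<-trans i<y (code-Ds<n c (zip-∈ʳ As Ds p)))
  ... | inj₁ i∈ = let (b , q) = ∈⇒zipˡ (code-peaks c) i∈ in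
    ≤-trans (≤-of (low-peak q)) (peak≤valley c q p i<y)
  ... | inj₂ (inj₁ (e , e∈ , eq)) = let (b , q) = ∈⇒zipˡ (code-peaks c′) e∈ in
    <-trans (≤-<-trans (fi≤i b q) i<y) (code-zip c p)
    where
    fi≤i : ∀ b → (e , b) ∈ zip (0 ∷ Es) (Bs ++ m ∷ []) → f i ≤ i
    fi≤i b q = +-cancelʳ-≤ b _ _ (≤-trans (≤-of (trans (high-peak q i eq) (trans (sym eq) (sym (+-suc i e)))))
      (+-monoʳ-≤ i (<⇒≤ (peak-above₀ 2≤m c′ q))))
  ... | inj₂ (inj₂ r) = comonotone-< y x mid-unique mid-mono (cnt-mid p) r i<y

  configuration-fit : (∀ {i} → i < m → f i < m) → Fit (Z m 0 0 As Ds) 0 0 D f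
  configuration-fit bound = fit-Z c low-peak configuration-valley λ _ → bound

record Bijection< (n : ℕ) (f g : ℕ → ℕ) : Set where
  field
    f< : ∀ {i} → i < n → f i < n
    g< : ∀ {i} → i < n → g i < n
    gf : ∀ {i} → i < n → g (f i) ≡ i
    fg : ∀ {i} → i < n → f (g i) ≡ i

assoc : List ℕ → List ℕ → ℕ → ℕ
assoc (w ∷ W) (v ∷ V) i with i ≟ w
... | yes _ = v
... | no _  = assoc W V i
assoc _ _ i = 0

assoc-zip : ∀ {W V i x} → Unique W → (i , x) ∈ zip W V → assoc W V i ≡ x
assoc-zip {w ∷ W} {v ∷ V} {i} u p with i ≟ w | p
... | yes _ | here refl = refl
... | yes refl | there q = contradiction (zip-∈ˡ W V q) (∉-head u)
... | no i≢w | here refl = contradiction refl i≢w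
... | no _ | there q = assoc-zip (AllPairs.tail u) q

-- The numbers below m, listed as S, the mirror image of T, and the rest.
module Listing (m : ℕ) (S T : List ℕ) (uS : Unique S) (uT : Unique T)
  (S< : ∀ {i} → i ∈ S → i < m) (T< : ∀ {i} → i ∈ T → i < m)
  (disj : ∀ {s t} → s ∈ S → t ∈ T → suc (s + t) ≢ m) where

  T̄ ends rest all : List ℕ
  T̄    = map (λ t → m ∸ suc t) T
  ends = S ++ T̄
  rest = filter (λ i → ¬? (i ∈? ends)) (upTo m)
  all  = S ++ T̄ ++ rest

  T̄⁻ : ∀ {i} → i ∈ T̄ → ∃[ t ] t ∈ T × suc (i + t) ≡ m
  T̄⁻ i∈ = let (t , t∈ , e) = mirror-map-∈⁻ T< i∈ in t , t∈ , mirror-comm t _ e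

  rest⁻ : ∀ {i} → i ∈ rest → i < m × i ∉ S × (∀ {t} → t ∈ T → suc (i + t) ≢ m)
  rest⁻ {i} i∈ = let (p , q) = ∈-filter⁻ (λ i → ¬? (i ∈? ends)) {xs = upTo m} i∈ in
    ∈-upTo⁻ p , (λ s → q (∈-++⁺ˡ s)) , λ {t} t∈ e → q (∈-++⁺ʳ S (mirror-map-∈⁺ t∈ (mirror-comm i t e)))

  rest⁺ : ∀ {i} → i < m → i ∉ S → (∀ {t} → t ∈ T → suc (i + t) ≢ m) → i ∈ rest
  rest⁺ {i} i<m i∉ h = ∈-filter⁺ (λ i → ¬? (i ∈? ends)) (∈-upTo⁺ i<m) λ i∈ →
    [ i∉ , (λ p → let (t , t∈ , e) = T̄⁻ p in h t∈ e) ]′ (∈-++⁻ S i∈)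

  rest-sorted : Sorted rest
  rest-sorted = AllPairs.filter⁺ (λ i → ¬? (i ∈? ends)) (AllPairs.applyUpTo⁺₁ id m λ i<j _ → i<j)

  all-unique : Unique all
  all-unique = Unique.++⁺ uS (Unique.++⁺ uT̄ (sorted⇒unique rest-sorted)
      λ (p , q) → let (t , t∈ , e) = T̄⁻ p in proj₂ (proj₂ (rest⁻ q)) t∈ e)
    λ (p , q) → [ (λ r → let (t , t∈ , e) = T̄⁻ r in disj p t∈ e) , (λ r → proj₁ (proj₂ (rest⁻ r)) p) ]′ (∈-++⁻ T̄ q)
    where
    uT̄ : Unique T̄
    uT̄ = unique-map _ uT λ p q → mirror-injective (T< p) (T< q)

  all⁻ : ∀ {i} → i ∈ all → i < m
  all⁻ i∈ with ∈-++⁻ S i∈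
  ... | inj₁ p = S< p
  ... | inj₂ q with ∈-++⁻ T̄ q
  ... | inj₁ r = let (t , _ , e) = T̄⁻ r in ≤-trans (s≤s (m≤m+n _ t)) (≤-of e)
  ... | inj₂ r = proj₁ (rest⁻ r)

  all⁺ : ∀ {i} → i < m → i ∈ all
  all⁺ {i} i<m with i ∈? S | i ∈? T̄
  ... | yes p | _     = ∈-++⁺ˡ p
  ... | no _  | yes q = ∈-++⁺ʳ S (∈-++⁺ˡ q)
  ... | no p  | no q  = ∈-++⁺ʳ S (∈-++⁺ʳ T̄ (rest⁺ i<m p λ {t} t∈ e → q (mirror-map-∈⁺ t∈ (mirror-comm i t e))))

  all-length : length S + (length T + length rest) ≡ m
  all-length = trans (sym (trans (List.length-++ S) (cong (length S +_)
      (trans (List.length-++ T̄) (cong (_+ length rest) (List.length-map _ T))))))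
    (trans (≤-antisym (card all-unique (λ i∈ → ∈-upTo⁺ (all⁻ i∈)))
                      (card (Unique.upTo⁺ m) (λ i∈ → all⁺ (∈-upTo⁻ i∈)))) (List.length-upTo m))

pred-A⁺ : ∀ {m As Ds} → Code m 0 0 As Ds → Unique (map pred (As ++ m ∷ [])) ×
  (∀ {v} → v ∈ map pred (As ++ m ∷ []) → v < m × suc v ∈ As ++ m ∷ [])
pred-A⁺ {m} {As} c = unique-map pred (sorted⇒unique (code-sorted-n c)) (λ p q e → pred-inj (pos p) (pos q) e) , val
  where
  pos : ∀ {a} → a ∈ As ++ m ∷ [] → 0 < a
  pos a∈ with ∈-++⁻ As a∈
  ... | inj₁ p = All.lookup (AllPairs.head (code-sortedᵃ c)) p
  ... | inj₂ (here refl) = code-a<n c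
  le : ∀ {a} → a ∈ As ++ m ∷ [] → a ≤ m
  le a∈ with ∈-++⁻ As a∈
  ... | inj₁ p = <⇒≤ (code-As<n c p)
  ... | inj₂ (here refl) = ≤-refl
  pred-inj : ∀ {x y} → 0 < x → 0 < y → pred x ≡ pred y → x ≡ y
  pred-inj {suc x} {suc y} _ _ refl = refl
  val : ∀ {v} → v ∈ map pred (As ++ m ∷ []) → v < m × suc v ∈ As ++ m ∷ []
  val v∈ with ∈-map⁻ pred v∈
  ... | zero  , a∈ , refl = contradiction (pos a∈) λ ()
  ... | suc a , a∈ , refl = le a∈ , a∈

module Construction {m As Ds Bs Es} (2≤m : 2 ≤ m) (c : Code m 0 0 As Ds) (c′ : Code m 0 0 Bs Es)
  (below : Below m Bs Es As Ds) where

  private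
    -- By `below` the positions in `Ds` lie in `D′`, hence off the maxima. Position 0 could only
    -- meet a maximum at mirrored position `m ∸ 1`, too large for an entry of `Es` and nonzero as
    -- `2 ≤ m`.
    disjoint-positions : ∀ {s t} → s ∈ 0 ∷ Ds → t ∈ 0 ∷ Es → suc (s + t) ≢ m
    disjoint-positions (here refl) (here refl) e = <-irrefl e 2≤m
    disjoint-positions (here refl) (there t∈) e with ∈⇒zipʳ (code-length c′) t∈
    ... | b , q = <-irrefl e (≤-<-trans (code-zip c′ q) (code-As<n c′ (zip-∈ˡ Bs Es q)))
    disjoint-positions {s} (there s∈) t∈ e with ∈⇒zipʳ (code-length c) s∈
    ... | x , q with below q | t∈
    ... | _ , s∈D′ , _ | here refl = <-irrefl (trans (cong suc (sym (+-identityʳ s))) e) (proj₁ (proj₂ (∈-D′⁻ c′ s∈D′)))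
    ... | _ , s∈D′ , _ | there {x = .0} t∈E = proj₂ (proj₂ (∈-D′⁻ c′ s∈D′)) t∈E
            (trans (+-suc _ s) (trans (cong suc (+-comm _ s)) e))

    B≥2 : ∀ {b} → b ∈ Bs → 2 ≤ b
    B≥2 b∈ = let (e , q) = ∈⇒zipˡ (code-length c′) b∈ in
      ≤-<-trans (All.lookup (AllPairs.head (code-sortedᵈ c′)) (zip-∈ʳ Bs Es q)) (code-zip c′ q)

    not-suc : ∀ {k} → 2 ≤ k → k + m ≢ suc m
    not-suc 2≤k e = 1+n≰n (≤-trans (+-monoˡ-≤ m 2≤k) (≤-of e))

    disjoint-A⁺B⁺ : ∀ {a b} → a ∈ As ++ m ∷ [] → b ∈ Bs ++ m ∷ [] → b + a ≢ suc m
    disjoint-A⁺B⁺ {a} {b} a∈ b∈ e with ∈-++⁻ As a∈ | ∈-++⁻ Bs b∈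
    ... | inj₁ p | inj₁ q = let (y , r) = ∈⇒zipˡ (code-length c) p in
      proj₂ (proj₂ (∈-A′⁻ c′ (proj₁ (below r)))) q e
    ... | inj₁ p | inj₂ (here refl) = let (y , r) = ∈⇒zipˡ (code-length c) p in
      not-suc (proj₁ (∈-A′⁻ c′ (proj₁ (below r)))) (trans (+-comm a m) e)
    ... | inj₂ (here refl) | inj₁ q = not-suc (B≥2 q) e
    ... | inj₂ (here refl) | inj₂ (here refl) = not-suc 2≤m e

    disjoint-values : ∀ {v w} → v ∈ map pred (As ++ m ∷ []) → w ∈ map pred (Bs ++ m ∷ []) → suc (v + w) ≢ m
    disjoint-values {v} {w} v∈ w∈ e = disjoint-A⁺B⁺ (proj₂ (proj₂ (pred-A⁺ c) v∈)) (proj₂ (proj₂ (pred-A⁺ c′) w∈))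
      (cong suc (trans (+-suc w v) (trans (cong suc (+-comm w v)) e)))

    module W = Listing m (0 ∷ Ds) (0 ∷ Es) (sorted⇒unique (code-sortedᵈ c)) (sorted⇒unique (code-sortedᵈ c′))
      (code-D⁺<n c) (code-D⁺<n c′) disjoint-positions
    module V = Listing m (map pred (As ++ m ∷ [])) (map pred (Bs ++ m ∷ [])) (proj₁ (pred-A⁺ c)) (proj₁ (pred-A⁺ c′))
      (λ v∈ → proj₁ (proj₂ (pred-A⁺ c) v∈)) (λ v∈ → proj₁ (proj₂ (pred-A⁺ c′) v∈)) disjoint-values

    len-S : length (0 ∷ Ds) ≡ length (map pred (As ++ m ∷ []))
    len-S = trans (code-peaks c) (sym (List.length-map pred (As ++ m ∷ [])))

    len-T : length (0 ∷ Es) ≡ length (map pred (Bs ++ m ∷ []))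
    len-T = trans (code-peaks c′) (sym (List.length-map pred (Bs ++ m ∷ [])))

    len-T̄ : length W.T̄ ≡ length V.T̄
    len-T̄ = trans (List.length-map _ (0 ∷ Es)) (trans len-T (sym (List.length-map _ (map pred (Bs ++ m ∷ [])))))

    len-rest : length W.rest ≡ length V.rest
    len-rest = +-cancelˡ-≡ (length (0 ∷ Es)) _ _ (+-cancelˡ-≡ (length (0 ∷ Ds)) _ _
      (trans W.all-length (trans (sym V.all-length) (sym (cong₂ (λ s t → s + (t + length V.rest)) len-S len-T)))))

    len-all : length W.all ≡ length V.all
    len-all = trans (List.length-++ (0 ∷ Ds)) (trans (cong₂ _+_ len-S
      (trans (List.length-++ W.T̄) (trans (cong₂ _+_ len-T̄ len-rest) (sym (List.length-++ V.T̄)))))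
      (sym (List.length-++ (map pred (As ++ m ∷ [])))))

    M : List (ℕ × ℕ)
    M = zip W.rest V.rest

    zip-all : zip W.all V.all ≡ zip (0 ∷ Ds) (map pred (As ++ m ∷ [])) ++ zip W.T̄ V.T̄ ++ M
    zip-all = trans (zip-++ (0 ∷ Ds) {ys = map pred (As ++ m ∷ [])} len-S)
      (cong (zip (0 ∷ Ds) (map pred (As ++ m ∷ [])) ++_) (zip-++ W.T̄ {ys = V.T̄} len-T̄))

  f g : ℕ → ℕ
  f = assoc W.all V.all
  g = assoc V.all W.all

  private
    f-pair : ∀ {i} → i < m → (i , f i) ∈ zip W.all V.all
    f-pair i<m = let (x , p) = ∈⇒zipˡ len-all (W.all⁺ i<m) in
      subst (λ y → (_ , y) ∈ zip W.all V.all) (sym (assoc-zip W.all-unique p)) p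

    g-pair : ∀ {v} → v < m → (g v , v) ∈ zip W.all V.all
    g-pair v<m = let (x , p) = ∈⇒zipʳ len-all (V.all⁺ v<m) in
      subst (λ y → (y , _) ∈ zip W.all V.all) (sym (assoc-zip V.all-unique (zip-swap W.all V.all p))) p

    f-of : ∀ {i v} → (i , v) ∈ zip (0 ∷ Ds) (map pred (As ++ m ∷ [])) ++ zip W.T̄ V.T̄ ++ M → f i ≡ v
    f-of p = assoc-zip W.all-unique (subst (_ ∈_) (sym zip-all) p)

  bijection : Bijection< m f g
  bijection = record
    { f< = λ i<m → V.all⁻ (zip-∈ʳ W.all V.all (f-pair i<m))
    ; g< = λ v<m → W.all⁻ (zip-∈ˡ W.all V.all (g-pair v<m))
    ; gf = λ i<m → assoc-zip V.all-unique (zip-swap W.all V.all (f-pair i<m))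
    ; fg = λ v<m → assoc-zip W.all-unique (g-pair v<m) }

  configuration : Configuration m As Ds Bs Es f M
  configuration = record
    { low-peak = λ {i} {b} p → low b p (f-of (∈-++⁺ˡ (zip-∈-mapʳ pred (0 ∷ Ds) (As ++ m ∷ []) p)))
    ; high-peak = high
    ; classify = λ {i} i<m → cls (subst ((i , f i) ∈_) zip-all (f-pair i<m))
    ; mid-pos = λ i∈ → W.rest⁻ (subst (_ ∈_) (map-proj₁-zip W.rest V.rest len-rest) i∈)
    ; mid-val = λ v<m v∉ h → subst (_ ∈_) (sym (map-proj₂-zip W.rest V.rest len-rest)) (V.rest⁺ v<m v∉ h)
    ; mid-unique = subst Unique (sym (map-proj₁-zip W.rest V.rest len-rest)) (sorted⇒unique W.rest-sorted)
    ; mid-mono = zip-comonotone W.rest-sorted V.rest-sorted }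
    where
    low : ∀ {i} b → (i , b) ∈ zip (0 ∷ Ds) (As ++ m ∷ []) → f i ≡ pred b → suc (f i) ≡ b
    low zero p _ = contradiction (peak-above₀ 2≤m c p) λ ()
    low (suc b) p e = cong suc e
    high : ∀ {e b} → (e , b) ∈ zip (0 ∷ Es) (Bs ++ m ∷ []) → ∀ i → suc (i + e) ≡ m → f i + b ≡ m
    high {e} {zero} p i eq = contradiction (peak-above₀ 2≤m c′ p) λ ()
    high {e} {suc w} p i eq = trans (cong (_+ suc w) (f-of (∈-++⁺ʳ (zip (0 ∷ Ds) (map pred (As ++ m ∷ []))) (∈-++⁺ˡ q′))))
      (m∸n+n≡m (proj₁ (proj₂ (pred-A⁺ c′) (zip-∈ʳ (0 ∷ Es) (map pred (Bs ++ m ∷ [])) q))))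
      where
      q : (e , w) ∈ zip (0 ∷ Es) (map pred (Bs ++ m ∷ []))
      q = zip-∈-mapʳ pred (0 ∷ Es) (Bs ++ m ∷ []) p
      q′ : (i , m ∸ suc w) ∈ zip W.T̄ V.T̄
      q′ = subst (λ k → (k , m ∸ suc w) ∈ zip W.T̄ V.T̄) (mirror-unique (mirror-comm i e eq))
        (subst (_ ∈_) (sym (zip-map (λ t → m ∸ suc t) (λ t → m ∸ suc t) (0 ∷ Es) (map pred (Bs ++ m ∷ []))))
          (∈-map⁺ (λ (x , y) → m ∸ suc x , m ∸ suc y) q))
    cls : ∀ {i v} → (i , v) ∈ zip (0 ∷ Ds) (map pred (As ++ m ∷ [])) ++ zip W.T̄ V.T̄ ++ M →
      i ∈ 0 ∷ Ds ⊎ (∃[ e ] e ∈ 0 ∷ Es × suc (i + e) ≡ m) ⊎ (i , v) ∈ M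
    cls p with ∈-++⁻ (zip (0 ∷ Ds) (map pred (As ++ m ∷ []))) p
    ... | inj₁ q = inj₁ (zip-∈ˡ (0 ∷ Ds) (map pred (As ++ m ∷ [])) q)
    ... | inj₂ q with ∈-++⁻ (zip W.T̄ V.T̄) q
    ... | inj₁ r = inj₂ (inj₁ (W.T̄⁻ (zip-∈ˡ W.T̄ V.T̄ r)))
    ... | inj₂ r = inj₂ (inj₂ r)

record Realisation (n : ℕ) (P Q : Path) : Set where
  field
    f g f′    : ℕ → ℕ
    bijection : Bijection< n f g
    reversed  : ReverseComplement n f f′
    fit       : Fit P 0 0 D f
    fit′      : Fit Q 0 0 D f′

reverse-complement : ∀ {n f g} → Bijection< n f g → ReverseComplement n f (λ j → n ∸ suc (f (n ∸ suc j)))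
reverse-complement {n} {f} b {i} {j} e =
  trans (cong (λ k → suc (f i + (n ∸ suc (f k)))) (mirror-unique (mirror-comm i j e)))
    (mirror (Bijection<.f< b (≤-trans (s≤s (m≤m+n i j)) (≤-of e))))

realise-code : ∀ {m As Ds Bs Es} → Code m 0 0 As Ds → Code m 0 0 Bs Es → Below m Bs Es As Ds → Below m As Ds Bs Es →
  Realisation m (Z m 0 0 As Ds) (Z m 0 0 Bs Es)
realise-code {m} c c′ b b′ with m <? 2
... | no m≮2 = record
  { f = f ; g = g ; bijection = bijection ; reversed = rc
  ; fit = configuration-fit 2≤m c c′ b configuration (Bijection<.f< bijection)
  ; fit′ = configuration-fit 2≤m c′ c b′ (configuration-mirror c′ rc configuration) bound′ }
  where
  2≤m = ≮⇒≥ m≮2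
  open Construction 2≤m c c′ b
  rc = reverse-complement bijection
  bound′ : ∀ {j} → j < m → m ∸ suc (f (m ∸ suc j)) < m
  bound′ j<m = mirror-< (Bijection<.f< bijection (mirror-< j<m))
-- A single letter, at once minimum and maximum, so the two ends of the listing would overlap.
... | yes m<2 with code-1 m<2 c | code-1 m<2 c′
... | refl , refl , refl | refl , refl , _ = record
  { f = λ _ → 0 ; g = λ _ → 0 ; f′ = λ _ → 0
  ; bijection = record
    { f< = λ _ → s≤s z≤n ; g< = λ _ → s≤s z≤n ; gf = λ { (s≤s z≤n) → refl } ; fg = λ { (s≤s z≤n) → refl } }
  ; reversed = λ _ → refl ; fit = refl , _ ; fit′ = refl , _ }

Compatible : Path → Path → Set
Compatible P Q = L′ᵢ Q ≼ᵢ P × L′ᵢ P ≼ᵢ Q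

≼ᵢ⇒below : ∀ {m As Ds Bs Es} → Code m 0 0 As Ds → Code m 0 0 Bs Es →
  L′ᵢ (Z m 0 0 Bs Es) ≼ᵢ Z m 0 0 As Ds → Below m Bs Es As Ds
≼ᵢ⇒below {m} {As} {Ds} c c′ s p = ≼ᵢ⇒cnt (L′-code c′) c (subst (_≼ᵢ Z m 0 0 As Ds) (L′ᵢ-Z c′) s) p

realise-irr : ∀ {P Q} → Irr 0 P → Irr 0 Q → Compatible P Q → downs Q ≡ downs P × Realisation (downs P) P Q
realise-irr {P} {Q} p q with irr⇒Z p | irr⇒Z q
... | As , Ds , c , e | Bs , Es , c′ , e′ =
  subst₂ (λ P′ Q′ → Compatible P′ Q′ → downs Q ≡ downs P × Realisation (downs P) P′ Q′) (sym e) (sym e′) (go c c′)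
  where
  go : ∀ {m m′ As Ds Bs Es} → Code m 0 0 As Ds → Code m′ 0 0 Bs Es → Compatible (Z m 0 0 As Ds) (Z m′ 0 0 Bs Es) →
    m′ ≡ m × Realisation m (Z m 0 0 As Ds) (Z m′ 0 0 Bs Es)
  -- Both `L′ᵢ` and coverings preserve semilength, so comparability forces the two sizes to agree.
  go c c′ (s , s′) with trans (sym (Z-semilength (L′-code c′)))
                              (trans (cong semilength (sym (L′ᵢ-Z c′))) (trans (≼ᵢ-semilength s) (Z-semilength c)))
  ... | refl = refl , realise-code c c′ (≼ᵢ⇒below c c′ s) (≼ᵢ⇒below c′ c s′)

-- Gluing blocks

dyck-++ : ∀ {h P R} → DyckFrom h P → DyckFrom 0 R → DyckFrom h (P ++ R)
dyck-++ end      r = r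
dyck-++ (up p)   r = up (dyck-++ p r)
dyck-++ (down p) r = down (dyck-++ p r)

dyck-concat : ∀ {Ps} → All (Irr 0) Ps → DyckFrom 0 (concat Ps)
dyck-concat []       = end
dyck-concat (p ∷ ps) = dyck-++ (irr⇒dyck p) (dyck-concat ps)

all-reverse : ∀ {P : Path → Set} {Ps} → All P Ps → All P (reverse Ps)
all-reverse ps = All.tabulate (All.lookup ps ∘ Any.reverse⁻)

concat-reverse-∷ : ∀ (Q : Path) Qs → concat (reverse (Q ∷ Qs)) ≡ concat (reverse Qs) ++ Q
concat-reverse-∷ Q Qs = trans (cong concat (List.unfold-reverse Q Qs))
  (trans (sym (List.concat-++ (reverse Qs) (Q ∷ []))) (cong (concat (reverse Qs) ++_) (List.++-identityʳ Q)))

-- The skew sum of permutations: since `f` counts from the largest letter, the first block receives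
-- the largest letters.
join : ℕ → (ℕ → ℕ) → (ℕ → ℕ) → ℕ → ℕ
join m f₁ f₂ i with i <? m
... | yes _ = f₁ i
... | no _  = m + f₂ (i ∸ m)

join-< : ∀ {m f₁ f₂ i} → i < m → join m f₁ f₂ i ≡ f₁ i
join-< {m} {i = i} i<m with i <? m
... | yes _  = refl
... | no i≮m = contradiction i<m i≮m

join-+ : ∀ m {f₁ f₂} i → join m f₁ f₂ (m + i) ≡ m + f₂ i
join-+ m {f₂ = f₂} i with m + i <? m
... | yes l = contradiction (m≤m+n m i) (<⇒≱ l)
... | no _  = cong (λ k → m + f₂ k) (m+n∸m≡n m i)

split : ∀ m {r i} → i < m + r → i < m ⊎ (∃[ k ] k < r × i ≡ m + k)
split m {r} {i} i< with i <? m
... | yes i<m = inj₁ i<m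
... | no i≮m  = inj₂ (i ∸ m , +-cancelˡ-< m _ _ (≤-trans (s≤s (≤-of e)) i<) , sym e)
  where
  e : m + (i ∸ m) ≡ i
  e = m+[n∸m]≡n (≮⇒≥ i≮m)

join-bound : ∀ m {r f₁ f₂} → (∀ {i} → i < m → f₁ i < m) → (∀ {i} → i < r → f₂ i < r) →
  ∀ {i} → i < m + r → join m f₁ f₂ i < m + r
join-bound m {r} {f₁} {f₂} b₁ b₂ i< with split m i<
... | inj₁ i<m = ≤-trans (s≤s (≤-of (join-< {m} {f₁} {f₂} i<m))) (≤-trans (b₁ i<m) (m≤m+n m r))
... | inj₂ (k , k<r , refl) = ≤-trans (s≤s (≤-of (join-+ m {f₁} {f₂} k))) (+-monoʳ-< m (b₂ k<r))

join-inverse : ∀ m {r f₁ f₂ g₁ g₂} → (∀ {i} → i < m → f₁ i < m) →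
  (∀ {i} → i < m → g₁ (f₁ i) ≡ i) → (∀ {i} → i < r → g₂ (f₂ i) ≡ i) →
  ∀ {i} → i < m + r → join m g₁ g₂ (join m f₁ f₂ i) ≡ i
join-inverse m {r} {f₁} {f₂} {g₁} {g₂} b₁ h₁ h₂ i< with split m i<
... | inj₁ i<m = trans (cong (join m g₁ g₂) (join-< {m} {f₁} {f₂} i<m)) (trans (join-< (b₁ i<m)) (h₁ i<m))
... | inj₂ (k , k<r , refl) = trans (cong (join m g₁ g₂) (join-+ m {f₁} {f₂} k))
  (trans (join-+ m {g₁} {g₂} (f₂ k)) (cong (m +_) (h₂ k<r)))

fit-++⁺ : ∀ {P R f₁ f₂} → DyckFrom 0 P → Fit P 0 0 D f₁ → Fit R 0 0 D f₂ → Fit (P ++ R) 0 0 D (join (downs P) f₁ f₂)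
fit-++⁺ {P} {R} {f₁} {f₂} p fit₁ fit₂ = Fit-++⁺ P
  (Fit-shift⁺ 0 P (λ j _ j< → join-< j<) fit₁)
  (subst₂ (λ c s → Fit R c (downs P) s (join (downs P) f₁ f₂)) (sym (dyck-ups≡downs p))
    (sym (dyck-lastStep p (inj₂ refl)))
    (subst (λ k → Fit R k k D (join (downs P) f₁ f₂)) (+-identityʳ (downs P))
      (Fit-shift⁺ (downs P) R (λ j _ _ → join-+ (downs P) j) fit₂)))

fit-++⁻ : ∀ {P R f f₂} → DyckFrom 0 P → (∀ j → j < downs R → f (downs P + j) ≡ downs P + f₂ j) →
  Fit (P ++ R) 0 0 D f → Fit P 0 0 D f × Fit R 0 0 D f₂
fit-++⁻ {P} {R} {f} {f₂} p h fit = let (q , r) = Fit-++⁻ P fit in q ,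
  Fit-shift⁻ (downs P) R (λ j _ → h j)
    (subst (λ k → Fit R k k D f) (sym (+-identityʳ (downs P)))
      (subst₂ (λ c s → Fit R c (downs P) s f) (dyck-ups≡downs p) (dyck-lastStep p (inj₂ refl)) r))

-- Reversal exchanges the order of the two blocks; this is the source of the reversed factors in
-- `L′`.
join-reverse-complement : ∀ m r {f₁ f₂ f₁′ f₂′} → ReverseComplement m f₁ f₁′ → ReverseComplement r f₂ f₂′ →
  ReverseComplement (m + r) (join m f₁ f₂) (join r f₂′ f₁′)
join-reverse-complement m r {f₁} {f₂} {f₁′} {f₂′} rc₁ rc₂ {i} {j} e with split m (≤-trans (s≤s (m≤m+n i j)) (≤-of e))
... | inj₂ (k , k<r , refl) = trans
    (cong suc (cong₂ _+_ (join-+ m {f₁} {f₂} k) (join-< {r} {f₂′} {f₁′} j<r)))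
    (trans (cong suc (+-assoc m (f₂ k) (f₂′ j))) (trans (sym (+-suc m _)) (cong (m +_) (rc₂ e′))))
  where
  e′ : suc (k + j) ≡ r
  e′ = +-cancelˡ-≡ m _ _ (trans (+-suc m (k + j)) (trans (cong suc (sym (+-assoc m k j))) e))
  j<r : j < r
  j<r = ≤-trans (s≤s (m≤n+m j k)) (≤-of e′)
... | inj₁ i<m with split r {m} {j} (≤-trans (≤-trans (s≤s (m≤n+m j i)) (≤-of e)) (≤-of (+-comm m r)))
...   | inj₁ j<r = contradiction
    (≤-trans (≥-of (+-suc (suc i) j)) (≤-trans (+-mono-≤ i<m j<r) (≥-of e))) 1+n≰n
...   | inj₂ (k , k<m , refl) = trans
    (cong suc (cong₂ _+_ (join-< {m} {f₁} {f₂} i<m) (join-+ r {f₂′} {f₁′} k)))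
    (trans (arith (f₁ i) (f₁′ k)) (cong (_+ r) (rc₁ e′)))
  where
  arith : ∀ a b → suc (a + (r + b)) ≡ suc (a + b) + r
  arith a b = cong suc (trans (cong (a +_) (+-comm r b)) (sym (+-assoc a b r)))
  e′ : suc (i + k) ≡ m
  e′ = +-cancelʳ-≡ r _ _ (trans (sym (arith i k)) e)

realise-++ : ∀ {P R Q S} → DyckFrom 0 P → DyckFrom 0 R → DyckFrom 0 S → downs Q ≡ downs P → downs S ≡ downs R →
  Realisation (downs P) P Q → Realisation (downs R) R S → Realisation (downs P + downs R) (P ++ R) (S ++ Q)
realise-++ {P} {R} {Q} {S} p r s eQ eS ρ₁ ρ₂ = record
  { f = join m ρ₁.f ρ₂.f ; g = join m ρ₁.g ρ₂.g ; f′ = join n ρ₂.f′ ρ₁.f′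
  ; bijection = record
    { f< = join-bound m b₁.f< b₂.f< ; g< = join-bound m b₁.g< b₂.g<
    ; gf = join-inverse m b₁.f< b₁.gf b₂.gf ; fg = join-inverse m b₁.g< b₁.fg b₂.fg }
  ; reversed = join-reverse-complement m n ρ₁.reversed ρ₂.reversed
  ; fit = fit-++⁺ p ρ₁.fit ρ₂.fit
  ; fit′ = subst (λ k → Fit (S ++ Q) 0 0 D (join k ρ₂.f′ ρ₁.f′)) eS (fit-++⁺ s ρ₂.fit′ ρ₁.fit′) }
  where
  m = downs P
  n = downs R
  module ρ₁ = Realisation ρ₁
  module ρ₂ = Realisation ρ₂
  module b₁ = Bijection< ρ₁.bijection
  module b₂ = Bijection< ρ₂.bijection

realise : ∀ {Ps Qs} → All (Irr 0) Ps → All (Irr 0) Qs → Pointwise Compatible Ps Qs →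
  downs (concat (reverse Qs)) ≡ downs (concat Ps) × Realisation (downs (concat Ps)) (concat Ps) (concat (reverse Qs))
realise [] [] [] = refl , record
  { f = id ; g = id ; f′ = id ; bijection = record { f< = id ; g< = id ; gf = λ _ → refl ; fg = λ _ → refl }
  ; reversed = λ () ; fit = _ ; fit′ = _ }
realise {P ∷ Ps} {Q ∷ Qs} (p ∷ ps) (q ∷ qs) (pq ∷ pqs) with realise-irr p q pq | realise ps qs pqs
... | e , ρ | e′ , ρ′ rewrite concat-reverse-∷ Q Qs | downs-++ P (concat Ps) | downs-++ (concat (reverse Qs)) Q =
  trans (cong₂ _+_ e′ e) (+-comm _ (downs P)) ,
  realise-++ (irr⇒dyck p) (dyck-concat ps) (dyck-concat (all-reverse qs)) e e′ ρ ρ′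

-- Cutting a permutation into blocks

compatible-irr : ∀ {P Q f f′} → Irr 0 P → Irr 0 Q → downs Q ≡ downs P →
  Injective< (downs P) f → Injective< (downs P) f′ → ReverseComplement (downs P) f f′ →
  Fit P 0 0 D f → Fit Q 0 0 D f′ → Compatible P Q
compatible-irr {P} {Q} {f} {f′} p q eq inj inj′ rc with irr⇒Z p | irr⇒Z q
... | As , Ds , c , e | Bs , Es , c′ , e′ =
  subst₂ (λ P′ Q′ → Fit P′ 0 0 D f → Fit Q′ 0 0 D f′ → Compatible P′ Q′) (sym e) (sym e′) (go eq c c′ inj inj′ rc)
  where
  go : ∀ {m m′ As Ds Bs Es} → m′ ≡ m → Code m 0 0 As Ds → Code m′ 0 0 Bs Es →
    Injective< m f → Injective< m f′ → ReverseComplement m f f′ →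
    Fit (Z m 0 0 As Ds) 0 0 D f → Fit (Z m′ 0 0 Bs Es) 0 0 D f′ → Compatible (Z m 0 0 As Ds) (Z m′ 0 0 Bs Es)
  go refl c c′ inj inj′ rc fit fit′ = L′≼ᵢ c c′ inj inj′ rc fit fit′ ,
    L′≼ᵢ c′ c inj′ inj (reverse-complement-sym {f = f} {f′} rc) fit′ fit

-- Inside an irreducible component `f` preserves no proper nonempty initial segment: the peak over
-- `k` is a witness.
irr-exceeds : ∀ {P f} → Irr 0 P → Fit P 0 0 D f → ∀ k → 0 < k → k < downs P → ∃[ i ] i < k × k ≤ f i
irr-exceeds {P} {f} p fit k 0<k k<m with irr⇒Z p
... | As , Ds , c , e with peak-over c k 0<k k<m
... | i , b , q , i<k , k<b =
  i , i<k , s≤s⁻¹ (≤-trans k<b (≥-of (fit-Z-peak c (subst (λ P → Fit P 0 0 D f) e fit) q)))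

-- The positions below `m` already use up all values below `m`.
pigeonhole : ∀ {n m f} → Injective< n f → m ≤ n → (∀ {i} → i < m → f i < m) → ∀ {i} → m ≤ i → i < n → m ≤ f i
pigeonhole {n} {m} {f} inj m≤n low {i} m≤i i<n with f i <? m
... | no fi≮m  = ≮⇒≥ fi≮m
... | yes fi<m = contradiction (≤-trans (≥-of (trans (List.length-map f (i ∷ upTo m)) (cong suc (List.length-upTo m))))
        (≤-trans (card uniq sub) (≤-of (List.length-upTo m)))) 1+n≰n
  where
  <n : ∀ {j} → j ∈ i ∷ upTo m → j < n
  <n (here refl) = i<n
  <n (there j∈)  = <-≤-trans (∈-upTo⁻ j∈) m≤n
  uniq : Unique (map f (i ∷ upTo m))
  uniq = unique-map f (unique-∷ (λ i∈ → <⇒≱ (∈-upTo⁻ i∈) m≤i) (Unique.upTo⁺ m))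
    λ p q → Injective<.injective inj (<n p) (<n q)
  sub : ∀ {z} → z ∈ map f (i ∷ upTo m) → z ∈ upTo m
  sub z∈ with ∈-map⁻ f z∈
  ... | j , here refl , refl = ∈-upTo⁺ fi<m
  ... | j , there j∈ , refl = ∈-upTo⁺ (low (∈-upTo⁻ j∈))

window : ℕ → (ℕ → ℕ) → ℕ → ℕ
window m f i = f (m + i) ∸ m

module _ {m r f} (inj : Injective< (m + r) f) (low : ∀ {i} → i < m → f i < m) where

  window-+ : ∀ i → i < r → f (m + i) ≡ m + window m f i
  window-+ i i<r = sym (m+[n∸m]≡n (pigeonhole inj (m≤m+n m r) low (m≤m+n m i) (+-monoʳ-< m i<r)))

  low-injective : Injective< m f
  low-injective = record
    { bounded = low
    ; injective = λ p q → Injective<.injective inj (≤-trans p (m≤m+n m r)) (≤-trans q (m≤m+n m r)) }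

  window-injective : Injective< r (window m f)
  window-injective = record
    { bounded = λ {i} p → +-cancelˡ-< m _ _ (≤-trans (s≤s (≥-of (window-+ i p))) (Injective<.bounded inj (+-monoʳ-< m p)))
    ; injective = λ {i} {j} p q e → +-cancelˡ-≡ m _ _ (Injective<.injective inj (+-monoʳ-< m p) (+-monoʳ-< m q)
        (trans (window-+ i p) (trans (cong (m +_) e) (sym (window-+ j q))))) }

  window-reverse-complement : ∀ {f′} → ReverseComplement (m + r) f f′ → ReverseComplement r (window m f) f′
  window-reverse-complement {f′} rc {i} {j} e = +-cancelˡ-≡ m _ _ (trans (+-suc m _)
    (trans (cong suc (trans (sym (+-assoc m _ (f′ j))) (cong (_+ f′ j) (sym (window-+ i i<r)))))
      (rc (trans (cong suc (+-assoc m i j)) (trans (sym (+-suc m (i + j))) (cong (m +_) e))))))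
    where
    i<r : i < r
    i<r = ≤-trans (s≤s (m≤m+n i j)) (≤-of e)

irr-downs>0 : ∀ {h P} → Irr h P → 0 < downs P
irr-downs>0 last     = s≤s z≤n
irr-downs>0 (up p)   = irr-downs>0 p
irr-downs>0 (down p) = s≤s z≤n

-- `P` makes `f` preserve the first `downs P` positions, and `S`, seen through the mirror, makes it
-- preserve the first `downs Q`. If the numbers differed, the longer block, coming from an
-- irreducible path, would contain a preserved shorter one, against `irr-exceeds`.
compatible-first : ∀ {P R Q S f f′} → Irr 0 P → DyckFrom 0 R → Irr 0 Q → DyckFrom 0 S →
  downs S + downs Q ≡ downs P + downs R →
  Injective< (downs P + downs R) f → Injective< (downs S + downs Q) f′ → ReverseComplement (downs P + downs R) f f′ →
  Fit (P ++ R) 0 0 D f → Fit (S ++ Q) 0 0 D f′ → downs Q ≡ downs P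
compatible-first {P} {R} {Q} {S} {f} {f′} p r q s e inj inj′ rc fit fit′ =
  ≤-antisym (≮⇒≥ m≮m′) (≮⇒≥ m′≮m)
  where
  m  = downs P
  m′ = downs Q
  n  = downs R
  n′ = downs S
  low : ∀ {i} → i < m → f i < m
  low i<m = ≤-trans (Fit-bound P (proj₁ (Fit-++⁻ P fit)) _ z≤n i<m) (≤-of (dyck-ups≡downs (irr⇒dyck p)))
  low′ : ∀ {i} → i < n′ → f′ i < n′
  low′ i<n′ = ≤-trans (Fit-bound S (proj₁ (Fit-++⁻ S fit′)) _ z≤n i<n′)
    (≤-of (dyck-ups≡downs s))
  fitᴾ = proj₁ (Fit-++⁻ P fit)
  fitQ : Fit Q 0 0 D (window n′ f′)
  fitQ = proj₂ (fit-++⁻ s (window-+ inj′ low′) fit′)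
  rc′ : ∀ {i j} → suc (i + j) ≡ n′ + m′ → suc (f i + f′ j) ≡ n′ + m′
  rc′ eq = trans (rc (trans eq e)) (sym e)

  m′≮m : ¬ m′ < m
  m′≮m m′<m with irr-exceeds p fitᴾ m′ (irr-downs>0 q) m′<m
  ... | i , i<m′ , m′≤fi = linear-⊥ 0 (≤-of (rc′ (mirror i<)) ⊕ m′≤fi ⊕ high) (arith (f i) (f′ j) n′ m′)
    where
    i< : i < n′ + m′
    i< = ≤-trans i<m′ (m≤n+m m′ n′)
    j = n′ + m′ ∸ suc i
    j≥ : n′ ≤ j
    j≥ = m+n≤o⇒m≤o∸n n′ (+-monoʳ-≤ n′ i<m′)
    high : n′ ≤ f′ j
    high = pigeonhole inj′ (m≤m+n n′ m′) low′ j≥ (≤-trans (s≤s (m≤n+m j i)) (≤-of (mirror i<)))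
    arith : ∀ a b n m → suc (n + m + a + b) + 0 ≡ suc (a + b) + m + n
    arith = solve-∀

  m≮m′ : ¬ m < m′
  -- In the coordinates of `f′` the block of `P` begins `m′ ∸ m` positions into the component `Q`.
  m≮m′ m<m′ with irr-exceeds q fitQ (m′ ∸ m) (m<n⇒0<n∸m m<m′) (∸-monoʳ-< (irr-downs>0 p) (<⇒≤ m<m′))
  ... | i , i<k , k≤f′i = linear-⊥ 0
      (≤-of (rc′ (mirror-comm (n′ + i) j (mirror i<))) ⊕ high
        ⊕ ≤-trans (+-monoʳ-≤ n′ k≤f′i) (≥-of (window-+ inj′ low′ i i<m′)) ⊕ ≥-of k+m)
      (arith (f j) (f′ (n′ + i)) n′ m m′ (m′ ∸ m))
    where
    k+m : m′ ∸ m + m ≡ m′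
    k+m = m∸n+n≡m (<⇒≤ m<m′)
    i<m′ : i < m′
    i<m′ = <-≤-trans i<k (m∸n≤m m′ m)
    i< : n′ + i < n′ + m′
    i< = +-monoʳ-< n′ i<m′
    j = n′ + m′ ∸ suc (n′ + i)
    j≥ : m ≤ j
    j≥ = m+n≤o⇒m≤o∸n m (≤-trans (≤-of (arith′ m n′ i))
      (≤-trans (+-monoʳ-≤ n′ (+-monoˡ-≤ m i<k)) (+-monoʳ-≤ n′ (≤-of k+m))))
      where
      arith′ : ∀ m n i → m + suc (n + i) ≡ n + (suc i + m)
      arith′ = solve-∀
    high : m ≤ f j
    high = pigeonhole inj (m≤m+n m n) low j≥
      (≤-trans (s≤s (m≤m+n j (n′ + i))) (≤-trans (≤-of (mirror-comm (n′ + i) j (mirror i<))) (≤-of e)))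
    arith : ∀ a b n m m′ k → suc (n + m′ + a + b + (k + m)) + 0 ≡ suc (a + b) + m + (n + k) + m′
    arith = solve-∀

-- `Qs` lists the components of the second path from last to first, so that the two heads cover the
-- same letters. Splitting off this block cuts the beginning off `f` and the end off `f′`.
compatible : ∀ {n Ps Qs f f′} → All (Irr 0) Ps → All (Irr 0) Qs →
  downs (concat Ps) ≡ n → downs (concat (reverse Qs)) ≡ n →
  Injective< n f → Injective< n f′ → ReverseComplement n f f′ →
  Fit (concat Ps) 0 0 D f → Fit (concat (reverse Qs)) 0 0 D f′ → Pointwise Compatible Ps Qs
compatible [] [] _ _ _ _ _ _ _ = []
compatible {Qs = Q ∷ Qs} [] (q ∷ qs) refl e _ _ _ _ _
  rewrite concat-reverse-∷ Q Qs | downs-++ (concat (reverse Qs)) Q =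
  contradiction (≤-trans (irr-downs>0 q) (≤-trans (m≤n+m _ _) (≤-of e))) λ ()
compatible {Ps = P ∷ Ps} (p ∷ ps) [] e refl _ _ _ _ _ rewrite downs-++ P (concat Ps) =
  contradiction (≤-trans (irr-downs>0 p) (≤-trans (m≤m+n _ _) (≤-of e))) λ ()
compatible {Ps = P ∷ Ps} {Q ∷ Qs} {f} {f′} (p ∷ ps) (q ∷ qs) refl e inj inj′ rc fit fit′
  rewrite concat-reverse-∷ Q Qs | downs-++ (concat (reverse Qs)) Q | downs-++ P (concat Ps) =
  compatible-irr p q m′≡m (low-injective inj low)
    (subst (λ k → Injective< k (window n′ f′)) m′≡m (window-injective inj″ low′))
    (reverse-complement-sym {f = window n′ f′} {f} (subst (λ k → ReverseComplement k (window n′ f′) f) m′≡m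
      (window-reverse-complement inj″ low′ {f} (reverse-complement-sym {f = f} {f′} rc″))))
    (proj₁ (fit-++⁻ {f₂ = window m f} (irr⇒dyck p) (window-+ inj low) fit))
    (proj₂ (fit-++⁻ s (window-+ inj″ low′) fit′))
  ∷ compatible ps qs refl n′≡n (window-injective inj low)
      (subst (λ k → Injective< k f′) n′≡n (low-injective inj″ low′))
      (window-reverse-complement inj low rc)
      (proj₂ (fit-++⁻ (irr⇒dyck p) (window-+ inj low) fit))
      (proj₁ (fit-++⁻ {f₂ = window n′ f′} s (window-+ inj″ low′) fit′))
  where
  s = dyck-concat (all-reverse qs)
  m  = downs P
  n  = downs (concat Ps)
  n′ = downs (concat (reverse Qs))
  inj″ : Injective< (n′ + downs Q) f′
  inj″ = subst (λ k → Injective< k f′) (sym e) inj′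
  rc″ : ReverseComplement (n′ + downs Q) f f′
  rc″ eq = trans (rc (trans eq e)) (sym e)
  m′≡m : downs Q ≡ m
  m′≡m = compatible-first p (dyck-concat ps) q s e inj inj″ rc fit fit′
  n′≡n : n′ ≡ n
  n′≡n = +-cancelʳ-≡ m _ _ (trans (cong (n′ +_) (sym m′≡m)) (trans e (+-comm m n)))
  low : ∀ {i} → i < m → f i < m
  low i<m = ≤-trans (Fit-bound P (proj₁ (Fit-++⁻ P fit)) _ z≤n i<m) (≤-of (dyck-ups≡downs (irr⇒dyck p)))
  low′ : ∀ {i} → i < n′ → f′ i < n′
  low′ i<n′ = ≤-trans (Fit-bound (concat (reverse Qs)) (proj₁ (Fit-++⁻ (concat (reverse Qs)) fit′)) _ z≤n i<n′)
    (≤-of (dyck-ups≡downs s))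

-- λ and μ as staircases

λ-exponents μ-exponents : ℕ → List (ℕ × List ℕ) → List (ℕ × ℕ)
λ-exponents m₀ []             = []
λ-exponents m₀ ((m , w) ∷ fs) = (m₀ ∸ m , length w + 1) ∷ λ-exponents m fs
μ-exponents M₀ []             = []
μ-exponents M₀ ((M , u) ∷ fs) = (M ∸ M₀ , length u + 1) ∷ μ-exponents M fs

mutual
  -- `λ-exponents` copies a local function that cannot be named here; as for `pathWithCode`, the `_`
  -- in the companion lemma is inferred from this one.
  λ-path-exponents : ∀ {n} (σ : Permutation′ n) → λ-path σ ≡ zigzag (λ-exponents (suc n) (ltrFactors σ))
  λ-path-exponents {n} σ with ltrFactors σ
  ... | []           = refl
  ... | (m , w) ∷ fs = cong ((replicate (suc n ∸ m) U ++ replicate (length w + 1) D) ++_) (λ-path-exponents′ σ m fs)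

  λ-path-exponents′ : ∀ {n} (σ : Permutation′ n) m fs → _ ≡ zigzag (λ-exponents m fs)
  λ-path-exponents′ σ m₀ [] = refl
  λ-path-exponents′ σ m₀ ((m , w) ∷ fs) =
    cong ((replicate (m₀ ∸ m) U ++ replicate (length w + 1) D) ++_) (λ-path-exponents′ σ m fs)

mutual
  μ-path-exponents : ∀ {n} (σ : Permutation′ n) → μ-path σ ≡ zigzag (μ-exponents 0 (rtlFactors σ))
  μ-path-exponents {n} σ with rtlFactors σ
  ... | []           = refl
  ... | (M , u) ∷ fs = cong ((replicate M U ++ replicate (length u + 1) D) ++_) (μ-path-exponents′ σ M fs)

  μ-path-exponents′ : ∀ {n} (σ : Permutation′ n) M fs → _ ≡ zigzag (μ-exponents M fs)
  μ-path-exponents′ σ M₀ [] = refl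
  μ-path-exponents′ σ M₀ ((M , u) ∷ fs) =
    cong ((replicate (M ∸ M₀) U ++ replicate (length u + 1) D) ++_) (μ-path-exponents′ σ M fs)

-- `c` is the least strict upper bound of the first `i` values. Being attained is what lets a new
-- left-to-right minimum be recognised by `c ≤ f i`.
RunningMax : (ℕ → ℕ) → ℕ → ℕ → Set
RunningMax f i c = (∀ j → j < i → f j < c) × (c ≡ 0 ⊎ (∃[ j ] j < i × suc (f j) ≡ c))

runningMax-0 : ∀ {f} → RunningMax f 0 0
runningMax-0 = (λ _ ()) , inj₁ refl

runningMax-record : ∀ {f i c} → RunningMax f i c → c ≤ f i → RunningMax f (suc i) (suc (f i))
runningMax-record {i = i} (bound , _) c≤ =
  (λ j j< → [ (λ j<i → <-trans (<-≤-trans (bound j j<i) c≤) (n<1+n _)) , (λ { refl → n<1+n _ }) ]′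
    (m≤n⇒m<n∨m≡n (s≤s⁻¹ j<))) ,
  inj₂ (i , n<1+n i , refl)

runningMax-keep : ∀ {f i c} → RunningMax f i c → f i < c → RunningMax f (suc i) c
runningMax-keep {i = i} (bound , attained) l =
  (λ j j< → [ bound j , (λ { refl → l }) ]′ (m≤n⇒m<n∨m≡n (s≤s⁻¹ j<))) ,
  [ inj₁ , (λ (j , j<i , e) → inj₂ (j , m≤n⇒m≤1+n j<i , e)) ]′ attained

record⇒≤ : ∀ {f i c} → RunningMax f i c → (∀ j → j < i → f j < f i) → c ≤ f i
record⇒≤ (_ , inj₁ refl) h = z≤n
record⇒≤ (_ , inj₂ (j , j<i , refl)) h = h j j<i

staircase-record : ∀ {f c} i k → c ≤ f i →
  staircase f c i (suc k) ≡ replicate (suc (f i) ∸ c) U ++ D ∷ staircase f (suc (f i)) (suc i) k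
staircase-record {f} {c} i k c≤ =
  cong (λ z → replicate (suc (f i) ∸ c) U ++ D ∷ staircase f z (suc i) k) (m≤n⇒m⊔n≡n (m≤n⇒m≤1+n c≤))

staircase-keep : ∀ {f c} i k → f i < c → staircase f c i (suc k) ≡ D ∷ staircase f c (suc i) k
staircase-keep {f} {c} i k l =
  cong₂ (λ u z → replicate u U ++ D ∷ staircase f z (suc i) k) (m≤n⇒m∸n≡0 l) (m≥n⇒m⊔n≡m l)

block : ∀ k (w : ℕ) R → (replicate k U ++ replicate (w + 1) D) ++ R ≡ replicate k U ++ D ∷ replicate w D ++ R
block k w R = trans (List.++-assoc (replicate k U) (replicate (w + 1) D) R)
  (cong (λ z → replicate k U ++ replicate z D ++ R) (+-comm w 1))

-- A path that starts with an up step leaves no room for letters before the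
-- first left-to-right minimum (after the last right-to-left maximum).
no-prefix : ∀ {f} n l R → replicate l D ++ R ≡ staircase f 0 0 n → R ≡ staircase f 0 0 n
no-prefix n       zero    R e = e
no-prefix zero    (suc _) R ()
no-prefix (suc n) (suc _) R ()

module _ {n} (σ : Permutation′ n) where

  module _ {f : ℕ → ℕ} (f-letter : ∀ k → f (toℕ k) + letter σ k ≡ n) where

    private
      fits : ∀ x y → toℕ (σ ⟨$⟩ʳ x) < toℕ (σ ⟨$⟩ʳ y) → f (toℕ y) < f (toℕ x)
      fits x y l = +-cancelʳ-< (letter σ x) _ _
        (≤-trans (+-monoʳ-< (f (toℕ y)) (s≤s l)) (≤-of (trans (f-letter y) (sym (f-letter x)))))

      fits⁻ : ∀ x y → f (toℕ y) < f (toℕ x) → toℕ (σ ⟨$⟩ʳ x) < toℕ (σ ⟨$⟩ʳ y)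
      fits⁻ x y l = s≤s⁻¹ (+-cancelˡ-< (f (toℕ y)) _ _
        (≤-trans (+-monoˡ-< (letter σ x) l) (≤-of (trans (f-letter x) (sym (f-letter y))))))

      gap : ∀ x c → suc n ∸ c ∸ letter σ x ≡ suc (f (toℕ x)) ∸ c
      gap x c = trans (∸-+-assoc (suc n) c (letter σ x)) (trans
        (cong₂ _∸_ (trans (cong suc (sym (f-letter x))) (+-comm (suc (f (toℕ x))) (letter σ x)))
          (+-comm c (letter σ x)))
        ([m+n]∸[m+o]≡n∸o (letter σ x) (suc (f (toℕ x))) c))

      letter≡ : ∀ x → letter σ x ≡ suc n ∸ suc (f (toℕ x))
      letter≡ x = sym (trans (cong (_∸ f (toℕ x)) (sym (f-letter x))) (m+n∸m≡n (f (toℕ x)) (letter σ x)))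

    -- The local fold function enters through its equation `spec`. As `foldr` builds from the right,
    -- the induction runs over the suffix from position `i`, for every running maximum `c` before
    -- it; `suc n ∸ c` is then the last minimum before the suffix, or `suc n` if there is none.
    ltr-invariant : (min? : ∀ i → Dec (IsLTRMin σ i))
      (add : Fin n → List ℕ × List (ℕ × List ℕ) → List ℕ × List (ℕ × List ℕ)) →
      (∀ i w fs → add i (w , fs) ≡ (if does (min? i) then ([] , (letter σ i , w) ∷ fs) else (letter σ i ∷ w , fs))) →
      ∀ k i c (g : Fin k → Fin n) → (∀ j → toℕ (g j) ≡ i + toℕ j) → RunningMax f i c →
      let (w , fs) = foldr add ([] , []) (tabulate g) in
      replicate (length w) D ++ zigzag (λ-exponents (suc n ∸ c) fs) ≡ staircase f c i k
    ltr-invariant min? add spec zero i c g hg rm = refl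
    ltr-invariant min? add spec (suc k) i c g hg rm
      with foldr add ([] , []) (tabulate (g ∘ Fin.suc))
         | (λ c → ltr-invariant min? add spec k (suc i) c (g ∘ Fin.suc) (λ j → trans (hg (Fin.suc j)) (+-suc i (toℕ j))))
    ... | w , fs | ih
      rewrite spec (g Fin.zero) w fs with min? (g Fin.zero)
    ... | yes minimal = trans (block (suc n ∸ c ∸ letter σ x) (length w) _)
        (trans (cong₂ (λ u R → replicate u U ++ D ∷ R) (trans (gap x c) (cong (λ z → suc (f z) ∸ c) x≡i))
            (trans (cong (λ z → replicate (length w) D ++ zigzag (λ-exponents z fs))
                (trans (letter≡ x) (cong (λ z → suc n ∸ suc (f z)) x≡i)))
              (ih (suc (f i)) (runningMax-record rm c≤))))
          (sym (staircase-record i k c≤)))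
      where
      x = g Fin.zero
      x≡i : toℕ x ≡ i
      x≡i = trans (hg Fin.zero) (+-identityʳ i)
      c≤ : c ≤ f i
      c≤ = record⇒≤ rm λ j j<i →
        let j<n = <-trans j<i (subst (_< n) x≡i (Fin.toℕ<n x))
            e   = Fin.toℕ-fromℕ< j<n in
        subst₂ (λ a b → f a < f b) e x≡i (fits x (fromℕ< j<n) (minimal (fromℕ< j<n) (subst₂ _<_ (sym e) (sym x≡i) j<i)))
    ... | no ¬min = trans (cong (D ∷_) (ih c (runningMax-keep rm l))) (sym (staircase-keep i k l))
      where
      x = g Fin.zero
      x≡i : toℕ x ≡ i
      x≡i = trans (hg Fin.zero) (+-identityʳ i)
      l : f i < c
      l with f i <? c
      ... | yes l = l
      ... | no f≮c = contradiction (λ y y<x → fits⁻ x y (<-≤-trans (proj₁ rm (toℕ y) (≤-trans y<x (≤-of x≡i)))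
                (≤-trans (≮⇒≥ f≮c) (≥-of (cong f x≡i))))) ¬min

    λ-path≡staircase : λ-path σ ≡ staircase f 0 0 n
    λ-path≡staircase = trans (λ-path-exponents σ)
      (no-prefix n _ _ (ltr-invariant (isLTRMin? σ) _ (λ _ _ _ → refl) n 0 0 id (λ _ → refl) runningMax-0))

  module _ {f′ : ℕ → ℕ} (f′-letter : ∀ j k → suc (j + toℕ k) ≡ n → suc (f′ j) ≡ letter σ k) where

    -- `foldl` reads from the left while `f′` starts at the right end, so the invariant concerns the
    -- accumulator: after `i` letters it encodes the staircase from `r` on, where `r` letters are
    -- unread, for whatever running maximum `c` these will produce.
    rtl-invariant : (max? : ∀ i → Dec (IsRTLMax σ i))
      (add : List ℕ × List (ℕ × List ℕ) → Fin n → List ℕ × List (ℕ × List ℕ)) →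
      (∀ i u fs → add (u , fs) i ≡ (if does (max? i) then ([] , (letter σ i , u) ∷ fs) else (u ++ letter σ i ∷ [] , fs))) →
      ∀ k i (g : Fin k → Fin n) → (∀ j → toℕ (g j) ≡ i + toℕ j) → i + k ≡ n → ∀ s →
      (∀ r c → r + i ≡ n → RunningMax f′ r c →
        replicate (length (proj₁ s)) D ++ zigzag (μ-exponents c (proj₂ s)) ≡ staircase f′ c r i) →
      let (u , fs) = foldl add s (tabulate g) in
      replicate (length u) D ++ zigzag (μ-exponents 0 fs) ≡ staircase f′ 0 0 n
    rtl-invariant max? add spec zero i g hg i+k s inv with trans (sym (+-identityʳ i)) i+k
    ... | refl = inv 0 0 refl runningMax-0
    rtl-invariant max? add spec (suc k) i g hg i+k (u , fs) inv =
      rtl-invariant max? add spec k (suc i) (g ∘ Fin.suc) (λ j → trans (hg (Fin.suc j)) (+-suc i (toℕ j)))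
        (trans (sym (+-suc i k)) i+k) (add (u , fs) x) inv′
      where
      x = g Fin.zero
      x≡i : toℕ x ≡ i
      x≡i = trans (hg Fin.zero) (+-identityʳ i)
      inv′ : ∀ r c → r + suc i ≡ n → RunningMax f′ r c →
        replicate (length (proj₁ (add (u , fs) x))) D ++ zigzag (μ-exponents c (proj₂ (add (u , fs) x)))
          ≡ staircase f′ c r (suc i)
      inv′ r c e rm rewrite spec x u fs with max? x
      ... | yes maximal = trans (block (letter σ x ∸ c) (length u) _)
          (trans (cong₂ (λ v R → replicate (v ∸ c) U ++ D ∷ R) (sym letter≡)
              (trans (cong (λ z → replicate (length u) D ++ zigzag (μ-exponents z fs)) (sym letter≡))
                (inv (suc r) (suc (f′ r)) e′ (runningMax-record rm c≤))))
            (sym (staircase-record r i c≤)))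
        where
        e′ : suc r + i ≡ n
        e′ = trans (sym (+-suc r i)) e
        letter≡ : suc (f′ r) ≡ letter σ x
        letter≡ = f′-letter r x (trans (cong (λ z → suc (r + z)) x≡i) e′)
        c≤ : c ≤ f′ r
        c≤ = record⇒≤ rm λ j j<r →
          let j<n = ≤-trans j<r (≤-trans (m≤m+n r (suc i)) (≤-of e))
              y   = fromℕ< (mirror-< j<n)
              y≡  = Fin.toℕ-fromℕ< (mirror-< j<n)
              y>x = ≤-trans (s≤s (≤-of x≡i)) (≤-trans (m+n≤o⇒m≤o∸n (suc i)
                      (≤-trans (+-monoʳ-≤ (suc i) j<r) (≤-of (trans (+-comm (suc i) r) e)))) (≥-of y≡)) in
          s≤s⁻¹ (subst₂ _<_ (sym (f′-letter j y (trans (cong (λ z → suc (j + z)) y≡) (mirror j<n)))) (sym letter≡)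
            (s≤s (maximal y y>x)))
      ... | no ¬max = trans (trans (cong (λ z → replicate z D ++ zigzag (μ-exponents c fs))
            (trans (List.length-++ u) (+-comm (length u) 1)))
          (cong (D ∷_) (inv (suc r) c e′ (runningMax-keep rm l)))) (sym (staircase-keep r i l))
        where
        e′ : suc r + i ≡ n
        e′ = trans (sym (+-suc r i)) e
        letter≡ : suc (f′ r) ≡ letter σ x
        letter≡ = f′-letter r x (trans (cong (λ z → suc (r + z)) x≡i) e′)
        l : f′ r < c
        l with f′ r <? c
        ... | yes l = l
        ... | no f≮c = contradiction max ¬max
          where
          max : IsRTLMax σ x
          max y x<y = s≤s⁻¹ (subst₂ _<_ (f′-letter j y jy) letter≡ (s≤s (<-≤-trans (proj₁ rm j j<r) (≮⇒≥ f≮c))))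
            where
            j = n ∸ suc (toℕ y)
            jy : suc (j + toℕ y) ≡ n
            jy = mirror-comm (toℕ y) j (mirror (Fin.toℕ<n y))
            j<r : j < r
            j<r = +-cancelʳ-< (toℕ y) j r (≤-trans (≤-of jy) (≤-trans (≥-of e) (+-monoʳ-≤ r (≤-trans (s≤s (≥-of x≡i)) x<y))))

    μ-path≡staircase : μ-path σ ≡ staircase f′ 0 0 n
    μ-path≡staircase = trans (μ-path-exponents σ)
      (no-prefix n _ _ (rtl-invariant (isRTLMax? σ) _ (λ _ _ _ → refl) n 0 id (λ _ → refl) refl ([] , []) λ _ _ _ _ → refl))

-- Passing between permutations and functions on numbers

extend : ∀ {n} → (Fin n → ℕ) → ℕ → ℕ
extend {n} h i with i <? n
... | yes i<n = h (fromℕ< i<n)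
... | no _    = 0

extend-toℕ : ∀ {n} (h : Fin n → ℕ) k → extend h (toℕ k) ≡ h k
extend-toℕ {n} h k with toℕ k <? n
... | yes p = cong h (Fin.fromℕ<-toℕ k p)
... | no p  = contradiction (Fin.toℕ<n k) p

realisation⇒permutation : ∀ {n P Q} → IsDyck n P → IsDyck n Q → Realisation n P Q →
  Σ[ α ∈ Permutation′ n ] (λ-path α ≡ P × μ-path α ≡ Q)
realisation⇒permutation {n} {P} {Q} dP dQ ρ = α ,
  trans (λ-path≡staircase α f-letter)
    (sym (trans (Fit⇒staircase P (IsDyck.dyck dP) fit) (cong (staircase f 0 0) (isDyck-downs dP)))) ,
  trans (μ-path≡staircase α f′-letter)
    (sym (trans (Fit⇒staircase Q (IsDyck.dyck dQ) fit′) (cong (staircase f′ 0 0) (isDyck-downs dQ))))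
  where
  open Realisation ρ
  open Bijection< bijection
  to from : Fin n → Fin n
  -- `f` counts letters from the largest, `Fin n` from the smallest; hence the reflection.
  to k   = fromℕ< (mirror-< (f< (Fin.toℕ<n k)))
  from v = fromℕ< (g< (mirror-< (Fin.toℕ<n v)))
  toℕ-to : ∀ k → toℕ (to k) ≡ n ∸ suc (f (toℕ k))
  toℕ-to k = Fin.toℕ-fromℕ< _
  toℕ-from : ∀ v → toℕ (from v) ≡ g (n ∸ suc (toℕ v))
  toℕ-from v = Fin.toℕ-fromℕ< _
  mirror² : ∀ {i} → i < n → n ∸ suc (n ∸ suc i) ≡ i
  mirror² {i} i<n = mirror-unique (mirror-comm i _ (mirror i<n))
  α : Permutation′ n
  α = permutation to from
    (λ v → Fin.toℕ-injective (trans (toℕ-to (from v)) (trans (cong (λ z → n ∸ suc (f z)) (toℕ-from v))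
      (trans (cong (λ z → n ∸ suc z) (fg (mirror-< (Fin.toℕ<n v)))) (mirror² (Fin.toℕ<n v))))))
    (λ k → Fin.toℕ-injective (trans (toℕ-from (to k)) (trans (cong (λ z → g (n ∸ suc z)) (toℕ-to k))
      (trans (cong g (mirror² (f< (Fin.toℕ<n k)))) (gf (Fin.toℕ<n k))))))
  f-letter : ∀ k → f (toℕ k) + letter α k ≡ n
  f-letter k = trans (cong (λ z → f (toℕ k) + suc z) (toℕ-to k)) (trans (+-suc _ _) (mirror (f< (Fin.toℕ<n k))))
  f′-letter : ∀ j k → suc (j + toℕ k) ≡ n → suc (f′ j) ≡ letter α k
  f′-letter j k e = cong suc (trans (sym (mirror-unique (reversed (mirror-comm j (toℕ k) e)))) (sym (toℕ-to k)))

module _ {n} (α : Permutation′ n) where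

  private
    f f′ : ℕ → ℕ
    f  = extend λ k → n ∸ letter α k
    -- In the reverse complement the larger letters correspond to the smaller letters of `α`, whose
    -- number is the letter minus one.
    f′ = extend λ k → toℕ (α ⟨$⟩ʳ opposite k)

    f-letter : ∀ k → f (toℕ k) + letter α k ≡ n
    f-letter k = trans (cong (_+ letter α k) (extend-toℕ (λ k → n ∸ letter α k) k)) (m∸n+n≡m (Fin.toℕ<n (α ⟨$⟩ʳ k)))

    f′-letter : ∀ j k → suc (j + toℕ k) ≡ n → suc (f′ j) ≡ letter α k
    f′-letter j k e = cong suc (trans (cong f′ (sym j≡)) (trans (extend-toℕ (λ k → toℕ (α ⟨$⟩ʳ opposite k)) (opposite k))
      (cong (λ k → toℕ (α ⟨$⟩ʳ k)) (Fin.opposite-involutive k))))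
      where
      j≡ : toℕ (opposite k) ≡ j
      j≡ = trans (Fin.opposite-prop k) (mirror-unique (mirror-comm j (toℕ k) e))

    at : ∀ {i} (i<n : i < n) → f i + letter α (fromℕ< i<n) ≡ n
    at i<n = subst (λ z → f z + letter α (fromℕ< i<n) ≡ n) (Fin.toℕ-fromℕ< i<n) (f-letter (fromℕ< i<n))

    rc : ReverseComplement n f f′
    rc {i} {j} e = trans (sym (+-suc (f i) (f′ j))) (trans (cong (f i +_) (f′-letter j (fromℕ< i<n)
        (trans (cong (λ z → suc (j + z)) (Fin.toℕ-fromℕ< i<n)) (mirror-comm i j e)))) (at i<n))
      where
      i<n : i < n
      i<n = ≤-trans (s≤s (m≤m+n i j)) (≤-of e)

    inj : Injective< n f
    inj = record
      { bounded = λ {i} i<n → ≤-trans (m<m+n (f i) (s≤s z≤n)) (≤-of (at i<n))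
      ; injective = λ {i} {j} i<n j<n e → Fin.fromℕ<-injective i j i<n j<n
          (α-injective (Fin.toℕ-injective (suc-injective (+-cancelˡ-≡ (f i) _ _
            (trans (at i<n) (sym (trans (cong (_+ letter α (fromℕ< j<n)) e) (at j<n)))))))) }
      where
      α-injective : ∀ {x y} → α ⟨$⟩ʳ x ≡ α ⟨$⟩ʳ y → x ≡ y
      α-injective {x} {y} e = trans (sym (inverseˡ α)) (trans (cong (α ⟨$⟩ˡ_) e) (inverseˡ α))

    inj′ : Injective< n f′
    inj′ = record
      { bounded = λ {j} j<n → ≤-trans (s≤s (m≤n+m (f′ j) _)) (≤-of (rc (mirror-comm j _ (mirror j<n))))
      ; injective = λ {i} {j} i<n j<n e → mirror-injective i<n j<n
          (Injective<.injective inj (mirror-< i<n) (mirror-< j<n)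
            (+-cancelʳ-≡ (f′ i) _ _ (suc-injective (trans (rc (mirror-comm i _ (mirror i<n)))
              (sym (trans (cong (λ z → suc (f (n ∸ suc j) + z)) e) (rc (mirror-comm j _ (mirror j<n))))))))) }

  permutation⇒compatible : ∀ {Ps Qs} → All (Irr 0) Ps → All (Irr 0) Qs →
    downs (concat Ps) ≡ n → downs (concat (reverse Qs)) ≡ n →
    λ-path α ≡ concat Ps → μ-path α ≡ concat (reverse Qs) → Pointwise Compatible Ps Qs
  permutation⇒compatible ps qs eP eQ eλ eμ = compatible ps qs eP eQ inj inj′ rc
    (subst (λ P → Fit P 0 0 D f) (trans (sym (λ-path≡staircase α f-letter)) eλ) (staircase-Fit f 0 0 n))
    (subst (λ P → Fit P 0 0 D f′) (trans (sym (μ-path≡staircase α f′-letter)) eμ) (staircase-Fit f′ 0 0 n))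

-- From components to arbitrary paths

L′ᵢ-irr : ∀ {P} → Irr 0 P → Irr 0 (L′ᵢ P)
L′ᵢ-irr p with irr⇒Z p
... | As , Ds , c , e = subst (Irr 0) (sym (trans (cong L′ᵢ e) (L′ᵢ-Z c))) (Z-irr₀ (L′-code c))

components-L′ : ∀ {Ps} → All (Irr 0) Ps → components (L′ (concat Ps)) ≡ reverse (map L′ᵢ Ps)
components-L′ {Ps} ps = trans (cong (λ Cs → components (concat (reverse (map L′ᵢ Cs)))) (components-concat ps))
  (components-concat (all-reverse (irrs ps)))
  where
  irrs : ∀ {Ps} → All (Irr 0) Ps → All (Irr 0) (map L′ᵢ Ps)
  irrs []       = []
  irrs (p ∷ ps) = L′ᵢ-irr p ∷ irrs ps

compatible⇒ : ∀ {Ps Qs} → Pointwise Compatible Ps Qs → Pointwise _≼ᵢ_ (map L′ᵢ Qs) Ps × Pointwise _≼ᵢ_ (map L′ᵢ Ps) Qs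
compatible⇒ [] = [] , []
compatible⇒ ((s , s′) ∷ ss) = let (t , t′) = compatible⇒ ss in s ∷ t , s′ ∷ t′

compatible⇐ : ∀ {Ps Qs} → Pointwise _≼ᵢ_ (map L′ᵢ Qs) Ps → Pointwise _≼ᵢ_ (map L′ᵢ Ps) Qs → Pointwise Compatible Ps Qs
compatible⇐ {[]}    {[]}    _        _          = []
compatible⇐ {_ ∷ _} {_ ∷ _} (s ∷ ss) (s′ ∷ ss′) = (s , s′) ∷ compatible⇐ ss ss′

-- With the second path written as `concat (reverse Qs)`, its image under `L′` has components in the
-- order of `Ps`. The other inequality comes out in reverse order on both sides and is reversed as a
-- whole.
≼-compatible : ∀ {Ps Qs} → All (Irr 0) Ps → All (Irr 0) Qs →
  (L′ (concat (reverse Qs)) ≼ concat Ps × L′ (concat Ps) ≼ concat (reverse Qs)) ⇔ Pointwise Compatible Ps Qs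
≼-compatible {Ps} {Qs} ps qs = mk⇔
  (λ (s , s′) → compatible⇐ (subst₂ (Pointwise _≼ᵢ_) e₁ (components-concat ps) s)
    (subst₂ (Pointwise _≼ᵢ_) (List.reverse-involutive _) (List.reverse-involutive Qs)
      (Pointwise.reverse⁺ (subst₂ (Pointwise _≼ᵢ_) (components-L′ ps) (components-concat (all-reverse qs)) s′))))
  (λ h → let (s , s′) = compatible⇒ h in
    subst₂ (Pointwise _≼ᵢ_) (sym e₁) (sym (components-concat ps)) s ,
    subst₂ (Pointwise _≼ᵢ_) (sym (components-L′ ps)) (sym (components-concat (all-reverse qs))) (Pointwise.reverse⁺ s′))
  where
  e₁ : components (L′ (concat (reverse Qs))) ≡ map L′ᵢ Qs
  e₁ = trans (components-L′ (all-reverse qs)) (trans (sym (List.reverse-map L′ᵢ (reverse Qs)))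
    (cong (map L′ᵢ) (List.reverse-involutive Qs)))

factors-theorem : ∀ {n Ps Qs} → All (Irr 0) Ps → All (Irr 0) Qs → IsDyck n (concat Ps) → IsDyck n (concat (reverse Qs)) →
  (Σ[ α ∈ Permutation′ n ] (λ-path α ≡ concat Ps × μ-path α ≡ concat (reverse Qs))) ⇔
  (L′ (concat (reverse Qs)) ≼ concat Ps × L′ (concat Ps) ≼ concat (reverse Qs))
factors-theorem {Ps = Ps} {Qs} ps qs dP dQ = mk⇔
  (λ (α , eλ , eμ) → Equivalence.from equiv
    (permutation⇒compatible α ps qs (isDyck-downs dP) (isDyck-downs dQ) eλ eμ))
  (λ h → realisation⇒permutation dP dQ
    (subst (λ k → Realisation k (concat Ps) (concat (reverse Qs))) (isDyck-downs dP)
      (proj₂ (realise ps qs (Equivalence.to equiv h)))))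
  where
  equiv = ≼-compatible ps qs

theorem7 : ∀ (n : ℕ) (P Q : Path) → IsDyck n P → IsDyck n Q →
    (Σ[ α ∈ Permutation′ n ] (λ-path α ≡ P × μ-path α ≡ Q)) ⇔ (L′ Q ≼ P × L′ P ≼ Q)
theorem7 n P Q dP dQ with decompose (IsDyck.dyck dP) | decompose (IsDyck.dyck dQ)
... | Ps , ps , refl | Qs , qs , refl =
  -- The factorisation is applied to `reverse Qs`; reversing it again restores `Q`.
  subst (λ Q → IsDyck n Q →
      (Σ[ α ∈ Permutation′ n ] (λ-path α ≡ concat Ps × μ-path α ≡ Q)) ⇔ (L′ Q ≼ concat Ps × L′ (concat Ps) ≼ Q))
    (cong concat (List.reverse-involutive Qs))
    (factors-theorem ps (all-reverse qs) dP) dQ
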